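{- Let $m,n$ be positive integers with $n>m^5$. Choose any linear inclusion $\mathbb{C}^{m^2}\subseteq \mathbb{C}^{mn^2}$ and use it to regard the permanent polynomial $\mathrm{perm}_m\in S^m\mathbb{C}^{m^2}$ as an element of $S^m\mathbb{C}^{mn^2}$, i.e. as a polynomial that involves only $m^2$ of the $mn^2$ variables. Then $\mathrm{perm}_m$ cannot be separated from $\mathrm{IMM}^m_n$ by the method of shifted partial derivatives; that is, for all choices of $e$ and $\tau$ (integers with $0\le e\le m$, $\tau\geq 0$), $$\dim \langle \partial^{=e}\,\mathrm{perm}_m\rangle_{=\tau}\ \leq\ \dim\langle \partial^{=e}\,\mathrm{IMM}^m_n\rangle_{=\tau},$$ where both spaces are computed in the polynomial ring in $mn^2$ variables, with $\mathrm{perm}_m,\mathrm{IMM}^m_n\in S^m\mathbb{C}^{mn^2}$.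
   Context: $S^d\mathbb{C}^N$ denotes the space of homogeneous polynomials of degree $d$ in $N$ variables over $\mathbb{C}$, and $S^e\mathbb{C}^{N*}$ the space of homogeneous constant-coefficient differential operators of order $e$, acting on $S^d\mathbb{C}^N$ when $e\le d$. For $p\in S^d\mathbb{C}^N$ and integers $0\le e\le d$, $\tau\ge 0$, the shifted partial derivative map is $$p_{(e,d-e)[\tau]}: S^e\mathbb{C}^{N*}\otimes S^\tau\mathbb{C}^N\to S^{d-e+\tau}\mathbb{C}^N,\qquad D\otimes q\mapsto q\,D(p),$$ and $\langle\partial^{=e}p\rangle_{=\tau}$ denotes its image, i.e. the linear span of all products $q\,D(p)$ with $D$ of order $e$ and $q$ homogeneous of degree $\tau$. $\mathrm{perm}_m\in S^m\mathbb{C}^{m^2}$ is the permanent of an $m\times m$ matrix of indeterminates: $\mathrm{perm}_m=\sum_{\sigma\in\mathfrak{S}_m}\prod_{i=1}^m x_{i,\sigma(i)}$. $\mathrm{IMM}^d_n\in S^d(\mathbb{C}^{dn^2})$ is the iterated matrix multiplication polynomial $(X_1,\dots,X_d)\mapsto \mathrm{trace}(X_1X_2\cdots X_d)$, where $X_1,\dots,X_d$ are $n\times n$ matrices of independent indeterminates. -}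

module Defs where

open import Algebra.Bundles using (CommutativeRing)
import Algebra.Definitions.RawMonoid
open import Algebra.Module.Bundles using (LeftModule)
open import Algebra.Module.Morphism.Structures using (module LeftModuleMorphisms)
import Algebra.Properties.AbelianGroup
import Algebra.Properties.CommutativeSemigroup
import Algebra.Properties.Group
import Algebra.Properties.Monoid.Mult
import Algebra.Properties.Monoid.Sum
import Algebra.Properties.Ring
import Algebra.Solver.Ring.NaturalCoefficients.Default
open import Data.Bool.Base using (if_then_else_)
open import Data.Empty using (⊥)
open import Data.Fin.Base as Fin using (Fin; combine; toℕ)
open import Data.Fin.Permutation using (Permutation′; _⟨$⟩ʳ_; id; insert)
import Data.Fin.Properties as Fin
open import Data.List.Base as List using (List; []; _∷_; [_])
open import Data.Nat.Base as ℕ using (ℕ; zero; suc; _∸_)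
import Data.Nat.Properties as ℕ
open import Data.Product.Base using (∃; Σ; _×_; _,_; proj₁; proj₂)
open import Data.Rational.Base as ℚ using (ℚ; 0ℚ; 1ℚ; ½; ∣_∣)
import Data.Rational.Properties as ℚ
open import Data.Vec.Base as Vec using (Vec; []; _∷_; _[_]%=_)
import Data.Vec.Properties as Vec
open import Function.Base using (_∘_)
open import Level using (0ℓ; _⊔_)
open import Relation.Binary.PropositionalEquality.Core
  using (_≡_; _≢_; refl; sym; trans; cong; cong₂; subst)
open import Relation.Nullary.Decidable using (Dec; yes; no; ⌊_⌋)
open import Relation.Nullary.Negation using (contradiction)
open import Relation.Unary using (Pred)

module CauchyReals where

  module Identities {c ℓ} (R : CommutativeRing c ℓ) where
    open CommutativeRing R
      using (_≈_; _+_; _*_; -_; _-_; +-group; +-abelianGroup; ring; +-commutativeSemigroup;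
             +-assoc; +-cong; +-congˡ; *-comm; -‿cong)
      renaming (sym to ≈-sym; trans to ≈-trans)
    open Algebra.Properties.Group +-group using (//-rightDividesˡ; \\-leftDividesʳ)
    open Algebra.Properties.AbelianGroup +-abelianGroup using (⁻¹-∙-comm)
    open Algebra.Properties.CommutativeSemigroup +-commutativeSemigroup using (interchange)
    open Algebra.Properties.Ring ring using (x[y-z]≈xy-xz)

    [p-q]+q : ∀ p q → (p - q) + q ≈ p
    [p-q]+q p q = //-rightDividesˡ q p

    [p-q]+[q-r] : ∀ p q r → (p - q) + (q - r) ≈ p - r
    [p-q]+[q-r] p q r = ≈-trans (+-assoc p (- q) (q - r)) (+-congˡ (\\-leftDividesʳ q (- r)))

    [p-q]+[r-s] : ∀ p q r s → (p - q) + (r - s) ≈ (p + r) - (q + s)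
    [p-q]+[r-s] p q r s = ≈-trans (interchange p (- q) r (- s)) (+-congˡ (⁻¹-∙-comm q s))

    p[r-s]+s[p-q] : ∀ p q r s → p * (r - s) + s * (p - q) ≈ p * r - q * s
    p[r-s]+s[p-q] p q r s = ≈-trans
      (+-cong (x[y-z]≈xy-xz p r s)
              (≈-trans (x[y-z]≈xy-xz s p q) (+-cong (*-comm s p) (-‿cong (*-comm s q)))))
      ([p-q]+[q-r] (p * r) (p * s) (q * s))

    -[p-q] : ∀ p q → - (p - q) ≈ - p - - q
    -[p-q] p q = ≈-sym (⁻¹-∙-comm p (- q))

  open Identities ℚ.+-*-commutativeRing
  open Algebra.Properties.AbelianGroup ℚ.+-0-abelianGroup using (⁻¹-anti-homo‿-)

  -- i ∈ K means that the index i lies in the K-th tail of I; this treats sequences and the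
  -- two-index families of the Cauchy condition uniformly.
  module Tails {I : Set} (_∈_ : I → ℕ → Set)
               (antitone : ∀ {i K L} → K ℕ.≤ L → i ∈ L → i ∈ K) where

    Vanishing : (I → ℚ) → Set
    Vanishing s = ∀ ε → 0ℚ ℚ.< ε → ∃ λ K → ∀ i → i ∈ K → ∣ s i ∣ ℚ.< ε

    Bounded : (I → ℚ) → Set
    Bounded b = ∃ λ B → 0ℚ ℚ.< B × ∃ λ K → ∀ i → i ∈ K → ∣ b i ∣ ℚ.≤ B

    vanishing-ext : ∀ {s t} → (∀ i → s i ≡ t i) → Vanishing s → Vanishing t
    vanishing-ext s≡t v ε ε>0 with v ε ε>0
    ... | K , s<ε = K , λ i i∈K → subst (λ x → ∣ x ∣ ℚ.< ε) (s≡t i) (s<ε i i∈K)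

    vanishing-0 : ∀ {s} → (∀ i → s i ≡ 0ℚ) → Vanishing s
    vanishing-0 s≡0 ε ε>0 = 0 , λ i _ → subst (λ x → ∣ x ∣ ℚ.< ε) (sym (s≡0 i)) ε>0

    vanishing-neg : ∀ {s} → Vanishing s → Vanishing (λ i → ℚ.- s i)
    vanishing-neg {s} v ε ε>0 with v ε ε>0
    ... | K , s<ε = K , λ i i∈K → subst (ℚ._< ε) (sym (ℚ.∣-p∣≡∣p∣ (s i))) (s<ε i i∈K)

    vanishing-+ : ∀ {s t} → Vanishing s → Vanishing t → Vanishing (λ i → s i ℚ.+ t i)
    vanishing-+ {s} {t} u v ε ε>0 = bound (u (½ ℚ.* ε) half>0) (v (½ ℚ.* ε) half>0)
      where
      half>0 : 0ℚ ℚ.< ½ ℚ.* ε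
      half>0 = ℚ.positive⁻¹ _ {{ℚ.pos*pos⇒pos ½ ε {{ℚ.positive ε>0}}}}
      halves : ½ ℚ.* ε ℚ.+ ½ ℚ.* ε ≡ ε
      halves = trans (sym (ℚ.*-distribʳ-+ ε ½ ½)) (ℚ.*-identityˡ ε)
      bound : (∃ λ K → ∀ i → i ∈ K → ∣ s i ∣ ℚ.< ½ ℚ.* ε) →
              (∃ λ K → ∀ i → i ∈ K → ∣ t i ∣ ℚ.< ½ ℚ.* ε) →
              ∃ λ K → ∀ i → i ∈ K → ∣ s i ℚ.+ t i ∣ ℚ.< ε
      bound (K , s<) (L , t<) = K ℕ.⊔ L , λ i i∈ →
        ℚ.≤-<-trans (ℚ.∣p+q∣≤∣p∣+∣q∣ (s i) (t i))
          (subst (∣ s i ∣ ℚ.+ ∣ t i ∣ ℚ.<_) halves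
            (ℚ.+-mono-< (s< i (antitone (ℕ.m≤m⊔n K L) i∈)) (t< i (antitone (ℕ.m≤n⊔m K L) i∈))))

    vanishing-* : ∀ {b s} → Bounded b → Vanishing s → Vanishing (λ i → b i ℚ.* s i)
    vanishing-* {b} {s} (B , B>0 , K , b≤B) v ε ε>0 = bound (v δ δ>0)
      where
      instance
        B-pos : ℚ.Positive B
        B-pos = ℚ.positive B>0
        B-nonNeg : ℚ.NonNegative B
        B-nonNeg = ℚ.pos⇒nonNeg B
        B-nonZero : ℚ.NonZero B
        B-nonZero = ℚ.pos⇒nonZero B
        ε-pos : ℚ.Positive ε
        ε-pos = ℚ.positive ε>0
        1/B-pos : ℚ.Positive (ℚ.1/ B)
        1/B-pos = ℚ.1/pos⇒pos B
      δ : ℚ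
      δ = ℚ.1/ B ℚ.* ε
      δ>0 : 0ℚ ℚ.< δ
      δ>0 = ℚ.positive⁻¹ _ {{ℚ.pos*pos⇒pos (ℚ.1/ B) ε}}
      Bδ≡ε : B ℚ.* δ ≡ ε
      Bδ≡ε = trans (sym (ℚ.*-assoc B (ℚ.1/ B) ε))
               (trans (cong (ℚ._* ε) (ℚ.*-inverseʳ B)) (ℚ.*-identityˡ ε))
      bound : (∃ λ L → ∀ i → i ∈ L → ∣ s i ∣ ℚ.< δ) → ∃ λ L → ∀ i → i ∈ L → ∣ b i ℚ.* s i ∣ ℚ.< ε
      bound (L , s<δ) = K ℕ.⊔ L , λ i i∈ →
        subst (ℚ._< ε) (sym (ℚ.∣p*q∣≡∣p∣*∣q∣ (b i) (s i)))
          (ℚ.≤-<-trans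
            (ℚ.*-monoʳ-≤-nonNeg ∣ s i ∣ {{ℚ.∣-∣-nonNeg (s i)}}
              (b≤B i (antitone (ℕ.m≤m⊔n K L) i∈)))
            (subst (B ℚ.* ∣ s i ∣ ℚ.<_) Bδ≡ε
              (ℚ.*-monoʳ-<-pos B (s<δ i (antitone (ℕ.m≤n⊔m K L) i∈)))))

  Tail : ℕ → ℕ → Set
  Tail n K = K ℕ.≤ n

  Tail² : ℕ × ℕ → ℕ → Set
  Tail² (m , n) K = K ℕ.≤ m × K ℕ.≤ n

  Tail²-antitone : ∀ {i K L} → K ℕ.≤ L → Tail² i L → Tail² i K
  Tail²-antitone K≤L (L≤m , L≤n) = ℕ.≤-trans K≤L L≤m , ℕ.≤-trans K≤L L≤n

  module Seq  = Tails Tail ℕ.≤-trans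
  module Seq² = Tails Tail² Tail²-antitone

  IsCauchy : (ℕ → ℚ) → Set
  IsCauchy s = ∀ ε → 0ℚ ℚ.< ε → ∃ λ K → ∀ m n → K ℕ.≤ m → K ℕ.≤ n → ∣ s m ℚ.- s n ∣ ℚ.< ε

  record ℝ : Set where
    constructor mkℝ
    field
      seq    : ℕ → ℚ
      cauchy : IsCauchy seq

  open ℝ

  infix 4 _≈ᵣ_
  _≈ᵣ_ : ℝ → ℝ → Set
  x ≈ᵣ y = ∀ ε → 0ℚ ℚ.< ε → ∃ λ K → ∀ n → K ℕ.≤ n → ∣ seq x n ℚ.- seq y n ∣ ℚ.< ε

  diff : (ℕ → ℚ) → ℕ × ℕ → ℚ
  diff s (m , n) = s m ℚ.- s n

  build : (s : ℕ → ℚ) → Seq².Vanishing (diff s) → ℝ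
  build s v = mkℝ s λ ε ε>0 → let (K , h) = v ε ε>0 in
    K , λ m n K≤m K≤n → h (m , n) (K≤m , K≤n)

  fromCauchy : ∀ x → Seq².Vanishing (diff (seq x))
  fromCauchy x ε ε>0 with cauchy x ε ε>0
  ... | K , h = K , λ { (m , n) (K≤m , K≤n) → h m n K≤m K≤n }

  bounded : ∀ x → Seq.Bounded (seq x)
  bounded x with cauchy x 1ℚ (ℚ.positive⁻¹ 1ℚ)
  ... | K , h = B , B>0 , K , λ n K≤n →
    subst (λ q → ∣ q ∣ ℚ.≤ B) ([p-q]+q (seq x n) (seq x K))
      (ℚ.≤-trans (ℚ.∣p+q∣≤∣p∣+∣q∣ (seq x n ℚ.- seq x K) (seq x K))
        (ℚ.+-monoˡ-≤ ∣ seq x K ∣ (ℚ.<⇒≤ (h n K K≤n ℕ.≤-refl))))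
    where
    B : ℚ
    B = 1ℚ ℚ.+ ∣ seq x K ∣
    B>0 : 0ℚ ℚ.< B
    B>0 = ℚ.positive⁻¹ B {{ℚ.pos+nonNeg⇒pos 1ℚ ∣ seq x K ∣ {{ℚ.∣-∣-nonNeg (seq x K)}}}}

  boundedˡ : ∀ x → Seq².Bounded (λ i → seq x (proj₁ i))
  boundedˡ x with bounded x
  ... | B , B>0 , K , h = B , B>0 , K , λ i p → h (proj₁ i) (proj₁ p)

  boundedʳ : ∀ x → Seq².Bounded (λ i → seq x (proj₂ i))
  boundedʳ x with bounded x
  ... | B , B>0 , K , h = B , B>0 , K , λ i p → h (proj₂ i) (proj₂ p)

  ≈ᵣ-pointwise : ∀ {x y} → (∀ n → seq x n ≡ seq y n) → x ≈ᵣ y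
  ≈ᵣ-pointwise {x} {y} h = Seq.vanishing-0 λ n →
    trans (cong (ℚ._- seq y n) (h n)) (ℚ.+-inverseʳ (seq y n))

  fromℚ : ℚ → ℝ
  fromℚ q = build (λ _ → q) (Seq².vanishing-0 λ _ → ℚ.+-inverseʳ q)

  infixl 6 _+ᵣ_
  infixl 7 _*ᵣ_
  infix  8 -ᵣ_

  _+ᵣ_ : ℝ → ℝ → ℝ
  x +ᵣ y = build (λ n → seq x n ℚ.+ seq y n)
    (Seq².vanishing-ext (λ { (m , n) → [p-q]+[r-s] (seq x m) (seq x n) (seq y m) (seq y n) })
      (Seq².vanishing-+ (fromCauchy x) (fromCauchy y)))

  _*ᵣ_ : ℝ → ℝ → ℝ
  x *ᵣ y = build (λ n → seq x n ℚ.* seq y n)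
    (Seq².vanishing-ext (λ { (m , n) → p[r-s]+s[p-q] (seq x m) (seq x n) (seq y m) (seq y n) })
      (Seq².vanishing-+ (Seq².vanishing-* (boundedˡ x) (fromCauchy y))
                        (Seq².vanishing-* (boundedʳ y) (fromCauchy x))))

  -ᵣ_ : ℝ → ℝ
  -ᵣ x = build (λ n → ℚ.- seq x n)
    (Seq².vanishing-ext (λ { (m , n) → -[p-q] (seq x m) (seq x n) })
      (Seq².vanishing-neg (fromCauchy x)))

  ℝ-ring : CommutativeRing 0ℓ 0ℓ
  ℝ-ring = record
    { Carrier = ℝ
    ; _≈_ = _≈ᵣ_
    ; _+_ = _+ᵣ_
    ; _*_ = _*ᵣ_
    ; -_ = -ᵣ_
    ; 0# = fromℚ 0ℚ
    ; 1# = fromℚ 1ℚ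
    ; isCommutativeRing = record
      { isRing = record
        { +-isAbelianGroup = record
          { isGroup = record
            { isMonoid = record
              { isSemigroup = record
                { isMagma = record
                  { isEquivalence = record
                    { refl = λ {x} → ≈ᵣ-pointwise {x} {x} (λ _ → refl)
                    ; sym = λ {x} {y} x≈y →
                        Seq.vanishing-ext (λ n → ⁻¹-anti-homo‿- (seq x n) (seq y n)) (Seq.vanishing-neg x≈y)
                    ; trans = λ {x} {y} {z} x≈y y≈z →
                        Seq.vanishing-ext (λ n → [p-q]+[q-r] (seq x n) (seq y n) (seq z n))
                          (Seq.vanishing-+ x≈y y≈z)
                    }
                  ; ∙-cong = λ {x} {x′} {y} {y′} x≈x′ y≈y′ →
                      Seq.vanishing-ext (λ n → [p-q]+[r-s] (seq x n) (seq x′ n) (seq y n) (seq y′ n))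
                        (Seq.vanishing-+ x≈x′ y≈y′)
                  }
                ; assoc = λ x y z → ≈ᵣ-pointwise {(x +ᵣ y) +ᵣ z} {x +ᵣ (y +ᵣ z)}
                    λ n → ℚ.+-assoc (seq x n) (seq y n) (seq z n)
                }
              ; identity =
                  (λ x → ≈ᵣ-pointwise {fromℚ 0ℚ +ᵣ x} {x} λ n → ℚ.+-identityˡ (seq x n)) ,
                  (λ x → ≈ᵣ-pointwise {x +ᵣ fromℚ 0ℚ} {x} λ n → ℚ.+-identityʳ (seq x n))
              }
            ; inverse =
                (λ x → ≈ᵣ-pointwise {(-ᵣ x) +ᵣ x} {fromℚ 0ℚ} λ n → ℚ.+-inverseˡ (seq x n)) ,
                (λ x → ≈ᵣ-pointwise {x +ᵣ (-ᵣ x)} {fromℚ 0ℚ} λ n → ℚ.+-inverseʳ (seq x n))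
            ; ⁻¹-cong = λ {x} {y} x≈y →
                Seq.vanishing-ext (λ n → -[p-q] (seq x n) (seq y n)) (Seq.vanishing-neg x≈y)
            }
          ; comm = λ x y → ≈ᵣ-pointwise {x +ᵣ y} {y +ᵣ x} λ n → ℚ.+-comm (seq x n) (seq y n)
          }
        ; *-cong = λ {x} {x′} {y} {y′} x≈x′ y≈y′ →
            Seq.vanishing-ext (λ n → p[r-s]+s[p-q] (seq x n) (seq x′ n) (seq y n) (seq y′ n))
              (Seq.vanishing-+ (Seq.vanishing-* (bounded x) y≈y′)
                               (Seq.vanishing-* (bounded y′) x≈x′))
        ; *-assoc = λ x y z → ≈ᵣ-pointwise {(x *ᵣ y) *ᵣ z} {x *ᵣ (y *ᵣ z)}
            λ n → ℚ.*-assoc (seq x n) (seq y n) (seq z n)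
        ; *-identity =
            (λ x → ≈ᵣ-pointwise {fromℚ 1ℚ *ᵣ x} {x} λ n → ℚ.*-identityˡ (seq x n)) ,
            (λ x → ≈ᵣ-pointwise {x *ᵣ fromℚ 1ℚ} {x} λ n → ℚ.*-identityʳ (seq x n))
        ; distrib =
            (λ x y z → ≈ᵣ-pointwise {x *ᵣ (y +ᵣ z)} {(x *ᵣ y) +ᵣ (x *ᵣ z)}
              λ n → ℚ.*-distribˡ-+ (seq x n) (seq y n) (seq z n)) ,
            (λ x y z → ≈ᵣ-pointwise {(y +ᵣ z) *ᵣ x} {(y *ᵣ x) +ᵣ (z *ᵣ x)}
              λ n → ℚ.*-distribʳ-+ (seq x n) (seq y n) (seq z n))
        }
      ; *-comm = λ x y → ≈ᵣ-pointwise {x *ᵣ y} {y *ᵣ x} λ n → ℚ.*-comm (seq x n) (seq y n)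
      }
    }

-- R[t]/(t² − u): the pair (a , b) stands for a + b t.
module Adjoin√ {c ℓ} (R : CommutativeRing c ℓ) (u : CommutativeRing.Carrier R) where
  open CommutativeRing R using
    ( Carrier; _≈_; _+_; _*_; -_; 0#; 1#; commutativeSemiring; +-cong; *-cong; *-congˡ; -‿cong
    ; +-assoc; +-comm; +-identityˡ; +-identityʳ; -‿inverseˡ; -‿inverseʳ )
    renaming (refl to ≈-refl; sym to ≈-sym; trans to ≈-trans)
  open Algebra.Solver.Ring.NaturalCoefficients.Default commutativeSemiring
    using (solve; _:=_; _:+_; _:*_; con)

  infixl 6 _⊕_
  infixl 7 _⊗_
  infix  8 ⊖_
  infix  4 _≋_

  _≋_ : Carrier × Carrier → Carrier × Carrier → Set ℓ
  (a , b) ≋ (c , d) = a ≈ c × b ≈ d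

  _⊕_ _⊗_ : Carrier × Carrier → Carrier × Carrier → Carrier × Carrier
  (a , b) ⊕ (c , d) = (a + c) , (b + d)
  (a , b) ⊗ (c , d) = (a * c + u * (b * d)) , (a * d + b * c)

  ⊖_ : Carrier × Carrier → Carrier × Carrier
  ⊖ (a , b) = (- a) , (- b)

  commutativeRing : CommutativeRing c ℓ
  commutativeRing = record
    { Carrier = Carrier × Carrier
    ; _≈_ = _≋_
    ; _+_ = _⊕_
    ; _*_ = _⊗_
    ; -_ = ⊖_
    ; 0# = 0# , 0#
    ; 1# = 1# , 0#
    ; isCommutativeRing = record
      { isRing = record
        { +-isAbelianGroup = record
          { isGroup = record
            { isMonoid = record
              { isSemigroup = record
                { isMagma = record
                  { isEquivalence = record
                    { refl = ≈-refl , ≈-refl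
                    ; sym = λ (p , q) → ≈-sym p , ≈-sym q
                    ; trans = λ (p , q) (p′ , q′) → ≈-trans p p′ , ≈-trans q q′
                    }
                  ; ∙-cong = λ (p , q) (p′ , q′) → +-cong p p′ , +-cong q q′
                  }
                ; assoc = λ (a , b) (c , d) (e , f) → +-assoc a c e , +-assoc b d f
                }
              ; identity = (λ (a , b) → +-identityˡ a , +-identityˡ b) ,
                           (λ (a , b) → +-identityʳ a , +-identityʳ b)
              }
            ; inverse = (λ (a , b) → -‿inverseˡ a , -‿inverseˡ b) ,
                        (λ (a , b) → -‿inverseʳ a , -‿inverseʳ b)
            ; ⁻¹-cong = λ (p , q) → -‿cong p , -‿cong q
            }
          ; comm = λ (a , b) (c , d) → +-comm a c , +-comm b d
          }
        ; *-cong = λ (p , q) (p′ , q′) →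
            +-cong (*-cong p p′) (*-congˡ (*-cong q q′)) , +-cong (*-cong p q′) (*-cong q p′)
        ; *-assoc = λ (a , b) (c , d) (e , f) →
            solve 7 (λ u a b c d e f →
              (a :* c :+ u :* (b :* d)) :* e :+ u :* ((a :* d :+ b :* c) :* f) :=
              a :* (c :* e :+ u :* (d :* f)) :+ u :* (b :* (c :* f :+ d :* e)))
              ≈-refl u a b c d e f ,
            solve 7 (λ u a b c d e f →
              (a :* c :+ u :* (b :* d)) :* f :+ (a :* d :+ b :* c) :* e :=
              a :* (c :* f :+ d :* e) :+ b :* (c :* e :+ u :* (d :* f)))
              ≈-refl u a b c d e f
        ; *-identity =
            (λ (a , b) →
              solve 3 (λ u a b → con 1 :* a :+ u :* (con 0 :* b) := a) ≈-refl u a b ,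
              solve 2 (λ a b → con 1 :* b :+ con 0 :* a := b) ≈-refl a b) ,
            (λ (a , b) →
              solve 3 (λ u a b → a :* con 1 :+ u :* (b :* con 0) := a) ≈-refl u a b ,
              solve 2 (λ a b → a :* con 0 :+ b :* con 1 := b) ≈-refl a b)
        ; distrib =
            (λ (a , b) (c , d) (e , f) →
              solve 7 (λ u a b c d e f →
                a :* (c :+ e) :+ u :* (b :* (d :+ f)) :=
                (a :* c :+ u :* (b :* d)) :+ (a :* e :+ u :* (b :* f))) ≈-refl u a b c d e f ,
              solve 6 (λ a b c d e f →
                a :* (d :+ f) :+ b :* (c :+ e) :=
                (a :* d :+ b :* c) :+ (a :* f :+ b :* e)) ≈-refl a b c d e f) ,
            (λ (a , b) (c , d) (e , f) →
              solve 7 (λ u a b c d e f →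
                (c :+ e) :* a :+ u :* ((d :+ f) :* b) :=
                (c :* a :+ u :* (d :* b)) :+ (e :* a :+ u :* (f :* b))) ≈-refl u a b c d e f ,
              solve 6 (λ a b c d e f →
                (c :+ e) :* b :+ (d :+ f) :* a :=
                (c :* b :+ d :* a) :+ (e :* b :+ f :* a)) ≈-refl a b c d e f)
        }
      ; *-comm = λ (a , b) (c , d) →
          solve 5 (λ u a b c d →
            a :* c :+ u :* (b :* d) := c :* a :+ u :* (d :* b)) ≈-refl u a b c d ,
          solve 4 (λ a b c d → a :* d :+ b :* c := c :* b :+ d :* a) ≈-refl a b c d
      }
    }

-- ℝ[√−1]
ℂ : CommutativeRing 0ℓ 0ℓ
ℂ = Adjoin√.commutativeRing CauchyReals.ℝ-ring (CauchyReals.-ᵣ CauchyReals.fromℚ 1ℚ)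

module LinearAlgebra {c ℓ m ℓm} (R : CommutativeRing c ℓ)
                     (V : LeftModule (CommutativeRing.ring R) m ℓm) where
  open CommutativeRing R using (Carrier; _≈_; 0#)
  open LeftModule V using (Carrierᴹ; _≈ᴹ_; 0ᴹ; _*ₗ_; +ᴹ-rawMonoid)
  open Algebra.Definitions.RawMonoid +ᴹ-rawMonoid using (sum)

  combination : ∀ {k} → (Fin k → Carrier) → (Fin k → Carrierᴹ) → Carrierᴹ
  combination a v = sum (λ i → a i *ₗ v i)

  LinearlyIndependent : ∀ {k} → (Fin k → Carrierᴹ) → Set (c ⊔ ℓ ⊔ ℓm)
  LinearlyIndependent v = ∀ a → combination a v ≈ᴹ 0ᴹ → ∀ i → a i ≈ 0#

  Span : ∀ {p} → Pred Carrierᴹ p → Pred Carrierᴹ (c ⊔ m ⊔ ℓm ⊔ p)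
  Span P x = ∃ λ k → Σ (Fin k → Carrier) λ a → Σ (Fin k → Carrierᴹ) λ v →
    (∀ i → P (v i)) × x ≈ᴹ combination a v

  -- dim W = k: the subspace W has a basis of k elements. This is a relation and not a
  -- function because bases cannot be computed when equality of scalars is undecidable.
  HasDimension : ∀ {p} → Pred Carrierᴹ p → ℕ → Set (c ⊔ ℓ ⊔ m ⊔ ℓm ⊔ p)
  HasDimension W k = Σ (Fin k → Carrierᴹ) λ b →
    (∀ i → W (b i)) × LinearlyIndependent b × (∀ x → W x → ∃ λ a → x ≈ᴹ combination a b)

-- Every permutation of Fin (suc n) is insert 0F j σ for exactly one pair (j , σ).
permutations : ∀ n → List (Permutation′ n)
permutations zero    = [ id ]
permutations (suc n) =
  List.concatMap (λ j → List.map (insert Fin.zero j) (permutations n)) (List.allFin (suc n))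

module Polynomials {c ℓ} (R : CommutativeRing c ℓ) where
  open CommutativeRing R
    renaming (refl to ≈-refl; sym to ≈-sym; trans to ≈-trans; setoid to ≈-setoid)
    hiding (zero)
  open Algebra.Properties.Monoid.Sum +-monoid using (sum; sum-cong-≋; sum-replicate; sum-replicate-zero)
  open Algebra.Definitions.RawMonoid +-rawMonoid using () renaming (_×_ to _×ᵣ_)
  open Algebra.Properties.Monoid.Mult +-monoid using (×-congʳ)
  open Algebra.Properties.Ring ring using (-0#≈0#)

  -- Homogeneous polynomials of degree d in N variables; coeff f α is the coefficient of
  -- the monomial with exponent vector α.
  record S (d N : ℕ) : Set (c ⊔ ℓ) where
    field
      coeff       : Vec ℕ N → Carrier
      homogeneous : ∀ α → Vec.sum α ≢ d → coeff α ≈ 0#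

  open S public

  private variable
    d e k M N : ℕ

  infix  4 _≈ₛ_
  infixl 6 _+ₛ_
  infixl 7 _·_ _•_
  infix  8 -ₛ_

  _≈ₛ_ : S d N → S d N → Set ℓ
  f ≈ₛ g = ∀ α → coeff f α ≈ coeff g α

  0ₛ : S d N
  0ₛ = record { coeff = λ _ → 0# ; homogeneous = λ _ _ → ≈-refl }

  _+ₛ_ : S d N → S d N → S d N
  f +ₛ g = record
    { coeff       = λ α → coeff f α + coeff g α
    ; homogeneous = λ α ≢d →
        ≈-trans (+-cong (homogeneous f α ≢d) (homogeneous g α ≢d)) (+-identityˡ 0#)
    }

  -ₛ_ : S d N → S d N
  -ₛ f = record
    { coeff       = λ α → - coeff f α
    ; homogeneous = λ α ≢d → ≈-trans (-‿cong (homogeneous f α ≢d)) -0#≈0#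
    }

  _•_ : Carrier → S d N → S d N
  a • f = record
    { coeff       = λ α → a * coeff f α
    ; homogeneous = λ α ≢d → ≈-trans (*-congˡ (homogeneous f α ≢d)) (zeroʳ a)
    }

  S-module : (d N : ℕ) → LeftModule ring (c ⊔ ℓ) ℓ
  S-module d N = record
    { Carrierᴹ = S d N
    ; _≈ᴹ_ = _≈ₛ_
    ; _+ᴹ_ = _+ₛ_
    ; _*ₗ_ = _•_
    ; 0ᴹ = 0ₛ
    ; -ᴹ_ = -ₛ_
    ; isLeftModule = record
      { isLeftSemimodule = record
        { +ᴹ-isCommutativeMonoid = record
          { isMonoid = record
            { isSemigroup = record
              { isMagma = record
                { isEquivalence = record
                  { refl  = λ α → ≈-refl
                  ; sym   = λ p α → ≈-sym (p α)
                  ; trans = λ p q α → ≈-trans (p α) (q α)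
                  }
                ; ∙-cong = λ p q α → +-cong (p α) (q α)
                }
              ; assoc = λ f g h α → +-assoc (coeff f α) (coeff g α) (coeff h α)
              }
            ; identity = (λ f α → +-identityˡ (coeff f α)) , (λ f α → +-identityʳ (coeff f α))
            }
          ; comm = λ f g α → +-comm (coeff f α) (coeff g α)
          }
        ; isPreleftSemimodule = record
          { *ₗ-cong      = λ p q α → *-cong p (q α)
          ; *ₗ-zeroˡ     = λ f α → zeroˡ (coeff f α)
          ; *ₗ-distribʳ  = λ f a b α → distribʳ (coeff f α) a b
          ; *ₗ-identityˡ = λ f α → *-identityˡ (coeff f α)
          ; *ₗ-assoc     = λ a b f α → *-assoc a b (coeff f α)
          ; *ₗ-zeroʳ     = λ a α → zeroʳ a
          ; *ₗ-distribˡ  = λ a f g α → distribˡ a (coeff f α) (coeff g α)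
          }
        }
      ; -ᴹ‿cong = λ p α → -‿cong (p α)
      ; -ᴹ‿inverse = (λ f α → -‿inverseˡ (coeff f α)) , (λ f α → -‿inverseʳ (coeff f α))
      }
    }

  sum-0 : ∀ N → Vec.sum (Vec.replicate N 0) ≡ 0
  sum-0 zero    = refl
  sum-0 (suc N) = sum-0 N

  sum-inc : (α : Vec ℕ N) (i : Fin N) → Vec.sum (α [ i ]%= suc) ≡ suc (Vec.sum α)
  sum-inc (a ∷ α) Fin.zero    = refl
  sum-inc (a ∷ α) (Fin.suc i) = trans (cong (a ℕ.+_) (sum-inc α i)) (ℕ.+-suc a (Vec.sum α))

  monomial : (α : Vec ℕ N) → Vec.sum α ≡ d → S d N
  monomial {d = d} α ≡d = record
    { coeff       = λ β → if ⌊ Vec.≡-dec ℕ._≟_ α β ⌋ then 1# else 0#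
    ; homogeneous = λ β ≢d → other β ≢d (Vec.≡-dec ℕ._≟_ α β)
    }
    where
    other : ∀ β → Vec.sum β ≢ d → (α≟β : Dec (α ≡ β)) → (if ⌊ α≟β ⌋ then 1# else 0#) ≈ 0#
    other β ≢d (yes refl) = contradiction ≡d ≢d
    other β ≢d (no _)     = ≈-refl

  1ₛ : S 0 N
  1ₛ {N} = monomial (Vec.replicate N 0) (sum-0 N)

  var : Fin N → S 1 N
  var {N} i = monomial (Vec.replicate N 0 [ i ]%= suc)
    (trans (sum-inc (Vec.replicate N 0) i) (cong suc (sum-0 N)))

  -- convolve p q α is the sum of p β * q γ over all β + γ = α.
  convolve : (Vec ℕ N → Carrier) → (Vec ℕ N → Carrier) → Vec ℕ N → Carrier
  convolve p q []      = p [] * q []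
  convolve p q (a ∷ α) =
    sum {suc a} λ i → convolve (p ∘ (toℕ i ∷_)) (q ∘ ((a ∸ toℕ i) ∷_)) α

  convolve-0 : (p q : Vec ℕ N → Carrier) (α : Vec ℕ N) →
               (∀ β γ → Vec.sum β ℕ.+ Vec.sum γ ≡ Vec.sum α → p β * q γ ≈ 0#) →
               convolve p q α ≈ 0#
  convolve-0 p q []      h = h [] [] refl
  convolve-0 p q (a ∷ α) h = ≈-trans
    (sum-cong-≋ λ i → convolve-0 (p ∘ (toℕ i ∷_)) (q ∘ ((a ∸ toℕ i) ∷_)) α λ β γ ≡α →
      h (toℕ i ∷ β) ((a ∸ toℕ i) ∷ γ)
        (trans (ℕ-interchange (toℕ i) (Vec.sum β) (a ∸ toℕ i) (Vec.sum γ))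
               (cong₂ ℕ._+_ (ℕ.m+[n∸m]≡n (ℕ.s≤s⁻¹ (Fin.toℕ<n i))) ≡α)))
    (sum-replicate-zero (suc a))
    where
    open Algebra.Properties.CommutativeSemigroup ℕ.+-commutativeSemigroup
      using () renaming (interchange to ℕ-interchange)

  _·_ : S d N → S e N → S (d ℕ.+ e) N
  _·_ {d} {N} {e} f g = record
    { coeff       = convolve (coeff f) (coeff g)
    ; homogeneous = λ α ≢d+e → convolve-0 (coeff f) (coeff g) α λ β γ ≡α →
        vanish β γ (λ { (refl , refl) → ≢d+e (sym ≡α) })
    }
    where
    vanish : ∀ β γ → (Vec.sum β ≡ d × Vec.sum γ ≡ e → ⊥) → coeff f β * coeff g γ ≈ 0#
    vanish β γ ¬both with Vec.sum β ℕ.≟ d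
    ... | no  ≢d   = ≈-trans (*-congʳ (homogeneous f β ≢d)) (zeroˡ (coeff g γ))
    ... | yes refl =
      ≈-trans (*-congˡ (homogeneous g γ λ ≡e → ¬both (refl , ≡e))) (zeroʳ (coeff f β))

  sumₛ : (Fin k → S d N) → S d N
  sumₛ {d = d} {N = N} = Algebra.Definitions.RawMonoid.sum (LeftModule.+ᴹ-rawMonoid (S-module d N))

  prodₛ : (Fin k → S 1 N) → S k N
  prodₛ {zero}  ℓ = 1ₛ
  prodₛ {suc k} ℓ = ℓ Fin.zero · prodₛ (ℓ ∘ Fin.suc)

  -- f = restrict f + x₀ · quotient f, where x₀ does not occur in restrict f.
  restrict : S d (suc N) → S d N
  restrict f = record
    { coeff       = λ α → coeff f (0 ∷ α)
    ; homogeneous = λ α → homogeneous f (0 ∷ α)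
    }

  quotient : S (suc d) (suc N) → S d (suc N)
  quotient f = record
    { coeff       = λ { (a ∷ α) → coeff f (suc a ∷ α) }
    ; homogeneous = λ { (a ∷ α) ≢d → homogeneous f (suc a ∷ α) (≢d ∘ ℕ.suc-injective) }
    }

  -- f(ℓ₀ , … , ℓₘ₋₁), for linear forms ℓᵢ.
  substitute : (Fin M → S 1 N) → S d M → S d N
  substitute {M}     {d = zero}  ℓ f = coeff f (Vec.replicate M 0) • 1ₛ
  substitute {zero}  {d = suc d} ℓ f = 0ₛ
  substitute {suc M} {d = suc d} ℓ f =
    substitute (ℓ ∘ Fin.suc) (restrict f) +ₛ ℓ Fin.zero · substitute ℓ (quotient f)

  -- The space S 1 N of linear forms is the N-dimensional space whose symmetric powers are the
  -- S d N, so an inclusion of spaces of linear forms turns S d M into a subspace of S d N.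
  IsLinearInclusion : (S 1 M → S 1 N) → Set (c ⊔ ℓ)
  IsLinearInclusion {M} {N} = LeftModuleMorphisms.IsLeftModuleMonomorphism
    (LeftModule.rawLeftModule (S-module 1 M)) (LeftModule.rawLeftModule (S-module 1 N))

  Sᵈ[_] : (S 1 M → S 1 N) → S d M → S d N
  Sᵈ[ ι ] = substitute (ι ∘ var)

  ∂ : Fin N → S (suc d) N → S d N
  ∂ i f = record
    { coeff       = λ α → suc (Vec.lookup α i) ×ᵣ coeff f (α [ i ]%= suc)
    ; homogeneous = λ α ≢d → ≈-trans
        (×-congʳ (suc (Vec.lookup α i))
          (homogeneous f (α [ i ]%= suc) λ ≡d →
            ≢d (ℕ.suc-injective (trans (sym (sum-inc α i)) ≡d))))
        (≈-trans (≈-sym (sum-replicate (suc (Vec.lookup α i))))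
                 (sum-replicate-zero (suc (Vec.lookup α i))))
    }

  ∂* : Vec (Fin N) e → S d N → S (d ∸ e) N
  ∂* []                  f = f
  ∂* {d = zero}  (i ∷ w) f = 0ₛ
  ∂* {d = suc d} (i ∷ w) f = ∂* w (∂ i f)

  -- A constant-coefficient operator of order e is written as a finite sum of terms
  -- a ∂/∂x_{i₁} ⋯ ∂/∂x_{iₑ}. The expression is not unique, but only the action is used.
  Operator : (e N : ℕ) → Set c
  Operator e N = List (Carrier × Vec (Fin N) e)

  _⟨_⟩ : Operator e N → S d N → S (d ∸ e) N
  []            ⟨ f ⟩ = 0ₛ
  ((a , w) ∷ D) ⟨ f ⟩ = a • ∂* w f +ₛ D ⟨ f ⟩

  -- The image of D ⊗ q ↦ q D(p), for D of order e and q of degree τ.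
  ShiftedPartials : (e τ : ℕ) → S d N → Pred (S (τ ℕ.+ (d ∸ e)) N) (c ⊔ ℓ)
  ShiftedPartials {d} {N} e τ p = LinearAlgebra.Span R (S-module (τ ℕ.+ (d ∸ e)) N) λ f →
    Σ (Operator e N) λ D → Σ (S τ N) λ q → f ≈ₛ q · D ⟨ p ⟩

  DimShiftedPartials : (e τ : ℕ) → S d N → ℕ → Set (c ⊔ ℓ)
  DimShiftedPartials {d} {N} e τ p =
    LinearAlgebra.HasDimension R (S-module (τ ℕ.+ (d ∸ e)) N) (ShiftedPartials e τ p)

  perm : ∀ m → S m (m ℕ.* m)
  perm m = List.foldr _+ₛ_ 0ₛ
    (List.map (λ σ → prodₛ λ i → var (combine {m} {m} i (σ ⟨$⟩ʳ i))) (permutations m))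

  Matrix : (n d N : ℕ) → Set (c ⊔ ℓ)
  Matrix n d N = Fin n → Fin n → S d N

  identity : ∀ {n} → Matrix n 0 N
  identity i j = if ⌊ i Fin.≟ j ⌋ then 1ₛ else 0ₛ

  _⊡_ : ∀ {n} → Matrix n d N → Matrix n e N → Matrix n (d ℕ.+ e) N
  _⊡_ {n = n} A B i j = sumₛ {n} λ k → A i k · B k j

  matrixProduct : ∀ {n} → (Fin d → Matrix n 1 N) → Matrix n d N
  matrixProduct {zero}  X = identity
  matrixProduct {suc d} X = X Fin.zero ⊡ matrixProduct (X ∘ Fin.suc)

  IMM : ∀ d n → S d (d ℕ.* (n ℕ.* n))
  IMM d n = sumₛ λ i → matrixProduct X i i
    where
    X : Fin d → Matrix n 1 (d ℕ.* (n ℕ.* n))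
    X k i j = var (combine k (combine i j))

open Polynomials ℂ public

{-# OPTIONS --safe #-}
module Submission where

-- What matters about perm_m is that it is a form p of degree m in M = m² variables. Let k = m - e and
-- D = τ + k. By the chain rule the shifted partials of p are spanned by min(M^e, dim S^k ℂ^M) · dim S^τ
-- products; if k > 0 they lie in an ideal generated by M linear forms, and so have codimension at
-- least dim S^D ℂ^(N-M).
--
-- IMM is the sum of the monomials of all closed walks of length m on n nodes. Differentiating along
-- e prescribed edges leaves walks with free runs between them. If the edge (a , b) has weight
-- (a - b)², then the walk whose runs are straight lines is the only one of least weight, so its
-- monomial leads the derivative. Hence the dimension for IMM is at least the number of monomials of
-- degree D that are divisible by one word from each of several families of pairwise coprime words,
-- where almost all families consist of words of a common length s. If a monomial of degree τ is
-- unlikely to be divisible by a given word of length s, then most monomials avoid all words and the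
-- choices of words multiply; this beats the first bound. Otherwise it is less likely that a monomial
-- of degree D avoids all words of some family than that it avoids M given variables; this beats the
-- second bound.

open import Defs using (module CauchyReals; module Adjoin√; module LinearAlgebra; module Polynomials; ℂ)
open import Algebra.Bundles using (CommutativeRing)
import Algebra.Definitions.RawMonoid
import Algebra.Properties.CommutativeMonoid.Mult
import Algebra.Properties.CommutativeMonoid.Sum
import Algebra.Properties.CommutativeSemigroup
import Algebra.Properties.Group
import Algebra.Properties.Monoid.Mult
import Algebra.Properties.Ring
import Algebra.Properties.Semiring.Mult
import Algebra.Properties.Semiring.Sum
import Algebra.Solver.Ring.NaturalCoefficients.Default
open import Data.Bool.Base using (if_then_else_)
open import Data.Empty using (⊥-elim)
open import Data.Fin.Base as Fin using (Fin; toℕ; fromℕ<; punchIn; combine; remQuot; _↑ˡ_; _↑ʳ_)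
import Data.Fin.Properties as Fin
import Data.Integer.Base as ℤ
open import Data.Integer.Base using (ℤ; 0ℤ)
import Data.Integer.Properties as ℤ
import Data.Integer.Solver
open import Data.List.Base as List
  using (List; []; _∷_; [_]; _++_; map; foldr; concat; filter; length; take; drop; allFin; upTo; cartesianProduct; cartesianProductWith)
import Data.List.Properties as List
open import Data.List.Membership.Propositional using (_∈_; _∉_; find)
open import Data.List.Membership.Propositional.Properties
  using (∈-allFin; ∈-cartesianProduct⁻; ∈-filter⁺; ∈-filter⁻; ∈-lookup; ∈-map⁺; ∈-map⁻; ∈-upTo⁻; ∈-++⁺ˡ; ∈-++⁺ʳ; ∈-++⁻)
open import Data.List.Relation.Unary.All as All using (All; []; _∷_)
import Data.List.Relation.Unary.All.Properties as All
open import Data.List.Relation.Unary.AllPairs using (AllPairs; []; _∷_)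
import Data.List.Relation.Unary.AllPairs.Properties as AllPairs
open import Data.List.Relation.Unary.Any as Any using (Any; here; there; any?; index)
open import Data.List.Relation.Unary.Any.Properties using (lookup-index)
open import Data.List.Relation.Unary.Unique.Propositional using (Unique)
import Data.List.Relation.Unary.Unique.Propositional.Properties as Unique
open import Data.Nat.Base as ℕ using (ℕ; zero; suc; _∸_)
import Data.Nat.Properties as ℕ
open import Data.Product.Base using (∃; Σ; _×_; _,_; proj₁; proj₂)
open import Data.Rational.Base as ℚ using (ℚ; 0ℚ; 1ℚ; ½; ∣_∣)
import Data.Rational.Properties as ℚ
open import Data.Sum.Base using (_⊎_; inj₁; inj₂)
open import Data.Vec.Base as Vec using (Vec; []; _∷_; _[_]%=_; lookup; replicate)
import Data.Vec.Functional
import Data.Vec.Functional.Properties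
import Data.Vec.Properties as Vec
import Data.Vec.Relation.Unary.All as VecAll
open import Function.Base using (_∘_; id)
open import Level using (Level; _⊔_; Lift; lift)
open import Relation.Binary.Definitions using (tri<; tri≈; tri>)
open import Relation.Binary.PropositionalEquality
  using (_≡_; _≢_; refl; sym; trans; cong; cong₂; subst; subst₂; module ≡-Reasoning)
open import Relation.Nullary using (¬_; Dec; yes; no; contradiction; ¬?)
open import Relation.Nullary.Decidable using (⌊_⌋)
open import Relation.Unary using (Pred; Decidable)

-- Equality of complex numbers is undecidable, so no rank can be computed. The linear algebra
-- therefore works over any commutative ring without zero divisors and of characteristic 0; pivots
-- exist under double negation, which is harmless because the conclusions are inequalities between
-- natural numbers. The weight (a - b)² is strictly convex: among walks with given ends and length,
-- equal increments give the only minimum. Increments are integers, so a run of r steps goes from ru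
-- to rw for a label (u , w). An edge at a known time determines the label, so words of one run with
-- different labels are coprime. Jumps are arbitrary, so different runs choose their labels freely.
-- Labels up to m⁴ keep all nodes at most m⁵ < n and offer (m⁴ + 1)² words per run, enough for both
-- cases. Because of the common length s, one number decides between the cases: the proportion of
-- monomials that a word of length s divides. It does not decrease with the degree, so what holds in
-- degree τ passes to degree τ + k. Proportions are written as cross-multiplied counts.

NoZeroDivisors : ∀ {c ℓ} → CommutativeRing c ℓ → Set (c ⊔ ℓ)
NoZeroDivisors R = ∀ {x y} → ¬ (x ≈ 0#) → x * y ≈ 0# → y ≈ 0#
  where open CommutativeRing R

CharacteristicZero : ∀ {c ℓ} → CommutativeRing c ℓ → Set ℓ
CharacteristicZero R = ∀ n → ¬ (suc n ×ᵣ 1# ≈ 0#)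
  where
  open CommutativeRing R
  open Algebra.Definitions.RawMonoid +-rawMonoid using () renaming (_×_ to _×ᵣ_)

FormallyReal : ∀ {c ℓ} → CommutativeRing c ℓ → Set (c ⊔ ℓ)
FormallyReal R = ∀ {x y} → x * x + y * y ≈ 0# → x ≈ 0#
  where open CommutativeRing R

-- The complex numbers: no zero divisors, characteristic zero.

module ℝ-Domain where
  open CauchyReals
  open ℝ
  open CommutativeRing ℝ-ring
    using (_≈_; _+_; _*_; 0#)

  -- The positive form of being nonzero: a rational bound away from 0 on some tail.
  Apart : ℝ → Set
  Apart x = ∃ λ δ → 0ℚ ℚ.< δ × ∃ λ K → ∀ n → K ℕ.≤ n → δ ℚ.≤ ∣ seq x n ∣

  x-0≡x : ∀ x → x ℚ.- 0ℚ ≡ x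
  x-0≡x x = trans (cong (x ℚ.+_) refl) (ℚ.+-identityʳ x)

  half>0 : ∀ {ε} → 0ℚ ℚ.< ε → 0ℚ ℚ.< ½ ℚ.* ε
  half>0 {ε} ε>0 = ℚ.positive⁻¹ _ {{ℚ.pos*pos⇒pos ½ ε {{ℚ.positive ε>0}}}}

  halves : ∀ ε → ½ ℚ.* ε ℚ.+ ½ ℚ.* ε ≡ ε
  halves ε = trans (sym (ℚ.*-distribʳ-+ ε ½ ½)) (ℚ.*-identityˡ ε)

  ≈0⇒¬apart : ∀ {x} → x ≈ 0# → ¬ Apart x
  ≈0⇒¬apart {x} x≈0 (δ , δ>0 , K , δ≤) with x≈0 δ δ>0
  ... | L , <δ = ℚ.<-irrefl refl (ℚ.≤-<-trans (δ≤ n (ℕ.m≤m⊔n K L))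
      (subst (λ q → ∣ q ∣ ℚ.< δ) (x-0≡x (seq x n)) (<δ n (ℕ.m≤n⊔m K L))))
    where n = K ℕ.⊔ L

  -- One rational comparison settles it, at an index K beyond which the terms differ by less than
  -- ε/4: if the term at K is below ε/2, the tail stays below ε; otherwise the tail keeps distance
  -- ε/4 from 0. Hence an equation x ≈ 0 can be proved by refuting apartness.
  ¬apart⇒≈0 : ∀ {x} → ¬ Apart x → x ≈ 0#
  ¬apart⇒≈0 {x} ¬ap ε ε>0 with cauchy x (½ ℚ.* (½ ℚ.* ε)) (half>0 (half>0 ε>0))
  ... | K , close with ∣ seq x K ∣ ℚ.<? ½ ℚ.* ε
  ...   | yes small = K , λ n K≤n → subst₂ ℚ._<_ refl (halves ε)
            (ℚ.≤-<-trans
              (subst (λ q → ∣ q ∣ ℚ.≤ ∣ seq x n ℚ.- seq x K ∣ ℚ.+ ∣ seq x K ∣)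
                (trans ([p-q]+q' (seq x n) (seq x K)) (sym (x-0≡x (seq x n))))
                (ℚ.∣p+q∣≤∣p∣+∣q∣ (seq x n ℚ.- seq x K) (seq x K)))
              (ℚ.+-mono-< (ℚ.<-trans (close n K K≤n ℕ.≤-refl) quarter<half) small))
    where
    [p-q]+q' : ∀ p q → (p ℚ.- q) ℚ.+ q ≡ p
    [p-q]+q' p q = Identities.[p-q]+q ℚ.+-*-commutativeRing p q
    quarter<half : ½ ℚ.* (½ ℚ.* ε) ℚ.< ½ ℚ.* ε
    quarter<half = subst₂ ℚ._<_ (ℚ.+-identityʳ _) (halves (½ ℚ.* ε))
      (ℚ.+-monoʳ-< (½ ℚ.* (½ ℚ.* ε)) (half>0 (half>0 ε>0)))
  ...   | no large = contradiction (q , half>0 (half>0 ε>0) , K , λ n K≤n → ≤-cancel n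
            (subst₂ ℚ._≤_ (sym (halves (½ ℚ.* ε))) refl
              (ℚ.≤-trans (ℚ.≮⇒≥ large)
                (ℚ.≤-trans (triangle n)
                  (ℚ.+-monoˡ-≤ ∣ seq x n ∣ (ℚ.<⇒≤ (close K n ℕ.≤-refl K≤n))))))) ¬ap
    where
    q = ½ ℚ.* (½ ℚ.* ε)
    triangle : ∀ n → ∣ seq x K ∣ ℚ.≤ ∣ seq x K ℚ.- seq x n ∣ ℚ.+ ∣ seq x n ∣
    triangle n = subst (λ r → ∣ r ∣ ℚ.≤ ∣ seq x K ℚ.- seq x n ∣ ℚ.+ ∣ seq x n ∣)
      (Identities.[p-q]+q ℚ.+-*-commutativeRing (seq x K) (seq x n))
      (ℚ.∣p+q∣≤∣p∣+∣q∣ (seq x K ℚ.- seq x n) (seq x n))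
    ≤-cancel : ∀ n → q ℚ.+ q ℚ.≤ q ℚ.+ ∣ seq x n ∣ → q ℚ.≤ ∣ seq x n ∣
    ≤-cancel n le with q ℚ.≤? ∣ seq x n ∣
    ... | yes q≤ = q≤
    ... | no  q≰ = contradiction (ℚ.<-≤-trans (ℚ.+-monoʳ-< q (ℚ.≰⇒> q≰)) le) (ℚ.<-irrefl refl)

  apart-* : ∀ {x y} → Apart x → Apart y → Apart (x * y)
  apart-* {x} {y} (δ , δ>0 , K , δ≤) (η , η>0 , L , η≤) =
    δ ℚ.* η , ℚ.positive⁻¹ _ {{ℚ.pos*pos⇒pos δ {{ℚ.positive δ>0}} η {{ℚ.positive η>0}}}} , K ℕ.⊔ L , λ n KL≤n →
    subst (δ ℚ.* η ℚ.≤_) (sym (ℚ.∣p*q∣≡∣p∣*∣q∣ (seq x n) (seq y n)))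
      (ℚ.≤-trans
        (ℚ.*-monoˡ-≤-nonNeg δ {{ℚ.pos⇒nonNeg δ {{ℚ.positive δ>0}}}} (η≤ n (ℕ.≤-trans (ℕ.m≤n⊔m K L) KL≤n)))
        (ℚ.*-monoʳ-≤-nonNeg ∣ seq y n ∣ {{ℚ.∣-∣-nonNeg (seq y n)}} (δ≤ n (ℕ.≤-trans (ℕ.m≤m⊔n K L) KL≤n))))

  -- Apartness cannot be extracted from x ≉ 0. But the goal becomes a refutation of `Apart y`, and
  -- inside it x ≉ 0 may be contradicted by refuting `Apart x` as well.
  domain : ∀ {x y} → ¬ (x ≈ 0#) → x * y ≈ 0# → y ≈ 0#
  domain {x} {y} x≉0 xy≈0 = ¬apart⇒≈0 {y} λ ap-y → x≉0 (¬apart⇒≈0 {x} λ ap-x →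
    ≈0⇒¬apart {x * y} xy≈0 (apart-* {x} {y} ap-x ap-y))

  ∣p∣²≡p² : ∀ p → ∣ p ∣ ℚ.* ∣ p ∣ ≡ p ℚ.* p
  ∣p∣²≡p² p with ℚ.∣p∣≡p∨∣p∣≡-p p
  ... | inj₁ eq = cong₂ ℚ._*_ eq eq
  ... | inj₂ eq = trans (cong₂ ℚ._*_ eq eq) (trans (sym (ℚ.neg-distribˡ-* p (ℚ.- p)))
      (trans (cong ℚ.-_ (sym (ℚ.neg-distribʳ-* p p))) (⁻¹-involutive (p ℚ.* p))))
    where open Algebra.Properties.Group ℚ.+-0-group using (⁻¹-involutive)

  0≤p² : ∀ p → 0ℚ ℚ.≤ p ℚ.* p
  0≤p² p = subst (0ℚ ℚ.≤_) (∣p∣²≡p² p)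
    (ℚ.nonNegative⁻¹ _ {{ℚ.nonNeg*nonNeg⇒nonNeg (∣ p ∣) {{ℚ.∣-∣-nonNeg p}} (∣ p ∣) {{ℚ.∣-∣-nonNeg p}}}})

  sum-of-squares : ∀ {x y} → x * x + y * y ≈ 0# → x ≈ 0#
  sum-of-squares {x} {y} x²+y²≈0 = ¬apart⇒≈0 {x} λ ap →
    let (δ , δ>0 , K , δ≤) = apart-* {x} {x} ap ap in
    ≈0⇒¬apart {x * x + y * y} x²+y²≈0 (δ , δ>0 , K , λ n K≤n →
      ℚ.≤-trans (δ≤ n K≤n)
        (subst₂ ℚ._≤_ (sym (ℚ.0≤p⇒∣p∣≡p (0≤p² (seq x n))))
                      (sym (ℚ.0≤p⇒∣p∣≡p (subst (ℚ._≤ seq x n ℚ.* seq x n ℚ.+ seq y n ℚ.* seq y n) (ℚ.+-identityˡ 0ℚ)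
                                           (ℚ.+-mono-≤ (0≤p² (seq x n)) (0≤p² (seq y n))))))
          (subst (ℚ._≤ seq x n ℚ.* seq x n ℚ.+ seq y n ℚ.* seq y n) (ℚ.+-identityʳ _)
            (ℚ.+-monoʳ-≤ (seq x n ℚ.* seq x n) (0≤p² (seq y n))))))

module Adjoin√-1-Domain {c ℓ} (R : CommutativeRing c ℓ)
    (domain : NoZeroDivisors R) (sum-of-squares : FormallyReal R) where
  open CommutativeRing R
    renaming (refl to ≈-refl; sym to ≈-sym; trans to ≈-trans)
  open Algebra.Solver.Ring.NaturalCoefficients.Default commutativeSemiring
    using (solve; _:=_; _:+_; _:*_; con)
  open Adjoin√ R (- 1#) using (_⊗_; _≋_)

  -- The norm N = a² + b² of w is nonzero by formal reality, and multiplying wz = 0 by the conjugate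
  -- of w gives N z = 0 in both components. The element -1 is treated as an indeterminate u;
  -- leftover multiples of u + 1 are removed by `absorb`.
  zero-product : ∀ {w z} → ¬ (w ≋ (0# , 0#)) → w ⊗ z ≋ (0# , 0#) → z ≋ (0# , 0#)
  zero-product {a , b} {x , y} w≉0 (re≈0 , im≈0) =
    domain N≉0 (≈-trans Nx≈ (≈-trans (+-cong (*-congˡ re≈0) (*-congˡ im≈0)) zeros)) ,
    domain N≉0 (≈-trans Ny≈ (≈-trans (+-cong (*-congˡ im≈0) (*-congˡ re≈0)) zeros))
    where
    u N : Carrier
    u = - 1#
    N = a * a + b * b
    N≉0 : ¬ (N ≈ 0#)
    N≉0 N≈0 = w≉0 (sum-of-squares N≈0 , sum-of-squares (≈-trans (+-comm _ _) N≈0))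
    zeros : ∀ {p q} → p * 0# + q * 0# ≈ 0#
    zeros = ≈-trans (+-cong (zeroʳ _) (zeroʳ _)) (+-identityˡ 0#)
    absorb : ∀ {p q} → p + q * (u + 1#) ≈ p
    absorb = ≈-trans (+-congˡ (≈-trans (*-congˡ (-‿inverseˡ 1#)) (zeroʳ _))) (+-identityʳ _)
    Nx≈ : N * x ≈ a * (a * x + u * (b * y)) + b * (a * y + b * x)
    Nx≈ = ≈-sym (≈-trans
      (solve 5 (λ u a b x y → a :* (a :* x :+ u :* (b :* y)) :+ b :* (a :* y :+ b :* x)
         := (a :* a :+ b :* b) :* x :+ (a :* b :* y) :* (u :+ con 1)) ≈-refl u a b x y)
      absorb)
    Ny≈ : N * y ≈ a * (a * y + b * x) + (u * b) * (a * x + u * (b * y))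
    Ny≈ = ≈-trans (≈-sym absorb)
      (≈-trans
        (solve 5 (λ u a b x y →
           (a :* a :+ b :* b) :* y :+ (b :* b :* y :* u :+ a :* b :* x) :* (u :+ con 1)
           := (a :* (a :* y :+ b :* x) :+ (u :* b) :* (a :* x :+ u :* (b :* y)))
              :+ (b :* b :* y) :* (u :+ con 1)) ≈-refl u a b x y)
        absorb)

module ℂ-Domain where
  open CauchyReals using (ℝ; ℝ-ring; module ℝ)
  open ℝ using (seq)
  open CommutativeRing ℂ using (1#; +-rawMonoid)
  open Algebra.Definitions.RawMonoid +-rawMonoid using () renaming (_×_ to _×ᵣ_)

  ℂ-domain : NoZeroDivisors ℂ
  ℂ-domain {w} {z} = Adjoin√-1-Domain.zero-product ℝ-ring
    (λ {x} {y} → ℝ-Domain.domain {x} {y}) (λ {x} {y} → ℝ-Domain.sum-of-squares {x} {y}) {w} {z}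

  1≤suc×1 : ∀ n k → 1ℚ ℚ.≤ seq (proj₁ (suc n ×ᵣ 1#)) k
  1≤suc×1 zero    k = ℚ.≤-reflexive (sym (ℚ.+-identityʳ 1ℚ))
  1≤suc×1 (suc n) k = ℚ.≤-trans (ℚ.≤-trans (ℚ.≤-reflexive (sym (ℚ.+-identityʳ 1ℚ)))
    (ℚ.+-monoʳ-≤ 1ℚ (ℚ.nonNegative⁻¹ 1ℚ))) (ℚ.+-monoʳ-≤ 1ℚ (1≤suc×1 n k))

  ℂ-char0 : CharacteristicZero ℂ
  ℂ-char0 n (re≈0 , _) = ℝ-Domain.≈0⇒¬apart {proj₁ (suc n ×ᵣ 1#)} re≈0
    (1ℚ , ℚ.positive⁻¹ 1ℚ , 0 , λ k _ → ℚ.≤-trans (1≤suc×1 n k) (p≤∣p∣ _))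
    where
    p≤∣p∣ : ∀ p → p ℚ.≤ ∣ p ∣
    p≤∣p∣ p with ℚ.≤-total 0ℚ p
    ... | inj₁ 0≤p = ℚ.≤-reflexive (sym (ℚ.0≤p⇒∣p∣≡p 0≤p))
    ... | inj₂ p≤0 = ℚ.≤-trans p≤0 (ℚ.0≤∣p∣ p)

-- Rank bounds without decidable equality.

¬¬-excluded-middle : ∀ {p} {P : Set p} → ¬ ¬ (P ⊎ ¬ P)
¬¬-excluded-middle h = h (inj₂ (h ∘ inj₁))

-- This supplies pivots: under double negation a finite column either vanishes or has an entry that
-- does not.
all-or-counterexample : ∀ {p n} (P : Fin n → Set p) → ¬ ¬ ((∀ i → P i) ⊎ ∃ λ i → ¬ P i)
all-or-counterexample {n = zero}  P h = h (inj₁ λ ())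
all-or-counterexample {n = suc n} P h = ¬¬-excluded-middle λ
  { (inj₂ ¬P0) → h (inj₂ (Fin.zero , ¬P0))
  ; (inj₁ P0)  → all-or-counterexample (P ∘ Fin.suc) λ
    { (inj₂ (i , ¬Pi)) → h (inj₂ (Fin.suc i , ¬Pi))
    ; (inj₁ Ps)        → h (inj₁ λ { Fin.zero → P0 ; (Fin.suc i) → Ps i }) } }

module Rank {c ℓ} (R : CommutativeRing c ℓ) (domain : NoZeroDivisors R) (char0 : CharacteristicZero R) where
  open CommutativeRing R hiding (zero)
    renaming (refl to ≈-refl; sym to ≈-sym; trans to ≈-trans)
  open Algebra.Properties.CommutativeMonoid.Sum +-commutativeMonoid
    using (sum; sum-cong-≋; sum-remove; ∑-distrib-+; sum-replicate-zero)
  open Algebra.Properties.Semiring.Sum semiring using (*-distribʳ-sum)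
  open Algebra.Properties.Ring ring using (-‿distribˡ-*; -‿distribʳ-*)
  open Algebra.Solver.Ring.NaturalCoefficients.Default commutativeSemiring
    using (solve; _:=_; _:*_)

  1≉0 : ¬ (1# ≈ 0#)
  1≉0 1≈0 = char0 0 (≈-trans (+-identityʳ 1#) 1≈0)

  sum-zero : ∀ {n} {f : Fin n → Carrier} → (∀ i → f i ≈ 0#) → sum f ≈ 0#
  sum-zero {n} h = ≈-trans (sum-cong-≋ h) (sum-replicate-zero n)

  -- Linear independence of the rows of A.
  TrivialKernel : ∀ {a u} → (Fin a → Fin u → Carrier) → Set (c ⊔ ℓ)
  TrivialKernel {a} A = ∀ (x : Fin a → Carrier) → (∀ j → sum (λ i → x i * A i j) ≈ 0#) → ∀ i → x i ≈ 0#

  -- Fraction-free, since only the absence of zero divisors is assumed.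
  module Eliminate {a u} (A : Fin (suc a) → Fin (suc u) → Carrier) (p : Fin (suc a)) where

    pivot : Carrier
    pivot = A p Fin.zero

    reduced : Fin a → Fin u → Carrier
    reduced i j = pivot * A (punchIn p i) (Fin.suc j) - A (punchIn p i) Fin.zero * A p (Fin.suc j)

    module _ (x : Fin a → Carrier) where

      -- The relation between rows of A that x becomes; its entry at p is chosen to cancel the first
      -- column.
      lifted : Fin (suc a) → Carrier
      lifted = Data.Vec.Functional.insertAt (λ i → pivot * x i) p (- sum (λ i → x i * A (punchIn p i) Fin.zero))

      lifted-sum : ∀ j → sum (λ i → lifted i * A i j) ≈
        - sum (λ i → x i * A (punchIn p i) Fin.zero) * A p j + sum (λ i → pivot * x i * A (punchIn p i) j)
      lifted-sum j = ≈-trans (sum-remove {i = p} (λ i → lifted i * A i j))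
        (+-cong (*-congʳ (reflexive (Data.Vec.Functional.Properties.insertAt-lookup _ p _)))
                (sum-cong-≋ λ i → *-congʳ (reflexive (Data.Vec.Functional.Properties.insertAt-punchIn _ p _ i))))

    -- A relation x between the reduced rows lifts to a relation between the rows of A. Its entries
    -- off p are pivot · x, and the pivot cancels.
    reduced-trivialKernel : ¬ (pivot ≈ 0#) → TrivialKernel A → TrivialKernel reduced
    reduced-trivialKernel pivot≉0 triv x h i = domain pivot≉0
      (≈-trans (≈-sym (reflexive (Data.Vec.Functional.Properties.insertAt-punchIn _ p _ i)))
               (triv (lifted x) zeros (punchIn p i)))
      where
      s = sum (λ i → x i * A (punchIn p i) Fin.zero)
      zeros : ∀ j → sum (λ i → lifted x i * A i j) ≈ 0#
      zeros Fin.zero = ≈-trans (lifted-sum x Fin.zero) (≈-trans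
        (+-cong (≈-sym (-‿distribˡ-* s pivot))
          (≈-trans (sum-cong-≋ {a} λ i → ≈-trans (*-congʳ (*-comm pivot (x i)))
                     (≈-trans (*-assoc _ _ _) (≈-trans (*-congˡ (*-comm _ _)) (≈-sym (*-assoc _ _ _)))))
                   (≈-sym (*-distribʳ-sum {a} pivot _))))
        (-‿inverseˡ (s * pivot)))
      zeros (Fin.suc j) = ≈-trans (lifted-sum x (Fin.suc j)) (≈-trans (+-comm _ _)
        (≈-trans (+-congˡ (≈-trans (≈-sym (-‿distribˡ-* s q)) (≈-trans (-‿distribʳ-* s q) (*-distribʳ-sum {a} (- q) _))))
          (≈-trans (≈-sym (∑-distrib-+ {a} _ _)) (≈-trans (sum-cong-≋ {a} term) (h j)))))
        where
        q = A p (Fin.suc j)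
        term : ∀ i → pivot * x i * A (punchIn p i) (Fin.suc j) + x i * A (punchIn p i) Fin.zero * (- q)
                     ≈ x i * reduced i j
        term i = ≈-trans (+-cong (solve 3 (λ a b c → a :* b :* c := b :* (a :* c)) ≈-refl pivot (x i) _)
            (≈-trans (*-assoc _ _ _) (*-congˡ (≈-sym (-‿distribʳ-* _ q)))))
          (≈-sym (distribˡ (x i) _ _))

  rank-bound : ∀ u a (A : Fin a → Fin u → Carrier) → TrivialKernel A → ¬ ¬ (a ℕ.≤ u)
  rank-bound u       zero    A triv h = h ℕ.z≤n
  rank-bound zero    (suc a) A triv h = 1≉0 (triv (λ _ → 1#) (λ ()) Fin.zero)
  rank-bound (suc u) (suc a) A triv h = all-or-counterexample (λ i → A i Fin.zero ≈ 0#) λ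
    { (inj₁ zeros) → rank-bound u (suc a) (λ i j → A i (Fin.suc j))
        (λ x hx → triv x λ { Fin.zero → sum-zero {suc a} (λ i → ≈-trans (*-congˡ (zeros i)) (zeroʳ (x i))) ; (Fin.suc j) → hx j })
        (h ∘ ℕ.m≤n⇒m≤1+n)
    ; (inj₂ (p , pivot≉0)) → rank-bound u a (Eliminate.reduced A p) (Eliminate.reduced-trivialKernel A p pivot≉0 triv)
        (h ∘ ℕ.s≤s) }

  -- The double negation disappears because the inequality is decidable.
  rank-bound-list : ∀ {x} {X : Set x} a (js : List X) (A : Fin a → X → Carrier) →
    (∀ (x : Fin a → Carrier) → (∀ j → j ∈ js → sum (λ i → x i * A i j) ≈ 0#) → ∀ i → x i ≈ 0#) → a ℕ.≤ length js
  rank-bound-list a js A triv with a ℕ.≤? length js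
  ... | yes le = le
  ... | no ¬le = ⊥-elim (rank-bound (length js) a (λ i j → A i (List.lookup js j))
      (λ x hx → triv x λ j j∈js → ≈-trans
         (sum-cong-≋ {a} λ i → *-congˡ (reflexive (cong (A i) (lookup-index j∈js)))) (hx (index j∈js)))
      ¬le)

-- Monomials as exponent vectors, and how many there are.

module Monomials where
  open import Data.Nat.Base
    using (_+_; _*_; _^_; _≤_; _<_; z≤n; s≤s; NonZero; >-nonZero)
  open import Data.Nat.Properties
  open import Data.Nat.Solver using (module +-*-Solver)
  open +-*-Solver using (solve; _:=_; _:+_; _:*_; con)

  open Algebra.Properties.CommutativeSemigroup +-commutativeSemigroup using (interchange)

  private variable
    ℓᴬ ℓᴾ : Level
    Elt Elt′ : Set ℓᴬ
    N : ℕ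

  ∑ : List Elt → (Elt → ℕ) → ℕ
  ∑ []       f = 0
  ∑ (x ∷ xs) f = f x + ∑ xs f

  ∑-++ : ∀ (xs ys : List Elt) f → ∑ (xs ++ ys) f ≡ ∑ xs f + ∑ ys f
  ∑-++ []       ys f = refl
  ∑-++ (x ∷ xs) ys f = trans (cong (f x +_) (∑-++ xs ys f)) (sym (+-assoc (f x) _ _))

  ∑-map : ∀ (g : Elt → Elt′) xs f → ∑ (map g xs) f ≡ ∑ xs (f ∘ g)
  ∑-map g []       f = refl
  ∑-map g (x ∷ xs) f = cong (f (g x) +_) (∑-map g xs f)

  ∑-cong : ∀ (xs : List Elt) {f g} → (∀ x → f x ≡ g x) → ∑ xs f ≡ ∑ xs g
  ∑-cong []       h = refl
  ∑-cong (x ∷ xs) h = cong₂ _+_ (h x) (∑-cong xs h)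

  ∑-mono-≤ : ∀ (xs : List Elt) {f g} → (∀ x → f x ≤ g x) → ∑ xs f ≤ ∑ xs g
  ∑-mono-≤ []       h = z≤n
  ∑-mono-≤ (x ∷ xs) h = +-mono-≤ (h x) (∑-mono-≤ xs h)

  ∑-0 : ∀ (xs : List Elt) {f} → (∀ x → f x ≡ 0) → ∑ xs f ≡ 0
  ∑-0 []       h = refl
  ∑-0 (x ∷ xs) h = cong₂ _+_ (h x) (∑-0 xs h)

  ∑-const : ∀ (xs : List Elt) k → ∑ xs (λ _ → k) ≡ length xs * k
  ∑-const []       k = refl
  ∑-const (x ∷ xs) k = cong (k +_) (∑-const xs k)

  ∑-+ : ∀ (xs : List Elt) f g → ∑ xs (λ x → f x + g x) ≡ ∑ xs f + ∑ xs g
  ∑-+ []       f g = refl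
  ∑-+ (x ∷ xs) f g = trans (cong ((f x + g x) +_) (∑-+ xs f g)) (interchange (f x) (g x) _ _)

  ∑-*ʳ : ∀ (xs : List Elt) f k → ∑ xs (λ x → f x * k) ≡ ∑ xs f * k
  ∑-*ʳ []       f k = refl
  ∑-*ʳ (x ∷ xs) f k = trans (cong (f x * k +_) (∑-*ʳ xs f k)) (sym (*-distribʳ-+ k (f x) _))

  ∑-*ˡ : ∀ (xs : List Elt) f k → ∑ xs (λ x → k * f x) ≡ k * ∑ xs f
  ∑-*ˡ xs f k = trans (∑-cong xs λ x → *-comm k (f x)) (trans (∑-*ʳ xs f k) (*-comm _ k))

  ∑-swap : ∀ (xs : List Elt) (ys : List Elt′) (f : Elt → Elt′ → ℕ) → ∑ xs (λ x → ∑ ys (f x)) ≡ ∑ ys (λ y → ∑ xs (λ x → f x y))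
  ∑-swap []       ys f = sym (∑-0 ys λ _ → refl)
  ∑-swap (x ∷ xs) ys f = trans (cong (∑ ys (f x) +_) (∑-swap xs ys f)) (sym (∑-+ ys (f x) _))

  inc : Fin N → Vec ℕ N → Vec ℕ N
  inc v α = α [ v ]%= suc

  -- A list of variables, called a word, stands for their product; `incs w` is multiplication by it.
  incs : List (Fin N) → Vec ℕ N → Vec ℕ N
  incs w α = foldr inc α w

  inc-comm : ∀ (u v : Fin N) α → inc u (inc v α) ≡ inc v (inc u α)
  inc-comm Fin.zero    Fin.zero    (a ∷ α) = refl
  inc-comm Fin.zero    (Fin.suc v) (a ∷ α) = refl
  inc-comm (Fin.suc u) Fin.zero    (a ∷ α) = refl
  inc-comm (Fin.suc u) (Fin.suc v) (a ∷ α) = cong (a ∷_) (inc-comm u v α)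

  inc-injective : ∀ (v : Fin N) {α β} → inc v α ≡ inc v β → α ≡ β
  inc-injective Fin.zero    {a ∷ α} {b ∷ β} eq = cong₂ _∷_ (suc-injective (Vec.∷-injectiveˡ eq)) (Vec.∷-injectiveʳ eq)
  inc-injective (Fin.suc v) {a ∷ α} {b ∷ β} eq = cong₂ _∷_ (Vec.∷-injectiveˡ eq) (inc-injective v (Vec.∷-injectiveʳ eq))

  lookup-inc : ∀ (v : Fin N) α → lookup (inc v α) v ≡ suc (lookup α v)
  lookup-inc v α = Vec.lookup∘updateAt v α

  lookup-inc-≢ : ∀ {u v : Fin N} α → u ≢ v → lookup (inc v α) u ≡ lookup α u
  lookup-inc-≢ {u = u} {v} α u≢v = Vec.lookup∘updateAt′ u v u≢v α

  uninc : ∀ (v : Fin N) κ → lookup κ v ≡ 0 ⊎ ∃ λ β → κ ≡ inc v β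
  uninc Fin.zero    (zero ∷ κ)  = inj₁ refl
  uninc Fin.zero    (suc a ∷ κ) = inj₂ (a ∷ κ , refl)
  uninc (Fin.suc v) (a ∷ κ) with uninc v κ
  ... | inj₁ ≡0         = inj₁ ≡0
  ... | inj₂ (β , refl) = inj₂ (a ∷ β , refl)

  inc≢0 : ∀ (v : Fin N) {α} → lookup (inc v α) v ≢ 0
  inc≢0 v {α} eq with trans (sym (lookup-inc v α)) eq
  ... | ()

  incs-inc : ∀ w (v : Fin N) α → incs w (inc v α) ≡ inc v (incs w α)
  incs-inc []      v α = refl
  incs-inc (u ∷ w) v α = trans (cong (inc u) (incs-inc w v α)) (inc-comm u v _)

  incs-comm : ∀ w w′ (α : Vec ℕ N) → incs w (incs w′ α) ≡ incs w′ (incs w α)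
  incs-comm w []       α = refl
  incs-comm w (v ∷ w′) α = trans (incs-inc w v _) (cong (inc v) (incs-comm w w′ α))

  incs-++ : ∀ w w′ (α : Vec ℕ N) → incs (w ++ w′) α ≡ incs w (incs w′ α)
  incs-++ w w′ α = List.foldr-++ inc α w w′

  incs-injective : ∀ w {α β : Vec ℕ N} → incs w α ≡ incs w β → α ≡ β
  incs-injective []      eq = eq
  incs-injective (v ∷ w) eq = incs-injective w (inc-injective v eq)

  sum-inc : ∀ (v : Fin N) α → Vec.sum (inc v α) ≡ suc (Vec.sum α)
  sum-inc Fin.zero    (a ∷ α) = refl
  sum-inc (Fin.suc v) (a ∷ α) = trans (cong (a +_) (sum-inc v α)) (+-suc a _)

  sum-incs : ∀ w (α : Vec ℕ N) → Vec.sum (incs w α) ≡ length w + Vec.sum α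
  sum-incs []      α = refl
  sum-incs (v ∷ w) α = trans (sum-inc v (incs w α)) (cong suc (sum-incs w α))

  infix 4 _∣ᵐ_ _∣ᵐ?_

  _∣ᵐ_ : List (Fin N) → Vec ℕ N → Set
  w ∣ᵐ κ = ∃ λ β → κ ≡ incs w β

  _∣ᵐ?_ : ∀ w (κ : Vec ℕ N) → Dec (w ∣ᵐ κ)
  []      ∣ᵐ? κ = yes (κ , refl)
  (v ∷ w) ∣ᵐ? κ with uninc v κ
  ... | inj₁ ≡0 = no λ { (β , refl) → inc≢0 v {incs w β} ≡0 }
  ... | inj₂ (κ′ , refl) with w ∣ᵐ? κ′
  ...   | yes (β , refl) = yes (β , refl)
  ...   | no  w∤κ′       = no λ { (β , eq) → w∤κ′ (β , inc-injective v eq) }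

  -- Coprimality of the two products.
  Disjoint : List (Fin N) → List (Fin N) → Set
  Disjoint w w′ = ∀ {v} → v ∈ w → v ∉ w′

  Disjoint-sym : ∀ {w w′ : List (Fin N)} → Disjoint w w′ → Disjoint w′ w
  Disjoint-sym d v∈w′ v∈w = d v∈w v∈w′

  lookup-incs-∉ : ∀ w {v : Fin N} α → v ∉ w → lookup (incs w α) v ≡ lookup α v
  lookup-incs-∉ []      α v∉w = refl
  lookup-incs-∉ (u ∷ w) α v∉w = trans (lookup-inc-≢ (incs w α) (v∉w ∘ here)) (lookup-incs-∉ w α (v∉w ∘ there))

  ∣ᵐ-inc⁻ : ∀ w {v : Fin N} {κ} → v ∉ w → w ∣ᵐ inc v κ → w ∣ᵐ κ
  ∣ᵐ-inc⁻ w {v} {κ} v∉w (β , eq) with uninc v β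
  ... | inj₁ ≡0 = contradiction (trans (cong (λ α → lookup α v) eq) (trans (lookup-incs-∉ w β v∉w) ≡0)) (inc≢0 v {κ})
  ... | inj₂ (β′ , refl) = β′ , inc-injective v (trans eq (incs-inc w v β′))

  ∣ᵐ-incs⁻ : ∀ w w′ {κ : Vec ℕ N} → Disjoint w w′ → w ∣ᵐ incs w′ κ → w ∣ᵐ κ
  ∣ᵐ-incs⁻ w []       d h = h
  ∣ᵐ-incs⁻ w (v ∷ w′) d h = ∣ᵐ-incs⁻ w w′ (λ v∈w v∈w′ → d v∈w (there v∈w′)) (∣ᵐ-inc⁻ w (λ v∈w → d v∈w (here refl)) h)

  ∣ᵐ-incs⁺ : ∀ w w′ {κ : Vec ℕ N} → w ∣ᵐ κ → w ∣ᵐ incs w′ κ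
  ∣ᵐ-incs⁺ w w′ (β , refl) = incs w′ β , incs-comm w′ w β

  ∣ᵐ-++⁺ : ∀ w w′ {κ : Vec ℕ N} → Disjoint w w′ → w ∣ᵐ κ → w′ ∣ᵐ κ → w ++ w′ ∣ᵐ κ
  ∣ᵐ-++⁺ w w′ d w∣κ (κ′ , refl) with ∣ᵐ-incs⁻ w w′ d w∣κ
  ... | β , refl = β , trans (incs-comm w′ w β) (sym (incs-++ w w′ β))

  -- The split by divisibility by the first variable is Pascal's rule, which `H` repeats.
  mons : ∀ N → ℕ → List (Vec ℕ N)
  mons zero    zero    = [ [] ]
  mons zero    (suc d) = []
  mons (suc N) zero    = map (0 ∷_) (mons N zero)
  mons (suc N) (suc d) = map (0 ∷_) (mons N (suc d)) ++ map (inc Fin.zero) (mons (suc N) d)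

  mons-complete : ∀ (α : Vec ℕ N) d → Vec.sum α ≡ d → α ∈ mons N d
  mons-complete []          zero    refl = here refl
  mons-complete (zero ∷ α)  zero    eq   = ∈-map⁺ (0 ∷_) (mons-complete α zero eq)
  mons-complete (zero ∷ α)  (suc d) eq   = ∈-++⁺ˡ (∈-map⁺ (0 ∷_) (mons-complete α (suc d) eq))
  mons-complete (suc a ∷ α) (suc d) eq   =
    ∈-++⁺ʳ (map (0 ∷_) (mons _ (suc d))) (∈-map⁺ (inc Fin.zero) (mons-complete (a ∷ α) d (suc-injective eq)))

  mons-degree : ∀ N d → All (λ α → Vec.sum α ≡ d) (mons N d)
  mons-degree zero    zero    = refl ∷ []
  mons-degree zero    (suc d) = []
  mons-degree (suc N) zero    = All.map⁺ (mons-degree N zero)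
  mons-degree (suc N) (suc d) = All.++⁺ (All.map⁺ (mons-degree N (suc d)))
    (All.map⁺ (All.map (λ {α} eq → trans (sum-inc Fin.zero α) (cong suc eq)) (mons-degree (suc N) d)))

  mons-sound : ∀ N d {α} → α ∈ mons N d → Vec.sum α ≡ d
  mons-sound N d = All.lookup (mons-degree N d)

  mons-unique : ∀ N d → Unique (mons N d)
  mons-unique zero    zero    = [] ∷ []
  mons-unique zero    (suc d) = []
  mons-unique (suc N) zero    = Unique.map⁺ Vec.∷-injectiveʳ (mons-unique N zero)
  mons-unique (suc N) (suc d) = Unique.++⁺
    (Unique.map⁺ Vec.∷-injectiveʳ (mons-unique N (suc d)))
    (Unique.map⁺ (inc-injective Fin.zero) (mons-unique (suc N) d)) disjoint
    where
    disjoint : ∀ {α} → ¬ (α ∈ map (0 ∷_) (mons N (suc d)) × α ∈ map (inc Fin.zero) (mons (suc N) d))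
    disjoint (α∈₁ , α∈₂) with ∈-map⁻ (0 ∷_) α∈₁ | ∈-map⁻ (inc Fin.zero) α∈₂
    ... | β , _ , refl | (b ∷ γ) , _ , ()

  ∑-mons-0 : ∀ (v : Fin N) (φ : Vec ℕ N → ℕ) → (∀ κ → lookup κ v ≡ 0 → φ κ ≡ 0) → ∑ (mons N 0) φ ≡ 0
  ∑-mons-0 {suc N} Fin.zero    φ h = trans (∑-map (0 ∷_) (mons N 0) φ) (∑-0 (mons N 0) λ α → h (0 ∷ α) refl)
  ∑-mons-0 {suc N} (Fin.suc v) φ h = trans (∑-map (0 ∷_) (mons N 0) φ) (∑-mons-0 v (φ ∘ (0 ∷_)) λ κ → h (0 ∷ κ))

  -- Division by v maps the multiples of v of degree d + 1 bijectively onto the monomials of degree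
  -- d. As `mons` favours the first variable, other v need an induction.
  ∑-mons-suc : ∀ (v : Fin N) d (φ : Vec ℕ N → ℕ) → (∀ κ → lookup κ v ≡ 0 → φ κ ≡ 0) →
               ∑ (mons N (suc d)) φ ≡ ∑ (mons N d) (φ ∘ inc v)
  ∑-mons-suc {suc N} Fin.zero    d φ h = trans (∑-++ (map (0 ∷_) (mons N (suc d))) _ φ)
    (cong₂ _+_ (trans (∑-map (0 ∷_) (mons N (suc d)) φ) (∑-0 (mons N (suc d)) λ α → h (0 ∷ α) refl))
               (∑-map (inc Fin.zero) (mons (suc N) d) φ))
  ∑-mons-suc {suc N} (Fin.suc v) zero φ h = trans (∑-++ (map (0 ∷_) (mons N 1)) _ φ)
    (trans (cong₂ _+_
      (trans (∑-map (0 ∷_) (mons N 1) φ) (∑-mons-suc v 0 (φ ∘ (0 ∷_)) λ κ → h (0 ∷ κ)))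
      (trans (∑-map (inc Fin.zero) (mons (suc N) 0) φ) (∑-mons-0 (Fin.suc v) (φ ∘ inc Fin.zero) λ { (a ∷ κ) → h (suc a ∷ κ) })))
    (trans (+-identityʳ _) (sym (∑-map (0 ∷_) (mons N 0) _))))
  ∑-mons-suc {suc N} (Fin.suc v) (suc d) φ h = trans (∑-++ (map (0 ∷_) (mons N (suc (suc d)))) _ φ)
    (trans (cong₂ _+_
      (trans (∑-map (0 ∷_) (mons N (suc (suc d))) φ) (trans (∑-mons-suc v (suc d) (φ ∘ (0 ∷_)) λ κ → h (0 ∷ κ))
        (sym (∑-map (0 ∷_) (mons N (suc d)) _))))
      (trans (∑-map (inc Fin.zero) (mons (suc N) (suc d)) φ)
        (trans (∑-mons-suc (Fin.suc v) d (φ ∘ inc Fin.zero) λ { (a ∷ κ) → h (suc a ∷ κ) })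
        (trans (∑-cong (mons (suc N) d) λ κ → cong φ (inc-comm Fin.zero (Fin.suc v) κ))
          (sym (∑-map (inc Fin.zero) (mons (suc N) d) _))))))
    (sym (∑-++ (map (0 ∷_) (mons N (suc d))) _ (φ ∘ inc (Fin.suc v)))))

  𝟙 : {P : Set ℓᴾ} → Dec P → ℕ
  𝟙 (yes _) = 1
  𝟙 (no  _) = 0

  𝟙-mono : {P Q : Set ℓᴾ} (P? : Dec P) (Q? : Dec Q) → (P → Q) → 𝟙 P? ≤ 𝟙 Q?
  𝟙-mono (no _)  Q?      f = z≤n
  𝟙-mono (yes p) (yes q) f = ≤-refl
  𝟙-mono (yes p) (no ¬q) f = contradiction (f p) ¬q

  𝟙-cong : {P Q : Set ℓᴾ} (P? : Dec P) (Q? : Dec Q) → (P → Q) → (Q → P) → 𝟙 P? ≡ 𝟙 Q?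
  𝟙-cong P? Q? f g = ≤-antisym (𝟙-mono P? Q? f) (𝟙-mono Q? P? g)

  -- f (d - s), read as 0 when s exceeds d.
  _⟨_-_⟩ : (ℕ → ℕ) → ℕ → ℕ → ℕ
  f ⟨ d     - zero  ⟩ = f d
  f ⟨ zero  - suc s ⟩ = 0
  f ⟨ suc d - suc s ⟩ = f ⟨ d - s ⟩

  ∑-multiples : ∀ w d (φ : Vec ℕ N → ℕ) →
    ∑ (mons N d) (λ κ → 𝟙 (w ∣ᵐ? κ) * φ κ) ≡ (λ d → ∑ (mons N d) (φ ∘ incs w)) ⟨ d - length w ⟩
  ∑-multiples {N} []      d φ = ∑-cong (mons N d) λ κ → +-identityʳ (φ κ)
  ∑-multiples {N} (v ∷ w) d φ = by d
    where
    vanish : ∀ κ → lookup κ v ≡ 0 → 𝟙 (v ∷ w ∣ᵐ? κ) * φ κ ≡ 0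
    vanish κ ≡0 with v ∷ w ∣ᵐ? κ
    ... | yes (β , refl) = contradiction ≡0 (inc≢0 v {incs w β})
    ... | no  _          = refl
    by : ∀ d → ∑ (mons N d) (λ κ → 𝟙 (v ∷ w ∣ᵐ? κ) * φ κ) ≡ (λ d → ∑ (mons N d) (φ ∘ incs (v ∷ w))) ⟨ d - suc (length w) ⟩
    by zero    = ∑-mons-0 v _ vanish
    by (suc d) = trans (∑-mons-suc v d _ vanish)
      (trans (∑-cong (mons N d) λ κ → cong (_* φ (inc v κ))
         (𝟙-cong (v ∷ w ∣ᵐ? inc v κ) (w ∣ᵐ? κ)
            (λ { (β , eq) → β , inc-injective v eq }) (λ { (β , refl) → β , refl })))
        (∑-multiples w d (φ ∘ inc v)))

  ∑-lookup : ∀ (α : Vec ℕ N) → ∑ (allFin N) (lookup α) ≡ Vec.sum α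
  ∑-lookup []      = refl
  ∑-lookup (a ∷ α) = cong (a +_) (trans (cong (λ vs → ∑ vs (lookup (a ∷ α))) (sym (List.map-tabulate (λ x → x) Fin.suc)))
    (trans (∑-map Fin.suc (allFin _) (lookup (a ∷ α))) (∑-lookup α)))

  ∑-mons-cong : ∀ d {f g : Vec ℕ N → ℕ} → (∀ κ → Vec.sum κ ≡ d → f κ ≡ g κ) → ∑ (mons N d) f ≡ ∑ (mons N d) g
  ∑-mons-cong {N} d {f} {g} h = go (mons N d) (mons-sound N d)
    where
    go : ∀ xs → (∀ {κ} → κ ∈ xs → Vec.sum κ ≡ d) → ∑ xs f ≡ ∑ xs g
    go []       _ = refl
    go (x ∷ xs) s = cong₂ _+_ (h x (s (here refl))) (go xs (s ∘ there))

  module Count {P : Vec ℕ N → Set} (P? : ∀ κ → Dec (P κ)) where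
    # : ℕ → ℕ
    # d = ∑ (mons N d) (𝟙 ∘ P?)

    -- Both sides count pairs (κ , v) with κ of degree d + 1 in P, weighted by the exponent of v in κ.
    DownClosed : Set
    DownClosed = ∀ v {κ} → P (inc v κ) → P κ

    down-closed-growth : DownClosed → ∀ d → suc d * # (suc d) ≤ (d + N) * # d
    down-closed-growth down d = begin
      suc d * # (suc d)
        ≡⟨ sym (∑-*ˡ (mons N (suc d)) _ (suc d)) ⟩
      ∑ (mons N (suc d)) (λ κ → suc d * 𝟙 (P? κ))
        ≡⟨ ∑-mons-cong (suc d) (λ κ eq → cong (_* 𝟙 (P? κ)) (sym (trans (∑-lookup κ) eq))) ⟩
      ∑ (mons N (suc d)) (λ κ → ∑ (allFin N) (lookup κ) * 𝟙 (P? κ))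
        ≡⟨ ∑-cong (mons N (suc d)) (λ κ → sym (∑-*ʳ (allFin N) (lookup κ) (𝟙 (P? κ)))) ⟩
      ∑ (mons N (suc d)) (λ κ → ∑ (allFin N) (λ v → lookup κ v * 𝟙 (P? κ)))
        ≡⟨ ∑-swap (mons N (suc d)) (allFin N) _ ⟩
      ∑ (allFin N) (λ v → ∑ (mons N (suc d)) (λ κ → lookup κ v * 𝟙 (P? κ)))
        ≡⟨ ∑-cong (allFin N) (λ v → ∑-mons-suc v d _ (λ κ ≡0 → cong (_* 𝟙 (P? κ)) ≡0)) ⟩
      ∑ (allFin N) (λ v → ∑ (mons N d) (λ β → lookup (inc v β) v * 𝟙 (P? (inc v β))))
        ≤⟨ ∑-mono-≤ (allFin N) (λ v → ∑-mono-≤ (mons N d) λ β →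
             *-mono-≤ (≤-reflexive (lookup-inc v β)) (𝟙-mono (P? (inc v β)) (P? β) (down v))) ⟩
      ∑ (allFin N) (λ v → ∑ (mons N d) (λ β → suc (lookup β v) * 𝟙 (P? β)))
        ≡⟨ sym (∑-swap (mons N d) (allFin N) _) ⟩
      ∑ (mons N d) (λ β → ∑ (allFin N) (λ v → suc (lookup β v) * 𝟙 (P? β)))
        ≡⟨ ∑-mons-cong d (λ β eq → trans (∑-*ʳ (allFin N) (suc ∘ lookup β) (𝟙 (P? β))) (cong (_* 𝟙 (P? β))
             (trans (∑-+ (allFin N) (λ _ → 1) (lookup β)) (trans (cong₂ _+_ (trans (∑-const (allFin N) 1)
               (trans (*-identityʳ _) (List.length-tabulate {n = N} (λ x → x)))) (trans (∑-lookup β) eq)) (+-comm N d))))) ⟩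
      ∑ (mons N d) (λ β → (d + N) * 𝟙 (P? β))
        ≡⟨ ∑-*ˡ (mons N d) _ (d + N) ⟩
      (d + N) * # d ∎
      where open ≤-Reasoning

  -- The binomial coefficient (N + d - 1 choose d), the dimension of `S d N`.
  H : ℕ → ℕ → ℕ
  H zero    zero    = 1
  H zero    (suc d) = 0
  H (suc N) zero    = H N zero
  H (suc N) (suc d) = H N (suc d) + H (suc N) d

  length-mons : ∀ N d → length (mons N d) ≡ H N d
  length-mons zero    zero    = refl
  length-mons zero    (suc d) = refl
  length-mons (suc N) zero    = trans (List.length-map _ (mons N zero)) (length-mons N zero)
  length-mons (suc N) (suc d) = trans (List.length-++ (map (0 ∷_) (mons N (suc d))))
    (cong₂ _+_ (trans (List.length-map _ (mons N (suc d))) (length-mons N (suc d)))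
               (trans (List.length-map _ (mons (suc N) d)) (length-mons (suc N) d)))

  ∑-mons-1 : ∀ N d → ∑ (mons N d) (λ _ → 1) ≡ H N d
  ∑-mons-1 N d = trans (∑-const (mons N d) 1) (trans (*-identityʳ _) (length-mons N d))

  -- The two growth ratios of these binomial coefficients, cleared of denominators; a joint
  -- induction derives both from Pascal's rule.
  H-suc-degree : ∀ N d → suc d * H N (suc d) ≡ (d + N) * H N d
  H-suc-vars   : ∀ N d → N * H (suc N) d ≡ (d + N) * H N d
  H-suc-degree zero    zero    = refl
  H-suc-degree zero    (suc d) = trans (*-zeroʳ (suc (suc d))) (sym (*-zeroʳ (suc d + 0)))
  H-suc-degree (suc N) d = trans (*-distribˡ-+ (suc d) (H N (suc d)) (H (suc N) d))
    (trans (cong (_+ suc d * H (suc N) d) (trans (H-suc-degree N d) (sym (H-suc-vars N d))))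
    (solve 3 (λ N d h → N :* h :+ (con 1 :+ d) :* h := (d :+ (con 1 :+ N)) :* h) refl N d (H (suc N) d)))
  H-suc-vars N zero    = refl
  H-suc-vars N (suc d) = trans (*-distribˡ-+ N (H N (suc d)) (H (suc N) d))
    (trans (cong (N * H N (suc d) +_) (trans (H-suc-vars N d) (sym (H-suc-degree N d))))
    (solve 3 (λ N d h → N :* h :+ (con 1 :+ d) :* h := (con 1 :+ d :+ N) :* h) refl N d (H N (suc d))))

  H>0 : ∀ N d → 0 < H (suc N) d
  H>0 zero    zero    = s≤s z≤n
  H>0 (suc N) zero    = H>0 N zero
  H>0 N       (suc d) = ≤-trans (H>0 N d) (m≤n+m (H (suc N) d) (H N (suc d)))

  H-mono : ∀ N {c d} → c ≤ d → H (suc N) c ≤ H (suc N) d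
  H-mono N {c} {zero}  z≤n = ≤-refl
  H-mono N {c} {suc d} c≤d with m≤n⇒m<n∨m≡n c≤d
  ... | inj₂ refl      = ≤-refl
  ... | inj₁ (s≤s c≤d′) = ≤-trans (H-mono N c≤d′) (m≤n+m (H (suc N) d) (H N (suc d)))

  ⟨-⟩-+ : ∀ (f : ℕ → ℕ) x s → f ⟨ x + s - s ⟩ ≡ f x
  ⟨-⟩-+ f x zero    = cong f (+-identityʳ x)
  ⟨-⟩-+ f x (suc s) = trans (cong (λ d → f ⟨ d - suc s ⟩) (+-suc x s)) (⟨-⟩-+ f x s)

  ⟨-⟩-< : ∀ (f : ℕ → ℕ) {d s} → d < s → f ⟨ d - s ⟩ ≡ 0
  ⟨-⟩-< f {zero}  {suc s} _         = refl
  ⟨-⟩-< f {suc d} {suc s} (s≤s d<s) = ⟨-⟩-< f d<s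

  ⟨-⟩-cong : ∀ {f g : ℕ → ℕ} → (∀ d → f d ≡ g d) → ∀ d s → f ⟨ d - s ⟩ ≡ g ⟨ d - s ⟩
  ⟨-⟩-cong h d       zero    = h d
  ⟨-⟩-cong h zero    (suc s) = refl
  ⟨-⟩-cong h (suc d) (suc s) = ⟨-⟩-cong h d s

  split-≤ : ∀ {s d} → s ≤ d → ∃ λ x → d ≡ x + s
  split-≤ {s} {d} s≤d = d ∸ s , sym (m∸n+n≡m s≤d)

  -- The hypothesis on single steps says that f/g does not increase from d to d + 1; the steps are
  -- chained by cancelling g (d + s).
  ratio-antitone : ∀ (f g : ℕ → ℕ) → (∀ d → 0 < g d) → (∀ d → f (suc d) * g d ≤ f d * g (suc d)) →
                   ∀ d s → f (d + s) * g d ≤ f d * g (d + s)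
  ratio-antitone f g g>0 step d zero = ≤-reflexive (cong₂ _*_ (cong f (+-identityʳ d)) (cong g (sym (+-identityʳ d))))
  ratio-antitone f g g>0 step d (suc s) = subst (λ n → f n * g d ≤ f d * g n) (sym (+-suc d s))
    (*-cancelʳ-≤ _ _ (g (d + s)) {{>-nonZero (g>0 (d + s))}} (begin
      f (suc (d + s)) * g d * g (d + s)   ≡⟨ swap (f (suc (d + s))) (g d) (g (d + s)) ⟩
      f (suc (d + s)) * g (d + s) * g d   ≤⟨ *-monoˡ-≤ (g d) (step (d + s)) ⟩
      f (d + s) * g (suc (d + s)) * g d   ≡⟨ swap (f (d + s)) _ (g d) ⟩
      f (d + s) * g d * g (suc (d + s))   ≤⟨ *-monoˡ-≤ (g (suc (d + s))) (ratio-antitone f g g>0 step d s) ⟩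
      f d * g (d + s) * g (suc (d + s))   ≡⟨ swap (f d) _ _ ⟩
      f d * g (suc (d + s)) * g (d + s)   ∎))
    where
    open ≤-Reasoning
    swap : ∀ a b c → a * b * c ≡ a * c * b
    swap a b c = trans (*-assoc a b c) (trans (cong (a *_) (*-comm b c)) (sym (*-assoc a c b)))

  -- The growth factor (d + N + 1)/(d + 1) of `H (suc N)` does not increase with d; cleared of
  -- denominators, the two sides differ by the term with N * c.
  H-log-concave : ∀ N d c → H (suc N) (suc d + c) * H (suc N) d ≤ H (suc N) (d + c) * H (suc N) (suc d)
  H-log-concave N d c = *-cancelˡ-≤ (suc d * suc (d + c)) (begin
    (suc d * suc (d + c)) * (h (suc (d + c)) * h d)
      ≡⟨ solve 4 (λ a b x y → a :* b :* (x :* y) := (b :* x) :* (a :* y)) refl (suc d) (suc (d + c)) (h (suc (d + c))) (h d) ⟩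
    (suc (d + c) * h (suc (d + c))) * (suc d * h d)
      ≡⟨ cong (_* (suc d * h d)) (H-suc-degree (suc N) (d + c)) ⟩
    ((d + c + suc N) * h (d + c)) * (suc d * h d)
      ≤⟨ ≤-trans (m≤m+n _ (N * c * (h (d + c) * h d))) (≤-reflexive
          (solve 5 (λ N d c x y → ((d :+ c :+ (con 1 :+ N)) :* x) :* ((con 1 :+ d) :* y) :+ N :* c :* (x :* y)
             := ((con 1 :+ (d :+ c)) :* x) :* ((d :+ (con 1 :+ N)) :* y)) refl N d c (h (d + c)) (h d))) ⟩
    (suc (d + c) * h (d + c)) * ((d + suc N) * h d)
      ≡⟨ cong ((suc (d + c) * h (d + c)) *_) (sym (H-suc-degree (suc N) d)) ⟩
    (suc (d + c) * h (d + c)) * (suc d * h (suc d))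
      ≡⟨ solve 4 (λ a b x y → (b :* x) :* (a :* y) := a :* b :* (x :* y)) refl (suc d) (suc (d + c)) (h (d + c)) (h (suc d)) ⟩
    (suc d * suc (d + c)) * (h (d + c) * h (suc d)) ∎)
    where
    open ≤-Reasoning
    h = H (suc N)

  -- H (d - s) / H d is the proportion of monomials of degree d that a word of length s divides. By
  -- log-concavity it does not decrease with the degree.
  H-ratio : ∀ N τ c s → H (suc N) ⟨ τ - s ⟩ * H (suc N) (τ + c) ≤ H (suc N) ⟨ τ + c - s ⟩ * H (suc N) τ
  H-ratio N τ c s with ≤-<-connex s τ
  ... | inj₂ τ<s = ≤-trans (≤-reflexive (cong (_* H (suc N) (τ + c)) (⟨-⟩-< (H (suc N)) τ<s))) z≤n
  ... | inj₁ s≤τ with split-≤ s≤τ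
  ...   | x , refl = subst₂ _≤_ (trans (*-comm (h (x + s + c)) (h x)) (cong (_* h (x + s + c)) (sym (⟨-⟩-+ h x s))))
            (cong (_* h (x + s)) (trans (sym (⟨-⟩-+ h (x + c) s)) (cong (λ d → h ⟨ d - s ⟩) xcs)))
            (ratio-antitone (λ d → h (d + c)) h (H>0 N) (λ d → H-log-concave N d c) x s)
    where
    h = H (suc N)
    xcs : x + c + s ≡ x + s + c
    xcs = trans (+-assoc x c s) (trans (cong (x +_) (+-comm c s)) (sym (+-assoc x s c)))

  -- The density of a set closed under division does not increase with the degree:
  -- `down-closed-growth` bounds its growth by exactly the factor by which `H` grows.
  down-closed-ratio : ∀ {P : Vec ℕ (suc N) → Set} (P? : ∀ κ → Dec (P κ)) → Count.DownClosed P? →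
    ∀ d s → Count.# P? d * H (suc N) ⟨ d - s ⟩ ≤ Count.# P? ⟨ d - s ⟩ * H (suc N) d
  down-closed-ratio {N} P? down d s with ≤-<-connex s d
  ... | inj₂ d<s = ≤-trans (≤-reflexive (trans (cong (Count.# P? d *_) (⟨-⟩-< (H (suc N)) d<s)) (*-zeroʳ (Count.# P? d)))) z≤n
  ... | inj₁ s≤d with split-≤ s≤d
  ...   | x , refl = subst₂ _≤_ (cong (# (x + s) *_) (sym (⟨-⟩-+ h x s))) (cong (_* h (x + s)) (sym (⟨-⟩-+ # x s)))
            (ratio-antitone # h (H>0 N) step x s)
    where
    open Count P? using (#; down-closed-growth)
    h = H (suc N)
    step : ∀ d → # (suc d) * h d ≤ # d * h (suc d)
    step d = *-cancelˡ-≤ (suc d) (begin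
      suc d * (# (suc d) * h d)    ≡⟨ sym (*-assoc (suc d) (# (suc d)) (h d)) ⟩
      suc d * # (suc d) * h d      ≤⟨ *-monoˡ-≤ (h d) (down-closed-growth down d) ⟩
      (d + suc N) * # d * h d      ≡⟨ solve 3 (λ a b c → a :* b :* c := b :* (a :* c)) refl (d + suc N) (# d) (h d) ⟩
      # d * ((d + suc N) * h d)    ≡⟨ cong (# d *_) (sym (H-suc-degree (suc N) d)) ⟩
      # d * (suc d * h (suc d))    ≡⟨ solve 3 (λ a b c → b :* (a :* c) := a :* (b :* c)) refl (suc d) (# d) (h (suc d)) ⟩
      suc d * (# d * h (suc d))    ∎)
      where open ≤-Reasoning

  Avoid : List (List (Fin N)) → Vec ℕ N → Set
  Avoid ws κ = All (λ w → ¬ w ∣ᵐ κ) ws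

  Avoid? : ∀ ws (κ : Vec ℕ N) → Dec (Avoid ws κ)
  Avoid? ws κ = All.all? (λ w → ¬? (w ∣ᵐ? κ)) ws

  #Avoid : List (List (Fin N)) → ℕ → ℕ
  #Avoid ws = Count.# (Avoid? ws)

  Avoid-incs⁻ : ∀ ws w {κ : Vec ℕ N} → Avoid ws (incs w κ) → Avoid ws κ
  Avoid-incs⁻ ws w = All.map λ {w′} w′∤ w′∣κ → w′∤ (∣ᵐ-incs⁺ w′ w w′∣κ)

  Avoid-incs⁺ : ∀ ws w {κ : Vec ℕ N} → All (Disjoint w) ws → Avoid ws κ → Avoid ws (incs w κ)
  Avoid-incs⁺ []       w []       []       = []
  Avoid-incs⁺ (w′ ∷ ws) w (d ∷ ds) (a ∷ as) =
    (λ w′∣ → a (∣ᵐ-incs⁻ w′ w (Disjoint-sym d) w′∣)) ∷ Avoid-incs⁺ ws w ds as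

  -- As w is coprime to the words of ws, division by w maps the multiples of w that avoid ws onto
  -- all monomials of degree d - length w that avoid ws.
  #Avoid-∷ : ∀ (w : List (Fin N)) ws d → All (Disjoint w) ws →
             #Avoid (w ∷ ws) d + #Avoid ws ⟨ d - length w ⟩ ≡ #Avoid ws d
  #Avoid-∷ {N} w ws d disj = trans
    (cong (#Avoid (w ∷ ws) d +_) (trans
      (⟨-⟩-cong (λ d → ∑-cong (mons N d) λ β → 𝟙-cong (Avoid? ws β) (Avoid? ws (incs w β))
        (Avoid-incs⁺ ws w disj) (Avoid-incs⁻ ws w)) d (length w))
      (sym (∑-multiples w d (𝟙 ∘ Avoid? ws)))))
    (trans (sym (∑-+ (mons N d) _ _)) (∑-cong (mons N d) pointwise))
    where
    pointwise : ∀ κ → 𝟙 (Avoid? (w ∷ ws) κ) + 𝟙 (w ∣ᵐ? κ) * 𝟙 (Avoid? ws κ) ≡ 𝟙 (Avoid? ws κ)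
    pointwise κ with w ∣ᵐ? κ | Avoid? ws κ
    ... | yes _ | yes _ = refl
    ... | yes _ | no  _ = refl
    ... | no  _ | yes _ = refl
    ... | no  _ | no  _ = refl

  H⟨-⟩-mono : ∀ N d {r s} → r ≤ s → H (suc N) ⟨ d - s ⟩ ≤ H (suc N) ⟨ d - r ⟩
  H⟨-⟩-mono N d {s = zero} z≤n = ≤-refl
  H⟨-⟩-mono N zero    {s = suc s} z≤n = z≤n
  H⟨-⟩-mono N (suc d) {s = suc s} z≤n = ≤-trans (H⟨-⟩-mono N d {s = s} z≤n) (H-mono N (n≤1+n d))
  H⟨-⟩-mono N zero    (s≤s r≤s) = ≤-refl
  H⟨-⟩-mono N (suc d) (s≤s r≤s) = H⟨-⟩-mono N d r≤s

  -- Each further word w leaves at most the proportion y / H of the avoiders. Those it divides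
  -- correspond to avoiders in degree d - length w, whose density is at least that in degree d. So
  -- avoiding coprime words is at least as rare as it would be for independent events.
  #Avoid-bound : ∀ (ws : List (List (Fin (suc N)))) s d y → AllPairs Disjoint ws → All (λ w → length w ≤ s) ws →
    H (suc N) d ≤ y + H (suc N) ⟨ d - s ⟩ → #Avoid ws d * H (suc N) d ^ length ws ≤ H (suc N) d * y ^ length ws
  #Avoid-bound {N} [] s d y _ _ _ = *-monoˡ-≤ 1 (≤-reflexive (∑-mons-1 (suc N) d))
  #Avoid-bound {N} (w ∷ ws) s d y (disj ∷ disjs) (≤s ∷ ≤ss) Hd≤ = begin
    a′ * (h * h ^ j)     ≡⟨ sym (*-assoc a′ h (h ^ j)) ⟩
    a′ * h * h ^ j       ≤⟨ *-monoˡ-≤ (h ^ j) (+-cancelʳ-≤ (a * h⁻) (a′ * h) (a * y) key) ⟩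
    a * y * h ^ j        ≡⟨ solve 3 (λ a y h → a :* y :* h := y :* (a :* h)) refl a y (h ^ j) ⟩
    y * (a * h ^ j)      ≤⟨ *-monoʳ-≤ y (#Avoid-bound ws s d y disjs ≤ss Hd≤) ⟩
    y * (h * y ^ j)      ≡⟨ solve 3 (λ y h p → y :* (h :* p) := h :* (y :* p)) refl y h (y ^ j) ⟩
    h * (y * y ^ j)      ∎
    where
    open ≤-Reasoning
    j = length ws
    h = H (suc N) d
    h⁻ = H (suc N) ⟨ d - s ⟩
    a = #Avoid ws d
    a′ = #Avoid (w ∷ ws) d
    a⁻ = #Avoid ws ⟨ d - length w ⟩
    key : a′ * h + a * h⁻ ≤ a * y + a * h⁻
    key = begin
      a′ * h + a * h⁻   ≤⟨ +-monoʳ-≤ (a′ * h) (≤-trans (*-monoʳ-≤ a (H⟨-⟩-mono N d ≤s))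
                             (down-closed-ratio (Avoid? ws) (λ v → Avoid-incs⁻ ws [ v ]) d (length w))) ⟩
      a′ * h + a⁻ * h   ≡⟨ sym (*-distribʳ-+ h a′ a⁻) ⟩
      (a′ + a⁻) * h     ≡⟨ cong (_* h) (#Avoid-∷ w ws d disj) ⟩
      a * h             ≤⟨ *-monoʳ-≤ a Hd≤ ⟩
      a * (y + h⁻)      ≡⟨ *-distribˡ-+ a y h⁻ ⟩
      a * y + a * h⁻    ∎

  -- A monomial not divisible by the s-th power of the first variable has one of s exponents there,
  -- and each leaves at most `H (suc N) d` monomials in the other variables.
  H-drop-bound : ∀ N d s → H (suc (suc N)) d ≤ s * H (suc N) d + H (suc (suc N)) ⟨ d - s ⟩
  H-drop-bound N d       zero    = ≤-refl
  H-drop-bound N zero    (suc s) = ≤-trans (m≤m+n (H N 0) (s * H N 0)) (m≤m+n _ 0)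
  H-drop-bound N (suc d) (suc s) = begin
    H (suc N) (suc d) + H (suc (suc N)) d
      ≤⟨ +-monoʳ-≤ (H (suc N) (suc d)) (H-drop-bound N d s) ⟩
    H (suc N) (suc d) + (s * H (suc N) d + H (suc (suc N)) ⟨ d - s ⟩)
      ≡⟨ sym (+-assoc (H (suc N) (suc d)) _ _) ⟩
    H (suc N) (suc d) + s * H (suc N) d + H (suc (suc N)) ⟨ d - s ⟩
      ≤⟨ +-monoˡ-≤ (H (suc (suc N)) ⟨ d - s ⟩) (+-monoʳ-≤ (H (suc N) (suc d)) (*-monoʳ-≤ s (H-mono N (n≤1+n d)))) ⟩
    H (suc N) (suc d) + s * H (suc N) (suc d) + H (suc (suc N)) ⟨ d - s ⟩ ∎
    where open ≤-Reasoning

  -- For K > 0 the second hypothesis reads y/H ≤ 1 - 1/K, and the claim follows the inequality (1 -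
  -- 1/K)^j ≤ 1/(1 + j/K).
  bernoulli : ∀ K H y j → y ≤ H → K * y + H ≤ K * H → (K + j) * y ^ j ≤ K * H ^ j
  bernoulli K H y zero    y≤H h = ≤-reflexive (cong (_* 1) (+-identityʳ K))
  bernoulli K H y (suc j) y≤H h = begin
    (K + suc j) * (y * y ^ j)   ≡⟨ sym (*-assoc (K + suc j) y (y ^ j)) ⟩
    (K + suc j) * y * y ^ j     ≤⟨ *-monoˡ-≤ (y ^ j) step ⟩
    (K + j) * H * y ^ j         ≡⟨ solve 3 (λ a h p → a :* h :* p := h :* (a :* p)) refl (K + j) H (y ^ j) ⟩
    H * ((K + j) * y ^ j)       ≤⟨ *-monoʳ-≤ H (bernoulli K H y j y≤H h) ⟩
    H * (K * H ^ j)             ≡⟨ solve 3 (λ h k p → h :* (k :* p) := k :* (h :* p)) refl H K (H ^ j) ⟩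
    K * (H * H ^ j)             ∎
    where
    open ≤-Reasoning
    step : (K + suc j) * y ≤ (K + j) * H
    step = begin
      (K + suc j) * y        ≡⟨ solve 3 (λ k j y → (k :+ (con 1 :+ j)) :* y := (k :* y :+ y) :+ j :* y) refl K j y ⟩
      (K * y + y) + j * y    ≤⟨ +-mono-≤ (≤-trans (+-monoʳ-≤ (K * y) y≤H) h) (*-monoʳ-≤ j y≤H) ⟩
      K * H + j * H          ≡⟨ sym (*-distribʳ-+ H K j) ⟩
      (K + j) * H            ∎

  -- Adding a variable to V variables multiplies H by (V + d)/V, and V ≥ suc P throughout.
  H-vars-ratio : ∀ P M d → H (suc P + M) d * suc P ^ M ≤ H (suc P) d * (suc P + d) ^ M
  H-vars-ratio P zero    d = ≤-reflexive (cong (λ n → H n d * 1) (+-identityʳ (suc P)))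
  H-vars-ratio P (suc M) d = subst (λ n → H n d * suc P ^ suc M ≤ H (suc P) d * (suc P + d) ^ suc M) (sym (+-suc (suc P) M)) (begin
    X * (suc P * suc P ^ M)              ≡⟨ sym (*-assoc X (suc P) _) ⟩
    X * suc P * suc P ^ M                ≤⟨ *-monoˡ-≤ (suc P ^ M) step ⟩
    Y * (suc P + d) * suc P ^ M          ≡⟨ solve 3 (λ a h p → a :* h :* p := h :* (a :* p)) refl Y (suc P + d) _ ⟩
    (suc P + d) * (Y * suc P ^ M)        ≤⟨ *-monoʳ-≤ (suc P + d) (H-vars-ratio P M d) ⟩
    (suc P + d) * (H (suc P) d * (suc P + d) ^ M) ≡⟨ solve 3 (λ h k p → h :* (k :* p) := k :* (h :* p)) refl (suc P + d) (H (suc P) d) ((suc P + d) ^ M) ⟩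
    H (suc P) d * ((suc P + d) * (suc P + d) ^ M) ∎)
    where
    open ≤-Reasoning
    X = H (suc (suc P + M)) d
    Y = H (suc P + M) d
    step : X * suc P ≤ Y * (suc P + d)
    step = *-cancelˡ-≤ (suc P + M) (begin
      (suc P + M) * (X * suc P)           ≡⟨ sym (*-assoc (suc P + M) X (suc P)) ⟩
      (suc P + M) * X * suc P             ≡⟨ cong (_* suc P) (H-suc-vars (suc P + M) d) ⟩
      (d + (suc P + M)) * Y * suc P       ≤⟨ ≤-trans (m≤m+n _ (M * d * Y)) (≤-reflexive
          (solve 4 (λ p m d y → (d :+ (p :+ m)) :* y :* p :+ m :* d :* y := (p :+ m) :* (y :* (p :+ d))) refl (suc P) M d Y)) ⟩
      (suc P + M) * (Y * (suc P + d))     ∎)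

  ^-distribʳ-* : ∀ a b n → (a * b) ^ n ≡ a ^ n * b ^ n
  ^-distribʳ-* a b zero    = refl
  ^-distribʳ-* a b (suc n) = trans (cong (a * b *_) (^-distribʳ-* a b n))
    (solve 4 (λ a b p q → a :* b :* (p :* q) := a :* p :* (b :* q)) refl a b (a ^ n) (b ^ n))

  -- `H (suc P) d` counts the monomials that avoid M given variables; by `H-vars-ratio` their
  -- proportion is at least (suc P / Q)^M with Q = suc P + d. So it suffices that each of M blocks
  -- of 1 + 2sK words costs a factor suc P / 2Q: the M factors 1/2 make up for e ≤ 2^M.
  many-avoided-is-rare : ∀ P M s K d e (ws : List (List (Fin (suc P + M)))) →
    AllPairs Disjoint ws → All (λ w → length w ≤ s) ws → length ws ≡ M * suc (2 * s * K) →
    0 < M → 0 < K → 0 < P → e ≤ 2 ^ M → 2 * s * (P + M) ≤ suc (2 * s) * suc P →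
    H (suc P + M) d ≤ K * H (suc P + M) ⟨ d - s ⟩ →
    e * #Avoid ws d ≤ H (suc P) d
  many-avoided-is-rare P@(suc P′) M s K d e ws disj ≤s len 0<M 0<K _ e≤2^M sP≤ Hd≤ = begin
    e * a       ≤⟨ *-monoˡ-≤ a e≤2^M ⟩
    2 ^ M * a   ≤⟨ *-cancelʳ-≤ (2 ^ M * a) z (Q ^ M) {{m^n≢0 Q M}} (begin
       2 ^ M * a * Q ^ M   ≡⟨ solve 3 (λ t a q → t :* a :* q := a :* (t :* q)) refl (2 ^ M) a (Q ^ M) ⟩
       a * (2 ^ M * Q ^ M) ≡⟨ cong (a *_) (sym (^-distribʳ-* 2 Q M)) ⟩
       a * (2 * Q) ^ M     ≤⟨ *-cancelʳ-≤ _ _ (h ^ n) {{m^n≢0 h n}} total ⟩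
       h * suc P ^ M       ≤⟨ H-vars-ratio P M d ⟩
       z * Q ^ M           ∎) ⟩
    z           ∎
    where
    open ≤-Reasoning
    V = P + M
    B = suc (2 * s * K)
    n = M * B
    h = H (suc V) d
    h⁻ = H (suc V) ⟨ d - s ⟩
    a = #Avoid ws d
    z = H (suc P) d
    Q = suc P + d
    y = h ∸ h⁻
    instance
      h≢0 : NonZero h
      h≢0 = >-nonZero (H>0 V d)
      K≢0 : NonZero K
      K≢0 = >-nonZero 0<K
    h⁻≤h : h⁻ ≤ h
    h⁻≤h = H⟨-⟩-mono V d {0} {s} z≤n
    y+h⁻≡h : y + h⁻ ≡ h
    y+h⁻≡h = m∸n+n≡m h⁻≤h
    Ky+h≤Kh : K * y + h ≤ K * h
    Ky+h≤Kh = begin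
      K * y + h       ≤⟨ +-monoʳ-≤ (K * y) Hd≤ ⟩
      K * y + K * h⁻  ≡⟨ sym (*-distribˡ-+ K y h⁻) ⟩
      K * (y + h⁻)    ≡⟨ cong (K *_) y+h⁻≡h ⟩
      K * h           ∎
    -- By `H-drop-bound` y is at most s * H V d, and V h = (d + V) H V d. The hypothesis `sP≤` then
    -- replaces 2sV by (2s + 1) suc P.
    2yQ≤ : y * (2 * Q) ≤ suc (2 * s) * (suc P * h)
    2yQ≤ = begin
      y * (2 * Q)                ≤⟨ *-mono-≤ y≤ (*-monoʳ-≤ 2 (subst (Q ≤_) (+-comm V d)
                                      (+-monoˡ-≤ d (subst (_≤ V) (+-comm P 1) (+-monoʳ-≤ P 0<M))))) ⟩
      s * H V d * (2 * (d + V))  ≡⟨ solve 3 (λ s x q → s :* x :* (con 2 :* q) := con 2 :* s :* (q :* x)) refl s (H V d) (d + V) ⟩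
      2 * s * ((d + V) * H V d)  ≡⟨ cong (2 * s *_) (sym (H-suc-vars V d)) ⟩
      2 * s * (V * h)            ≡⟨ sym (*-assoc (2 * s) V h) ⟩
      2 * s * V * h              ≤⟨ *-monoˡ-≤ h sP≤ ⟩
      suc (2 * s) * suc P * h    ≡⟨ *-assoc (suc (2 * s)) (suc P) h ⟩
      suc (2 * s) * (suc P * h)  ∎
      where
      y≤ : y ≤ s * H V d
      y≤ = ≤-trans (∸-monoˡ-≤ h⁻ (H-drop-bound (P′ + M) d s)) (≤-reflexive (m+n∸n≡m (s * H V d) h⁻))
    -- By `bernoulli`, 2sK words cost a factor K / (K + 2sK) = 1 / (1 + 2s); the one further word
    -- costs y / h ≤ (1 + 2s) suc P / 2Q.
    block : y ^ B * (2 * Q) ≤ suc P * h ^ B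
    block = *-cancelˡ-≤ (K * suc (2 * s)) {{m*n≢0 K (suc (2 * s))}} (begin
      K * suc (2 * s) * (y * y ^ j * (2 * Q))
        ≡⟨ solve 5 (λ K s y p q → K :* (con 1 :+ con 2 :* s) :* (y :* p :* q) := (K :+ con 2 :* s :* K) :* p :* (y :* q)) refl K s y (y ^ j) (2 * Q) ⟩
      (K + j) * y ^ j * (y * (2 * Q))
        ≤⟨ *-mono-≤ (bernoulli K h y j (m∸n≤m h h⁻) Ky+h≤Kh) 2yQ≤ ⟩
      K * h ^ j * (suc (2 * s) * (suc P * h))
        ≡⟨ solve 5 (λ K hj S P h → K :* hj :* (S :* (P :* h)) := K :* S :* (P :* (h :* hj))) refl K (h ^ j) (suc (2 * s)) (suc P) h ⟩
      K * suc (2 * s) * (suc P * (h * h ^ j)) ∎)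
      where j = 2 * s * K
    blocks : y ^ n * (2 * Q) ^ M ≤ suc P ^ M * h ^ n
    blocks = subst₂ _≤_ (trans (^-distribʳ-* (y ^ B) (2 * Q) M) (cong (_* (2 * Q) ^ M) (trans (^-*-assoc y B M) (cong (y ^_) (*-comm B M)))))
                        (trans (^-distribʳ-* (suc P) (h ^ B) M) (cong (suc P ^ M *_) (trans (^-*-assoc h B M) (cong (h ^_) (*-comm B M)))))
                        (^-monoˡ-≤ M block)
    total : a * (2 * Q) ^ M * h ^ n ≤ h * suc P ^ M * h ^ n
    total = begin
      a * (2 * Q) ^ M * h ^ n    ≡⟨ solve 3 (λ a q h → a :* q :* h := a :* h :* q) refl a ((2 * Q) ^ M) (h ^ n) ⟩
      a * h ^ n * (2 * Q) ^ M    ≤⟨ *-monoˡ-≤ ((2 * Q) ^ M) (subst (λ l → a * h ^ l ≤ h * y ^ l) len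
                                      (#Avoid-bound ws s d y disj ≤s (≤-reflexive (sym y+h⁻≡h)))) ⟩
      h * y ^ n * (2 * Q) ^ M    ≡⟨ *-assoc h (y ^ n) _ ⟩
      h * (y ^ n * (2 * Q) ^ M)  ≤⟨ *-monoʳ-≤ h blocks ⟩
      h * (suc P ^ M * h ^ n)    ≡⟨ sym (*-assoc h (suc P ^ M) (h ^ n)) ⟩
      h * suc P ^ M * h ^ n      ∎

  infixr 5 _∷_

  data Selection {N} : List (List (List (Fin N))) → List (Fin N) → Set where
    []  : Selection [] []
    _∷_ : ∀ {w C u Cs} → w ∈ C → Selection Cs u → Selection (C ∷ Cs) (w ++ u)

  data Independent {N} : List (List (List (Fin N))) → Set where
    []  : Independent []
    _∷_ : ∀ {C Cs} →
          AllPairs Disjoint C × (∀ {w C′ w′} → w ∈ C → C′ ∈ Cs → w′ ∈ C′ → Disjoint w w′) →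
          Independent Cs → Independent (C ∷ Cs)

  -- For the families made from walks these are leading monomials of shifted partials: u leads a
  -- derivative, and β is the shift.
  Good : ℕ → List (List (List (Fin N))) → Vec ℕ N → Set
  Good τ Cs κ = ∃ λ u → ∃ λ β → Selection Cs u × κ ≡ incs u β × Vec.sum β ≡ τ

  selection-∈ : ∀ {Cs u} {v : Fin N} → Selection Cs u → v ∈ u → ∃ λ C → ∃ λ w → C ∈ Cs × w ∈ C × v ∈ w
  selection-∈ (_∷_ {w} {C} w∈C sel) v∈ with ∈-++⁻ w v∈
  ... | inj₁ v∈w = C , w , here refl , w∈C , v∈w
  ... | inj₂ v∈u with selection-∈ sel v∈u
  ...   | C′ , w′ , C′∈ , w′∈ , v∈w′ = C′ , w′ , there C′∈ , w′∈ , v∈w′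

  selection-exists : ∀ {n} → 0 < n → ∀ (Cs : List (List (List (Fin N)))) → All (λ C → length C ≡ n) Cs → ∃ (Selection Cs)
  selection-exists 0<n []             []      = [] , []
  selection-exists 0<n ([] ∷ Cs)      (l ∷ h) = contradiction l (<⇒≢ 0<n)
  selection-exists 0<n ((w ∷ C) ∷ Cs) (l ∷ h) = let (u , sel) = selection-exists 0<n Cs h in w ++ u , here refl ∷ sel

  length-filter-∑ : ∀ {a p} {A : Set a} {P : Pred A p} (P? : Decidable P) xs → length (filter P? xs) ≡ ∑ xs (𝟙 ∘ P?)
  length-filter-∑ P? []       = refl
  length-filter-∑ P? (x ∷ xs) with P? x
  ... | yes _ = cong suc (length-filter-∑ P? xs)
  ... | no  _ = length-filter-∑ P? xs

  #Avoid-union-bound : ∀ (ws : List (List (Fin N))) s d → All (λ w → length w ≡ s) ws →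
    H N d ≤ #Avoid ws d + length ws * H N ⟨ d - s ⟩
  #Avoid-union-bound {N} ws s d lens = begin
    H N d
      ≡⟨ sym (∑-mons-1 N d) ⟩
    ∑ (mons N d) (λ _ → 1)
      ≤⟨ ∑-mono-≤ (mons N d) (pointwise ws) ⟩
    ∑ (mons N d) (λ κ → 𝟙 (Avoid? ws κ) + ∑ ws (λ w → 𝟙 (w ∣ᵐ? κ) * 1))
      ≡⟨ ∑-+ (mons N d) _ _ ⟩
    #Avoid ws d + ∑ (mons N d) (λ κ → ∑ ws (λ w → 𝟙 (w ∣ᵐ? κ) * 1))
      ≡⟨ cong (#Avoid ws d +_) (trans (∑-swap (mons N d) ws _) (multiples ws lens)) ⟩
    #Avoid ws d + length ws * H N ⟨ d - s ⟩ ∎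
    where
    open ≤-Reasoning
    pointwise : ∀ ws κ → 1 ≤ 𝟙 (Avoid? ws κ) + ∑ ws (λ w → 𝟙 (w ∣ᵐ? κ) * 1)
    pointwise []       κ = ≤-refl
    pointwise (w ∷ ws) κ with w ∣ᵐ? κ | Avoid? ws κ | pointwise ws κ
    ... | yes _ | yes _ | _ = s≤s z≤n
    ... | yes _ | no  _ | _ = s≤s z≤n
    ... | no  _ | yes _ | h = h
    ... | no  _ | no  _ | h = h
    multiples : ∀ ws → All (λ w → length w ≡ s) ws →
      ∑ ws (λ w → ∑ (mons N d) (λ κ → 𝟙 (w ∣ᵐ? κ) * 1)) ≡ length ws * H N ⟨ d - s ⟩
    multiples []       []          = refl
    multiples (w ∷ ws) (refl ∷ ls) = cong₂ _+_
      (trans (∑-multiples w d (λ _ → 1)) (⟨-⟩-cong (∑-mons-1 N) d (length w))) (multiples ws ls)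

  module _ {N : ℕ} where

    extend : List (List (Fin N)) → List (Vec ℕ N) → List (Vec ℕ N)
    extend []      xs = []
    extend (w ∷ C) xs = map (incs w) xs ++ extend C xs

    length-extend : ∀ C xs → length (extend C xs) ≡ length C * length xs
    length-extend []      xs = refl
    length-extend (w ∷ C) xs = trans (List.length-++ (map (incs w) xs)) (cong₂ _+_ (List.length-map (incs w) xs) (length-extend C xs))

    ∈-extend⁻ : ∀ C xs {κ} → κ ∈ extend C xs → ∃ λ w → ∃ λ x → w ∈ C × x ∈ xs × κ ≡ incs w x
    ∈-extend⁻ (w ∷ C) xs κ∈ with ∈-++⁻ (map (incs w) xs) κ∈
    ... | inj₁ κ∈₁ = let (x , x∈ , eq) = ∈-map⁻ (incs w) κ∈₁ in w , x , here refl , x∈ , eq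
    ... | inj₂ κ∈₂ = let (w′ , x , w′∈ , x∈ , eq) = ∈-extend⁻ C xs κ∈₂ in w′ , x , there w′∈ , x∈ , eq

    -- If w x = w′ x′ with coprime w and w′, then w divides x′, which the last hypothesis excludes.
    extend-unique : ∀ C xs → AllPairs Disjoint C → Unique xs → (∀ {x w} → x ∈ xs → w ∈ C → ¬ w ∣ᵐ x) → Unique (extend C xs)
    extend-unique []      xs _        u av = []
    extend-unique (w ∷ C) xs (d ∷ ds) u av = Unique.++⁺ (Unique.map⁺ (incs-injective w) u)
      (extend-unique C xs ds u λ x∈ w∈ → av x∈ (there w∈))
      λ { (κ∈₁ , κ∈₂) → clash (∈-map⁻ (incs w) κ∈₁) (∈-extend⁻ C xs κ∈₂) }
      where
      clash : ∀ {κ} → (∃ λ x → x ∈ xs × κ ≡ incs w x) → ¬ (∃ λ w′ → ∃ λ x′ → w′ ∈ C × x′ ∈ xs × κ ≡ incs w′ x′)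
      clash (x , _ , eq) (w′ , x′ , w′∈ , x′∈ , eq′) =
        av x′∈ (here refl) (∣ᵐ-incs⁻ w w′ (All.lookup d w′∈) (x , trans (sym eq′) eq))

    choices : ℕ → List (List (List (Fin N))) → List (Vec ℕ N) → List (Vec ℕ N)
    choices L []       base = base
    choices L (C ∷ Bs) base = extend (take L C) (choices L Bs base)

    ∈-take : ∀ {a} {A : Set a} {x : A} L xs → x ∈ take L xs → x ∈ xs
    ∈-take (suc L) (x ∷ xs) (here eq) = here eq
    ∈-take (suc L) (x ∷ xs) (there i) = there (∈-take L xs i)

    length-choices : ∀ L Bs base → All (λ C → L ≤ length C) Bs → length (choices L Bs base) ≡ L ^ length Bs * length base
    length-choices L []       base []       = sym (*-identityˡ (length base))
    length-choices L (C ∷ Bs) base (L≤ ∷ h) = trans (length-extend (take L C) (choices L Bs base))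
      (trans (cong₂ _*_ (trans (List.length-take L C) (m≤n⇒m⊓n≡m L≤)) (length-choices L Bs base h)) (sym (*-assoc L (L ^ length Bs) (length base))))

    choices-avoid : ∀ L Bs base w → (∀ {C w′} → C ∈ Bs → w′ ∈ C → Disjoint w w′) →
      (∀ {x} → x ∈ base → ¬ w ∣ᵐ x) → ∀ {x} → x ∈ choices L Bs base → ¬ w ∣ᵐ x
    choices-avoid L []       base w d av x∈ = av x∈
    choices-avoid L (C ∷ Bs) base w d av x∈ w∣x with ∈-extend⁻ (take L C) (choices L Bs base) x∈
    ... | w′ , x′ , w′∈ , x′∈ , refl = choices-avoid L Bs base w (d ∘ there) av x′∈
            (∣ᵐ-incs⁻ w w′ (d (here refl) (∈-take L C w′∈)) w∣x)

    choices-unique : ∀ L Bs base → Independent Bs → Unique base →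
      (∀ {x C w} → x ∈ base → C ∈ Bs → w ∈ take L C → ¬ w ∣ᵐ x) → Unique (choices L Bs base)
    choices-unique L []       base []             u av = u
    choices-unique L (C ∷ Bs) base ((ds , d) ∷ i) u av = extend-unique (take L C) (choices L Bs base)
      (AllPairs.take⁺ L ds)
      (choices-unique L Bs base i u λ x∈ C∈ → av x∈ (there C∈))
      λ {x} {w} x∈ w∈ → choices-avoid L Bs base w (λ C′∈ w′∈ → d (∈-take L C w∈) C′∈ w′∈)
        (λ x∈ → av x∈ (here refl) w∈) x∈

    choices-good : ∀ L Bs Rs τ base → (∀ {x} → x ∈ base → Good τ Rs x) → ∀ {x} → x ∈ choices L Bs base → Good τ (Bs ++ Rs) x
    choices-good L []       Rs τ base g x∈ = g x∈
    choices-good L (C ∷ Bs) Rs τ base g x∈ with ∈-extend⁻ (take L C) (choices L Bs base) x∈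
    ... | w , x′ , w∈ , x′∈ , refl with choices-good L Bs Rs τ base g x′∈
    ...   | u , β , sel , refl , eq = w ++ u , β , ∈-take L C w∈ ∷ sel , sym (incs-++ w u β) , eq

    Independent-++ˡ : ∀ Bs Rs → Independent {N} (Bs ++ Rs) → Independent Bs
    Independent-++ˡ []       Rs i              = []
    Independent-++ˡ (C ∷ Bs) Rs ((ds , d) ∷ i) = (ds , λ w∈ C′∈ w′∈ → d w∈ (∈-++⁺ˡ C′∈) w′∈) ∷ Independent-++ˡ Bs Rs i

    Independent-across : ∀ Bs Rs → Independent {N} (Bs ++ Rs) → ∀ {B C w w′} → B ∈ Bs → C ∈ Rs → w ∈ B → w′ ∈ C → Disjoint w w′
    Independent-across (C ∷ Bs) Rs ((ds , d) ∷ i) (here refl) C∈ w∈ w′∈ = d w∈ (∈-++⁺ʳ Bs C∈) w′∈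
    Independent-across (C ∷ Bs) Rs ((ds , d) ∷ i) (there B∈)  C∈ w∈ w′∈ = Independent-across Bs Rs i B∈ C∈ w∈ w′∈

    few-divisors : ∀ L s τ G Bs Rs f → Independent (Bs ++ Rs) → Selection Rs f →
      All (λ C → L ≤ length C) Bs → All (All (λ w → length w ≡ s)) Bs →
      2 * (length Bs * L) * H N ⟨ τ - s ⟩ ≤ H N τ → 2 * G ≤ L ^ length Bs →
      ∃ λ ks → Unique ks × (∀ κ → κ ∈ ks → Good τ (Bs ++ Rs) κ) × G * H N τ ≤ length ks
    few-divisors L s τ G Bs Rs f ind sel L≤ lens small 2G≤ =
      choices L Bs base ,
      choices-unique L Bs base (Independent-++ˡ Bs Rs ind) (Unique.map⁺ (incs-injective f) (Unique.filter⁺ (Avoid? W) (mons-unique N τ))) base-avoid ,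
      (λ κ → choices-good L Bs Rs τ base base-good {κ}) ,
      *-cancelˡ-≤ 2 (begin
        2 * (G * H N τ)                    ≡⟨ sym (*-assoc 2 G (H N τ)) ⟩
        2 * G * H N τ                      ≤⟨ *-mono-≤ 2G≤ H≤2a ⟩
        L ^ length Bs * (2 * a)            ≡⟨ solve 2 (λ p a → p :* (con 2 :* a) := con 2 :* (p :* a)) refl (L ^ length Bs) a ⟩
        2 * (L ^ length Bs * a)            ≡⟨ cong (2 *_) (trans (cong (L ^ length Bs *_) (sym length-base)) (sym (length-choices L Bs base L≤))) ⟩
        2 * length (choices L Bs base)     ∎)
      where
      open ≤-Reasoning
      W = concat (map (take L) Bs)
      base = map (incs f) (filter (Avoid? W) (mons N τ))
      a = #Avoid W τ
      length-base : length base ≡ a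
      length-base = trans (List.length-map (incs f) (filter (Avoid? W) (mons N τ))) (length-filter-∑ (Avoid? W) (mons N τ))
      base-good : ∀ {x} → x ∈ base → Good τ Rs x
      base-good x∈ with ∈-map⁻ (incs f) x∈
      ... | β , β∈ , refl = f , β , sel , refl , mons-sound N τ (proj₁ (∈-filter⁻ (Avoid? W) {xs = mons N τ} β∈))
      ∈W : ∀ {C w} Bs → C ∈ Bs → w ∈ take L C → w ∈ concat (map (take L) Bs)
      ∈W (C ∷ Bs) (here refl) w∈ = ∈-++⁺ˡ w∈
      ∈W (C ∷ Bs) (there C∈)  w∈ = ∈-++⁺ʳ (take L C) (∈W Bs C∈ w∈)
      base-avoid : ∀ {x C w} → x ∈ base → C ∈ Bs → w ∈ take L C → ¬ w ∣ᵐ x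
      base-avoid {C = C} {w} x∈ C∈ w∈ w∣x with ∈-map⁻ (incs f) x∈
      ... | β , β∈ , refl = All.lookup (proj₂ (∈-filter⁻ (Avoid? W) {xs = mons N τ} β∈)) (∈W Bs C∈ w∈)
        (∣ᵐ-incs⁻ w f (λ v∈w v∈f → let (C′ , w′ , C′∈ , w′∈ , v∈w′) = selection-∈ sel v∈f in
          Independent-across Bs Rs ind C∈ C′∈ (∈-take L C w∈) w′∈ v∈w v∈w′) w∣x)
      length-W : ∀ Bs → All (λ C → L ≤ length C) Bs → length (concat (map (take L) Bs)) ≡ length Bs * L
      length-W []       []       = refl
      length-W (C ∷ Bs) (L≤ ∷ h) = trans (List.length-++ (take L C)) (cong₂ _+_ (trans (List.length-take L C) (m≤n⇒m⊓n≡m L≤)) (length-W Bs h))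
      lens-W : ∀ Bs → All (All (λ w → length w ≡ s)) Bs → All (λ w → length w ≡ s) (concat (map (take L) Bs))
      lens-W []       []      = []
      lens-W (C ∷ Bs) (l ∷ h) = All.++⁺ (All.take⁺ L l) (lens-W Bs h)
      H≤2a : H N τ ≤ 2 * a
      H≤2a = +-cancelʳ-≤ (H N τ) (H N τ) (2 * a) (begin
        H N τ + H N τ                                       ≡⟨ solve 1 (λ h → h :+ h := con 2 :* h) refl (H N τ) ⟩
        2 * H N τ                                           ≤⟨ *-monoʳ-≤ 2 (#Avoid-union-bound W s τ (lens-W Bs lens)) ⟩
        2 * (a + length W * H N ⟨ τ - s ⟩)                  ≡⟨ cong (λ l → 2 * (a + l * H N ⟨ τ - s ⟩)) (length-W Bs L≤) ⟩
        2 * (a + length Bs * L * H N ⟨ τ - s ⟩)             ≡⟨ solve 3 (λ a b h → con 2 :* (a :+ b :* h) := con 2 :* a :+ con 2 :* b :* h) refl a (length Bs * L) (H N ⟨ τ - s ⟩) ⟩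
        2 * a + 2 * (length Bs * L) * H N ⟨ τ - s ⟩         ≤⟨ +-monoʳ-≤ (2 * a) small ⟩
        2 * a + H N τ                                       ∎)

    hits? : ∀ (Cs : List (List (List (Fin N)))) κ → Dec (All (Any (_∣ᵐ κ)) Cs)
    hits? Cs κ = All.all? (Any.any? (λ w → w ∣ᵐ? κ)) Cs

    -- Words of different families are coprime, so if each divides κ then so does their product.
    hits⇒selection : ∀ {Cs} {κ : Vec ℕ N} → Independent Cs → All (Any (_∣ᵐ κ)) Cs → ∃ λ u → Selection Cs u × u ∣ᵐ κ
    hits⇒selection {κ = κ} []       []       = [] , [] , κ , refl
    hits⇒selection ((ds , d) ∷ i) (h ∷ hs) with hits⇒selection i hs | find h
    ... | u , sel , u∣κ | w , w∈ , w∣κ = w ++ u , w∈ ∷ sel , ∣ᵐ-++⁺ w u disj w∣κ u∣κ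
      where
      disj : Disjoint w u
      disj v∈w v∈u = let (C′ , w′ , C′∈ , w′∈ , v∈w′) = selection-∈ sel v∈u in d w∈ C′∈ w′∈ v∈w v∈w′

    -- A union bound over the families: each is missed by at most z / length Cs monomials, so at
    -- most z miss some family.
    many-divisors : ∀ Cs τ k z → Independent Cs → (∀ {u} → Selection Cs u → length u ≡ k) → 0 < length Cs →
      All (λ C → length Cs * #Avoid C (τ + k) ≤ z) Cs →
      ∃ λ ks → Unique ks × (∀ κ → κ ∈ ks → Good τ Cs κ) × H N (τ + k) ≤ length ks + z
    many-divisors Cs τ k z ind len 0<e rare = filter (hits? Cs) (mons N D) , Unique.filter⁺ (hits? Cs) (mons-unique N D) , (λ κ → good {κ}) , (begin
      H N D
        ≡⟨ sym (∑-mons-1 N D) ⟩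
      ∑ (mons N D) (λ _ → 1)
        ≤⟨ ∑-mono-≤ (mons N D) (pointwise Cs) ⟩
      ∑ (mons N D) (λ κ → 𝟙 (hits? Cs κ) + ∑ Cs (λ C → 𝟙 (Avoid? C κ)))
        ≡⟨ ∑-+ (mons N D) _ _ ⟩
      ∑ (mons N D) (𝟙 ∘ hits? Cs) + ∑ (mons N D) (λ κ → ∑ Cs (λ C → 𝟙 (Avoid? C κ)))
        ≡⟨ cong₂ _+_ (sym (length-filter-∑ (hits? Cs) (mons N D))) (∑-swap (mons N D) Cs _) ⟩
      length (filter (hits? Cs) (mons N D)) + ∑ Cs (λ C → #Avoid C D)
        ≤⟨ +-monoʳ-≤ _ (*-cancelˡ-≤ (length Cs) {{>-nonZero 0<e}} (≤-trans (≤-reflexive (sym (∑-*ˡ Cs _ (length Cs)))) (sum≤ (length Cs) Cs rare))) ⟩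
      length (filter (hits? Cs) (mons N D)) + z ∎)
      where
      open ≤-Reasoning
      D = τ + k
      good : ∀ {κ} → κ ∈ filter (hits? Cs) (mons N D) → Good τ Cs κ
      good κ∈ with ∈-filter⁻ (hits? Cs) {xs = mons N D} κ∈
      ... | κ∈D , h with hits⇒selection ind h
      ...   | u , sel , β , refl = u , β , sel , refl , +-cancelˡ-≡ k _ _
              (trans (cong (_+ Vec.sum β) (sym (len sel))) (trans (sym (sum-incs u β)) (trans (mons-sound N D κ∈D) (+-comm τ k))))
      pointwise : ∀ Cs κ → 1 ≤ 𝟙 (hits? Cs κ) + ∑ Cs (λ C → 𝟙 (Avoid? C κ))
      pointwise []       κ = ≤-refl
      pointwise (C ∷ Cs) κ with hits? Cs κ | Any.any? (λ w → w ∣ᵐ? κ) C | Avoid? C κ | pointwise Cs κ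
      ... | _     | yes _ | yes _ | _ = m≤n⇒m≤o+n _ (s≤s z≤n)
      ... | yes _ | yes _ | no  _ | _ = s≤s z≤n
      ... | no  _ | yes _ | no  _ | h = h
      ... | _     | no  _ | yes _ | _ = s≤s z≤n
      ... | _     | no ¬h | no ¬a | _ = ⊥-elim (¬a (All.¬Any⇒All¬ C ¬h))
      sum≤ : ∀ e Cs → All (λ C → e * #Avoid C D ≤ z) Cs → ∑ Cs (λ C → e * #Avoid C D) ≤ length Cs * z
      sum≤ e []       []       = z≤n
      sum≤ e (C ∷ Cs) (h ∷ hs) = +-mono-≤ h (sum≤ e Cs hs)

  -- H τ against K · H (τ - s) decides whether divisibility by a word of length s is rare; K is such
  -- that the g · L words in use together divide at most half of the monomials in the rare case.
  good-monomials : ∀ P M s L τ k G (Bs Rs : List (List (List (Fin (suc P + M))))) →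
    (let Cs = Bs ++ Rs; K = 2 * (length Bs * L); n = M * suc (2 * s * K)) →
    Independent Cs → (∀ {u} → Selection Cs u → length u ≡ k) →
    All (λ C → length C ≡ n) Cs → All (All (λ w → length w ≤ s)) Cs → All (All (λ w → length w ≡ s)) Bs →
    0 < M → 0 < P → 0 < length Bs → 0 < L → L ≤ n → length Cs ≤ 2 ^ M →
    2 * s * (P + M) ≤ suc (2 * s) * suc P → 2 * G ≤ L ^ length Bs →
    ∃ λ ks → Unique ks × (∀ κ → κ ∈ ks → Good τ Cs κ) ×
      (G * H (suc P + M) τ ≤ length ks ⊎ H (suc P + M) (τ + k) ≤ length ks + H (suc P) (τ + k))
  good-monomials P M s L τ k G Bs Rs ind len lenC len≤ lenB 0<M 0<P 0<g 0<L L≤n e≤ sP≤ 2G≤ =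
    split (≤-<-connex (K * H V ⟨ τ - s ⟩) (H V τ))
    where
    Cs = Bs ++ Rs
    K = 2 * (length Bs * L)
    n = M * suc (2 * s * K)
    V = suc P + M
    0<K : 0 < K
    0<K = *-mono-≤ {1} {2} {1} (s≤s z≤n) (*-mono-≤ 0<g 0<L)
    0<n : 0 < n
    0<n = *-mono-≤ 0<M (s≤s z≤n)
    e>0 : 0 < length Cs
    e>0 = ≤-trans 0<g (≤-trans (m≤m+n (length Bs) (length Rs)) (≤-reflexive (sym (List.length-++ Bs))))
    rare : H V (τ + k) ≤ K * H V ⟨ τ + k - s ⟩ → ∀ Cs′ → Independent Cs′ → All (λ C → length C ≡ n) Cs′ → All (All (λ w → length w ≤ s)) Cs′ →
      All (λ C → length Cs * #Avoid C (τ + k) ≤ H (suc P) (τ + k)) Cs′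
    rare h []        []             []       []       = []
    rare h (C ∷ Cs′) ((ds , _) ∷ i) (l ∷ ls) (q ∷ qs) =
      many-avoided-is-rare P M s K (τ + k) (length Cs) C ds q l 0<M 0<K 0<P e≤ sP≤ h ∷ rare h Cs′ i ls qs
    split : K * H V ⟨ τ - s ⟩ ≤ H V τ ⊎ H V τ < K * H V ⟨ τ - s ⟩ → _
    split (inj₁ small) =
      let (f , sel) = selection-exists 0<n Rs (All.++⁻ʳ Bs lenC)
          (ks , u , g , le) = few-divisors L s τ G Bs Rs f ind sel (All.map (λ l → ≤-trans L≤n (≤-reflexive (sym l))) (All.++⁻ˡ Bs lenC)) lenB small 2G≤
      in ks , u , g , inj₁ le
    split (inj₂ large) =
      let (ks , u , g , le) = many-divisors Cs τ k (H (suc P) (τ + k)) ind len e>0 (rare large′ Cs ind lenC len≤)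
      in ks , u , g , inj₂ le
      where
      large′ : H V (τ + k) ≤ K * H V ⟨ τ + k - s ⟩
      large′ = *-cancelʳ-≤ _ _ (H V τ) {{>-nonZero (H>0 (P + M) τ)}} (begin
        H V (τ + k) * H V τ                    ≤⟨ *-monoʳ-≤ (H V (τ + k)) (<⇒≤ large) ⟩
        H V (τ + k) * (K * H V ⟨ τ - s ⟩)      ≡⟨ solve 3 (λ a b c → a :* (b :* c) := b :* (c :* a)) refl (H V (τ + k)) K (H V ⟨ τ - s ⟩) ⟩
        K * (H V ⟨ τ - s ⟩ * H V (τ + k))      ≤⟨ *-monoʳ-≤ K (H-ratio (P + M) τ k s) ⟩
        K * (H V ⟨ τ + k - s ⟩ * H V τ)        ≡⟨ sym (*-assoc K (H V ⟨ τ + k - s ⟩) (H V τ)) ⟩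
        K * H V ⟨ τ + k - s ⟩ * H V τ          ∎)
        where open ≤-Reasoning

open Monomials

word : ∀ {N} (α : Vec ℕ N) → ∃ λ w → α ≡ incs w (replicate N 0) × length w ≡ Vec.sum α
word []          = [] , refl , refl
word (a ∷ α) with word α
... | w , refl , eq = heads a
  where
  tails : ∀ w → 0 ∷ incs w (replicate _ 0) ≡ incs (map Fin.suc w) (0 ∷ replicate _ 0)
  tails []      = refl
  tails (v ∷ w) = cong (inc (Fin.suc v)) (tails w)
  heads : ∀ a → ∃ λ w′ → a ∷ incs w (replicate _ 0) ≡ incs w′ (0 ∷ replicate _ 0) × length w′ ≡ a ℕ.+ Vec.sum (incs w (replicate _ 0))
  heads zero    = map Fin.suc w , tails w , trans (List.length-map Fin.suc w) eq
    where import Data.List.Properties as List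
  heads (suc a) with heads a
  ... | w′ , eq₁ , eq₂ = Fin.zero ∷ w′ , cong (inc Fin.zero) eq₁ , cong suc eq₂

-- Coefficient series and the linear operators on them.

module Operators {c ℓ} (R : CommutativeRing c ℓ) where
  open CommutativeRing R hiding (zero)
    renaming (refl to ≈-refl; sym to ≈-sym; trans to ≈-trans)
  open Algebra.Definitions.RawMonoid +-rawMonoid using () renaming (_×_ to _×ᵣ_)
  open Algebra.Properties.CommutativeMonoid.Sum +-commutativeMonoid
    using (sum; sum-cong-≋; ∑-distrib-+; sum-replicate-zero)
  open Algebra.Properties.Semiring.Sum semiring using (*-distribˡ-sum; *-distribʳ-sum)
  open Algebra.Properties.Monoid.Mult +-monoid using (×-congʳ)
  open Algebra.Properties.CommutativeMonoid.Mult +-commutativeMonoid using (×-distrib-+)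
  open Algebra.Properties.Semiring.Mult semiring using (×-comm-*)
  open Algebra.Properties.CommutativeSemigroup *-commutativeSemigroup using () renaming (x∙yz≈y∙xz to x*yz≈y*xz)
  open Polynomials R using (S; coeff; homogeneous; convolve)

  private variable
    M N : ℕ

  -- Coefficient functions without the degrees of `S`, so that multiplication, differentiation and
  -- substitution become linear maps between spaces that carry no degree index.
  Series : ℕ → Set c
  Series N = Vec ℕ N → Carrier

  infix 4 _≋_
  infixl 6 _⊞_
  infixl 7 _⊡_

  _≋_ : Series N → Series N → Set ℓ
  f ≋ g = ∀ γ → f γ ≈ g γ

  _⊞_ : Series N → Series N → Series N
  (f ⊞ g) γ = f γ + g γ

  _⊡_ : Carrier → Series N → Series N
  (a ⊡ f) γ = a * f γ

  𝟎 : Series N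
  𝟎 γ = 0#

  sum-zero : ∀ {n} (f : Fin n → Carrier) → (∀ i → f i ≈ 0#) → sum f ≈ 0#
  sum-zero {n} f h = ≈-trans (sum-cong-≋ {n} h) (sum-replicate-zero n)

  sum-single : ∀ {n} (i : Fin n) (f : Fin n → Carrier) → (∀ j → i ≢ j → f j ≈ 0#) → sum f ≈ f i
  sum-single {suc n} Fin.zero    f h = ≈-trans (+-congˡ (sum-zero (f ∘ Fin.suc) λ j → h (Fin.suc j) λ ())) (+-identityʳ _)
  sum-single {suc n} (Fin.suc i) f h = ≈-trans
    (+-cong (h Fin.zero λ ()) (sum-single i (f ∘ Fin.suc) λ j i≢j → h (Fin.suc j) (i≢j ∘ Fin.suc-injective)))
    (+-identityˡ _)

  record Linear (Φ : Series M → Series N) : Set (c ⊔ ℓ) where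
    field
      ≋-cong : ∀ {f g} → f ≋ g → Φ f ≋ Φ g
      homo-⊞ : ∀ f g → Φ (f ⊞ g) ≋ Φ f ⊞ Φ g
      homo-⊡ : ∀ a f → Φ (a ⊡ f) ≋ a ⊡ Φ f

    homo-𝟎 : Φ 𝟎 ≋ 𝟎
    homo-𝟎 γ = ≈-trans (≋-cong (λ _ → ≈-sym (zeroˡ 0#)) γ) (≈-trans (homo-⊡ 0# 𝟎 γ) (zeroˡ _))

    homo-≋𝟎 : ∀ {f} → f ≋ 𝟎 → Φ f ≋ 𝟎
    homo-≋𝟎 f≋𝟎 γ = ≈-trans (≋-cong f≋𝟎 γ) (homo-𝟎 γ)

    homo-sum : ∀ {n} (a : Fin n → Carrier) (f : Fin n → Series M) →
               Φ (λ γ → sum λ i → a i * f i γ) ≋ λ γ → sum λ i → a i * Φ (f i) γ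
    homo-sum {zero}  a f γ = homo-𝟎 γ
    homo-sum {suc n} a f γ = ≈-trans (homo-⊞ (a Fin.zero ⊡ f Fin.zero) _ γ)
      (+-cong (homo-⊡ (a Fin.zero) (f Fin.zero) γ) (homo-sum (a ∘ Fin.suc) (f ∘ Fin.suc) γ))

  open Linear public

  combination-linear : ∀ {n} (a : Fin n → Carrier) (Φ : Fin n → Series M → Series N) → (∀ i → Linear (Φ i)) →
                       Linear (λ f γ → sum λ i → a i * Φ i f γ)
  combination-linear {n = n} a Φ lin = record
    { ≋-cong = λ f≋g γ → sum-cong-≋ {n} λ i → *-congˡ (≋-cong (lin i) f≋g γ)
    ; homo-⊞ = λ f g γ → ≈-trans (sum-cong-≋ {n} λ i → ≈-trans (*-congˡ (homo-⊞ (lin i) f g γ)) (distribˡ (a i) _ _)) (∑-distrib-+ {n} _ _)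
    ; homo-⊡ = λ b f γ → ≈-trans (sum-cong-≋ {n} λ i → ≈-trans (*-congˡ (homo-⊡ (lin i) b f γ)) (x*yz≈y*xz (a i) b _)) (≈-sym (*-distribˡ-sum {n} b _))
    }

  -- Multiplication by the variable v.
  shift : Fin N → Series N → Series N
  shift Fin.zero    f (zero ∷ α)  = 0#
  shift Fin.zero    f (suc a ∷ α) = f (a ∷ α)
  shift (Fin.suc v) f (a ∷ α)     = shift v (f ∘ (a ∷_)) α

  shift-inc : ∀ (v : Fin N) f β → shift v f (inc v β) ≡ f β
  shift-inc Fin.zero    f (b ∷ β) = refl
  shift-inc (Fin.suc v) f (b ∷ β) = shift-inc v (f ∘ (b ∷_)) β

  shift-∤ : ∀ (v : Fin N) f γ → lookup γ v ≡ 0 → shift v f γ ≡ 0#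
  shift-∤ Fin.zero    f (zero ∷ γ) ≡0 = refl
  shift-∤ (Fin.suc v) f (a ∷ γ)    ≡0 = shift-∤ v (f ∘ (a ∷_)) γ ≡0

  shift-linear : ∀ (v : Fin N) → Linear (shift v)
  shift-linear v = record { ≋-cong = cong′ v ; homo-⊞ = homo-⊞′ v ; homo-⊡ = homo-⊡′ v }
    where
    cong′ : ∀ (v : Fin N) {f g} → f ≋ g → shift v f ≋ shift v g
    cong′ Fin.zero    h (zero ∷ γ)  = ≈-refl
    cong′ Fin.zero    h (suc a ∷ γ) = h (a ∷ γ)
    cong′ (Fin.suc v) h (a ∷ γ)     = cong′ v (h ∘ (a ∷_)) γ
    homo-⊞′ : ∀ (v : Fin N) f g → shift v (f ⊞ g) ≋ shift v f ⊞ shift v g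
    homo-⊞′ Fin.zero    f g (zero ∷ γ)  = ≈-sym (+-identityˡ 0#)
    homo-⊞′ Fin.zero    f g (suc a ∷ γ) = ≈-refl
    homo-⊞′ (Fin.suc v) f g (a ∷ γ)     = homo-⊞′ v _ _ γ
    homo-⊡′ : ∀ (v : Fin N) a f → shift v (a ⊡ f) ≋ a ⊡ shift v f
    homo-⊡′ Fin.zero    b f (zero ∷ γ)  = ≈-sym (zeroʳ b)
    homo-⊡′ Fin.zero    b f (suc a ∷ γ) = ≈-refl
    homo-⊡′ (Fin.suc v) b f (a ∷ γ)     = homo-⊡′ v b _ γ

  shifts : List (Fin N) → Series N → Series N
  shifts w f = foldr shift f w

  shifts-linear : ∀ (w : List (Fin N)) → Linear (shifts w)
  shifts-linear [] = record { ≋-cong = λ h → h ; homo-⊞ = λ _ _ _ → ≈-refl ; homo-⊡ = λ _ _ _ → ≈-refl }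
  shifts-linear (v ∷ w) = record
    { ≋-cong = λ h → ≋-cong (shift-linear v) (≋-cong (shifts-linear w) h)
    ; homo-⊞ = λ f g γ → ≈-trans (≋-cong (shift-linear v) (homo-⊞ (shifts-linear w) f g) γ) (homo-⊞ (shift-linear v) _ _ γ)
    ; homo-⊡ = λ a f γ → ≈-trans (≋-cong (shift-linear v) (homo-⊡ (shifts-linear w) a f) γ) (homo-⊡ (shift-linear v) a _ γ)
    }

  shifts-incs : ∀ (w : List (Fin N)) f β → shifts w f (incs w β) ≡ f β
  shifts-incs []      f β = refl
  shifts-incs (v ∷ w) f β = trans (shift-inc v (shifts w f) (incs w β)) (shifts-incs w f β)

  shifts-∤ : ∀ (w : List (Fin N)) f γ → ¬ w ∣ᵐ γ → shifts w f γ ≈ 0#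
  shifts-∤ []      f γ w∤γ = contradiction (γ , refl) w∤γ
  shifts-∤ (v ∷ w) f γ w∤γ with uninc v γ
  ... | inj₁ ≡0         = reflexive (shift-∤ v (shifts w f) γ ≡0)
  ... | inj₂ (γ′ , refl) = ≈-trans (reflexive (shift-inc v (shifts w f) γ′)) (shifts-∤ w f γ′ λ { (β , refl) → w∤γ (β , refl) })

  slice : Series (suc N) → Series (suc N) → (a : ℕ) → Vec ℕ N → Fin (suc a) → Carrier
  slice p q a γ i = convolve (p ∘ (toℕ i ∷_)) (q ∘ ((a ∸ toℕ i) ∷_)) γ

  convolve-cong : ∀ {p p′ q q′ : Series N} → p ≋ p′ → q ≋ q′ → convolve p q ≋ convolve p′ q′
  convolve-cong h h′ []      = *-cong (h []) (h′ [])
  convolve-cong h h′ (a ∷ γ) = sum-cong-≋ {suc a} λ i → convolve-cong (h ∘ (toℕ i ∷_)) (h′ ∘ ((a ∸ toℕ i) ∷_)) γ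

  convolve-linear : ∀ (q : Series N) → Linear (λ p → convolve p q)
  convolve-linear q = record
    { ≋-cong = λ h → convolve-cong h (λ _ → ≈-refl)
    ; homo-⊞ = λ p p′ → add p p′ q
    ; homo-⊡ = λ a p → scale a p q
    }
    where
    add : ∀ {N} (p p′ q : Series N) → convolve (p ⊞ p′) q ≋ convolve p q ⊞ convolve p′ q
    add p p′ q []      = distribʳ (q []) (p []) (p′ [])
    add p p′ q (a ∷ γ) = ≈-trans (sum-cong-≋ {suc a} λ i → add (p ∘ (toℕ i ∷_)) (p′ ∘ (toℕ i ∷_)) (q ∘ ((a ∸ toℕ i) ∷_)) γ) (∑-distrib-+ {suc a} (slice p q a γ) (slice p′ q a γ))
    scale : ∀ {N} b (p q : Series N) → convolve (b ⊡ p) q ≋ b ⊡ convolve p q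
    scale b p q []      = *-assoc b (p []) (q [])
    scale b p q (a ∷ γ) = ≈-trans (sum-cong-≋ {suc a} λ i → scale b (p ∘ (toℕ i ∷_)) (q ∘ ((a ∸ toℕ i) ∷_)) γ) (≈-sym (*-distribˡ-sum {suc a} b (slice p q a γ)))

  -- The rule (x_v p) q = x_v (p q). For later variables it holds in each slice, and linearity moves
  -- the shift across the sum of the slices.
  convolve-shift : ∀ (v : Fin N) p q → convolve (shift v p) q ≋ shift v (convolve p q)
  convolve-shift Fin.zero p q (zero ∷ γ) = ≈-trans (+-identityʳ _) (homo-𝟎 (convolve-linear (q ∘ (0 ∷_))) γ)
  convolve-shift Fin.zero p q (suc a ∷ γ) = ≈-trans (+-congʳ (homo-𝟎 (convolve-linear (q ∘ (suc a ∷_))) γ)) (+-identityˡ _)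
  convolve-shift (Fin.suc v) p q (a ∷ γ) = ≈-trans
    (sum-cong-≋ {suc a} λ i → ≈-trans (convolve-shift v (p ∘ (toℕ i ∷_)) (q ∘ ((a ∸ toℕ i) ∷_)) γ) (≈-sym (*-identityˡ _)))
    (≈-trans (≈-sym (homo-sum (shift-linear v) {suc a} (λ _ → 1#) (λ i β → slice p q a β i) γ))
      (≋-cong (shift-linear v) (λ β → sum-cong-≋ {suc a} λ i → *-identityˡ (slice p q a β i)) γ))

  convolve-shifts : ∀ (w : List (Fin N)) p q → convolve (shifts w p) q ≋ shifts w (convolve p q)
  convolve-shifts []      p q γ = ≈-refl
  convolve-shifts (v ∷ w) p q γ = ≈-trans (convolve-shift v (shifts w p) q γ) (≋-cong (shift-linear v) (convolve-shifts w p q) γ)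

  -- The constant polynomial 1, by the recursion of `convolve` instead of a test of exponents for
  -- equality.
  𝟏 : Series N
  𝟏 []          = 1#
  𝟏 (zero ∷ α)  = 𝟏 α
  𝟏 (suc a ∷ α) = 0#

  𝟏-0 : ∀ N → 𝟏 (replicate N 0) ≡ 1#
  𝟏-0 zero    = refl
  𝟏-0 (suc N) = 𝟏-0 N

  𝟏-≢0 : ∀ (γ : Vec ℕ N) → γ ≢ replicate N 0 → 𝟏 γ ≡ 0#
  𝟏-≢0 []          γ≢0 = contradiction refl γ≢0
  𝟏-≢0 (zero ∷ γ)  γ≢0 = 𝟏-≢0 γ (γ≢0 ∘ cong (0 ∷_))
  𝟏-≢0 (suc a ∷ γ) γ≢0 = refl

  convolve-𝟏 : ∀ (q : Series N) → convolve 𝟏 q ≋ q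
  convolve-𝟏 q []      = *-identityˡ (q [])
  convolve-𝟏 q (a ∷ γ) = ≈-trans (+-cong (convolve-𝟏 (q ∘ (a ∷_)) γ)
    (sum-zero {a} _ λ i → homo-𝟎 (convolve-linear (q ∘ ((a ∸ suc (toℕ i)) ∷_))) γ)) (+-identityʳ _)

  mono : Vec ℕ N → Series N
  mono α β = if ⌊ Vec.≡-dec ℕ._≟_ α β ⌋ then 1# else 0#

  mono-≡ : ∀ (α : Vec ℕ N) → mono α α ≡ 1#
  mono-≡ α with Vec.≡-dec ℕ._≟_ α α
  ... | yes _  = refl
  ... | no α≢α = contradiction refl α≢α

  mono-≢ : ∀ {α β : Vec ℕ N} → α ≢ β → mono α β ≡ 0#
  mono-≢ {α = α} {β} α≢β with Vec.≡-dec ℕ._≟_ α β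
  ... | yes α≡β = contradiction α≡β α≢β
  ... | no _    = refl

  mono-shifts : ∀ (w : List (Fin N)) → mono (incs w (replicate N 0)) ≋ shifts w 𝟏
  mono-shifts {N} w γ with w ∣ᵐ? γ
  ... | no w∤γ = ≈-trans (reflexive (mono-≢ λ { refl → w∤γ (replicate N 0 , refl) })) (≈-sym (shifts-∤ w 𝟏 γ w∤γ))
  ... | yes (β , refl) with Vec.≡-dec ℕ._≟_ β (replicate N 0)
  ...   | yes refl = reflexive (trans (mono-≡ (incs w β)) (sym (trans (shifts-incs w 𝟏 β) (𝟏-0 N))))
  ...   | no β≢0   = reflexive (trans (mono-≢ (β≢0 ∘ sym ∘ incs-injective w)) (sym (trans (shifts-incs w 𝟏 β) (𝟏-≢0 β β≢0))))

  convolve-mono : ∀ (w : List (Fin N)) q → convolve (mono (incs w (replicate N 0))) q ≋ shifts w q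
  convolve-mono w q γ = ≈-trans (convolve-cong (mono-shifts w) (λ _ → ≈-refl) γ)
    (≈-trans (convolve-shifts w 𝟏 q γ) (≋-cong (shifts-linear w) (convolve-𝟏 q) γ))

  pd : Fin N → Series N → Series N
  pd v f γ = suc (lookup γ v) ×ᵣ f (inc v γ)

  pd-linear : ∀ (v : Fin N) → Linear (pd v)
  pd-linear v = record
    { ≋-cong = λ h γ → ×-congʳ (suc (lookup γ v)) (h (inc v γ))
    ; homo-⊞ = λ f g γ → ×-distrib-+ (f (inc v γ)) (g (inc v γ)) (suc (lookup γ v))
    ; homo-⊡ = λ a f γ → ≈-sym (×-comm-* (suc (lookup γ v)) a (f (inc v γ)))
    }

  pd-shift-≡ : ∀ (v : Fin N) f → pd v (shift v f) ≋ f ⊞ shift v (pd v f)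
  pd-shift-≡ Fin.zero    f (zero ∷ γ)  = ≈-refl
  pd-shift-≡ Fin.zero    f (suc a ∷ γ) = ≈-refl
  pd-shift-≡ (Fin.suc v) f (a ∷ γ)     = pd-shift-≡ v (f ∘ (a ∷_)) γ

  ×-zero : ∀ n → n ×ᵣ 0# ≈ 0#
  ×-zero zero    = ≈-refl
  ×-zero (suc n) = ≈-trans (+-identityˡ _) (×-zero n)

  ×-shift : ∀ n (v : Fin N) f γ → n ×ᵣ shift v f γ ≈ shift v (λ α → n ×ᵣ f α) γ
  ×-shift n v f γ with uninc v γ
  ... | inj₁ ≡0 = ≈-trans (×-congʳ n (reflexive (shift-∤ v f γ ≡0)))
          (≈-trans (×-zero n) (reflexive (sym (shift-∤ v _ γ ≡0))))
  ... | inj₂ (β , refl) = ≈-trans (×-congʳ n (reflexive (shift-inc v f β))) (reflexive (sym (shift-inc v (λ α → n ×ᵣ f α) β)))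

  pd-shift-≢ : ∀ {u v : Fin N} → u ≢ v → ∀ f → pd u (shift v f) ≋ shift v (pd u f)
  pd-shift-≢ {u = Fin.zero}  {Fin.zero}  u≢v f γ           = contradiction refl u≢v
  pd-shift-≢ {u = Fin.zero}  {Fin.suc v} u≢v f (a ∷ γ)     = ×-shift (suc a) v (f ∘ (suc a ∷_)) γ
  pd-shift-≢ {u = Fin.suc u} {Fin.zero}  u≢v f (zero ∷ γ)  = ×-zero (suc (lookup γ u))
  pd-shift-≢ {u = Fin.suc u} {Fin.zero}  u≢v f (suc a ∷ γ) = ≈-refl
  pd-shift-≢ {u = Fin.suc u} {Fin.suc v} u≢v f (a ∷ γ)     = pd-shift-≢ (u≢v ∘ cong Fin.suc) (f ∘ (a ∷_)) γ

  kronecker : Fin N → Fin N → Carrier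
  kronecker u v = if ⌊ u Fin.≟ v ⌋ then 1# else 0#

  kronecker-≡ : ∀ (v : Fin N) → kronecker v v ≈ 1#
  kronecker-≡ v with v Fin.≟ v
  ... | yes _  = ≈-refl
  ... | no v≢v = contradiction refl v≢v

  kronecker-≢ : ∀ {u v : Fin N} → u ≢ v → kronecker u v ≈ 0#
  kronecker-≢ {u = u} {v} u≢v with u Fin.≟ v
  ... | yes u≡v = contradiction u≡v u≢v
  ... | no  _   = ≈-refl

  -- Leibniz's rule for x_v f, with u = v and u ≠ v merged by a Kronecker symbol so that it can be
  -- summed over either index.
  pd-shift-scaled : ∀ (u v : Fin N) a f γ → a * pd u (shift v f) γ ≈ a * kronecker u v * f γ + a * shift v (pd u f) γ
  pd-shift-scaled u v a f γ with u Fin.≟ v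
  ... | yes refl = ≈-trans (*-congˡ (pd-shift-≡ u f γ)) (≈-trans (distribˡ a _ _) (+-congʳ (*-congʳ (≈-sym (*-identityʳ a)))))
  ... | no  u≢v  = ≈-trans (*-congˡ (pd-shift-≢ u≢v f γ)) (≈-sym (≈-trans (+-congʳ (≈-trans (*-congʳ (zeroʳ a)) (zeroˡ _))) (+-identityˡ _)))

  _at_ : S 1 N → Fin N → Carrier
  λ₁ at v = coeff λ₁ (inc v (replicate _ 0))

  multiply : (Fin N → Carrier) → Series N → Series N
  multiply a f γ = sum λ v → a v * shift v f γ

  multiply-linear : ∀ (a : Fin N → Carrier) → Linear (multiply a)
  multiply-linear a = combination-linear a shift shift-linear

  linear-form : ∀ (l : S 1 N) → coeff l ≋ multiply (l at_) 𝟏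
  linear-form {N} l γ with Vec.sum γ ℕ.≟ 1
  ... | no ≢1 = ≈-trans (homogeneous l γ ≢1) (≈-sym (sum-zero {N} _ λ v → ≈-trans (*-congˡ (vanish v)) (zeroʳ _)))
    where
    vanish : ∀ v → shift v 𝟏 γ ≈ 0#
    vanish v with uninc v γ
    ... | inj₁ ≡0 = reflexive (shift-∤ v 𝟏 γ ≡0)
    ... | inj₂ (β , refl) = reflexive (trans (shift-inc v 𝟏 β) (𝟏-≢0 β λ { refl → ≢1 (trans (sum-inc v β) (cong suc (sum-0 N))) }))
      where
      sum-0 : ∀ N → Vec.sum (replicate N 0) ≡ 0
      sum-0 zero    = refl
      sum-0 (suc N) = sum-0 N
  ... | yes ≡1 with word γ
  ...   | []        , refl , len = contradiction (trans len ≡1) λ ()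
  ...   | u ∷ v ∷ w , refl , len = contradiction (trans len ≡1) λ ()
  ...   | u ∷ []    , refl , len = ≈-sym (≈-trans (sum-single u _ λ v u≢v → ≈-trans (*-congˡ (reflexive
            (shift-∤ v 𝟏 (inc u (replicate N 0)) (trans (lookup-inc-≢ (replicate N 0) (u≢v ∘ sym)) (Vec.lookup-replicate v 0))))) (zeroʳ _))
          (≈-trans (*-congˡ (reflexive (trans (shift-inc u 𝟏 (replicate N 0)) (𝟏-0 N)))) (*-identityʳ _)))

  linear-form-· : ∀ (l : S 1 N) (f : Series N) → convolve (coeff l) f ≋ multiply (l at_) f
  linear-form-· {N} l f γ = ≈-trans (≋-cong (convolve-linear f) (linear-form l) γ)
    (≈-trans (homo-sum (convolve-linear f) (l at_) (λ v → shift v 𝟏) γ)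
      (sum-cong-≋ {N} λ v → *-congˡ (≈-trans (convolve-shift v 𝟏 f γ) (≋-cong (shift-linear v) (convolve-𝟏 f) γ))))

  pd-multiply : ∀ (u : Fin N) a f → pd u (multiply a f) ≋ a u ⊡ f ⊞ multiply a (pd u f)
  pd-multiply {N} u a f γ = ≈-trans (homo-sum (pd-linear u) a (λ v → shift v f) γ)
    (≈-trans (sum-cong-≋ {N} λ v → pd-shift-scaled u v (a v) f γ) (≈-trans (∑-distrib-+ {N} (λ v → a v * kronecker u v * f γ) _)
      (+-congʳ (≈-trans (≈-sym (*-distribʳ-sum {N} (f γ) λ v → a v * kronecker u v)) (*-congʳ
        (≈-trans (sum-single u _ λ v u≢v → ≈-trans (*-congˡ (kronecker-≢ u≢v)) (zeroʳ _)) (≈-trans (*-congˡ (kronecker-≡ u)) (*-identityʳ _))))))))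

  pd-along : (Fin N → Carrier) → Series N → Series N
  pd-along y f γ = sum λ v → y v * pd v f γ

  pd-along-linear : ∀ (y : Fin N → Carrier) → Linear (pd-along y)
  pd-along-linear y = combination-linear y pd pd-linear

  pd-along-shift : ∀ y (v : Fin N) f → pd-along y (shift v f) ≋ y v ⊡ f ⊞ shift v (pd-along y f)
  pd-along-shift {N} y v f γ = ≈-trans (sum-cong-≋ {N} λ u → pd-shift-scaled u v (y u) f γ)
    (≈-trans (∑-distrib-+ {N} (λ u → y u * kronecker u v * f γ) _)
      (+-cong (≈-trans (≈-sym (*-distribʳ-sum {N} (f γ) λ u → y u * kronecker u v)) (*-congʳ
          (≈-trans (sum-single v _ λ u v≢u → ≈-trans (*-congˡ (kronecker-≢ (v≢u ∘ sym))) (zeroʳ _)) (≈-trans (*-congˡ (kronecker-≡ v)) (*-identityʳ _)))))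
        (≈-sym (homo-sum (shift-linear v) y (λ u → pd u f) γ))))

length-product : ∀ {a b c} {A : Set a} {B : Set b} {C : Set c} (_⊗_ : A → B → C) xs ys →
                 length (cartesianProductWith _⊗_ xs ys) ≡ length xs ℕ.* length ys
length-product _⊗_ []       ys = refl
length-product _⊗_ (x ∷ xs) ys = trans (List.length-++ (map (x ⊗_) ys))
  (cong₂ ℕ._+_ (List.length-map (x ⊗_) ys) (length-product _⊗_ xs ys))

allWords : ∀ M e → List (Vec (Fin M) e)
allWords M zero    = [] ∷ []
allWords M (suc e) = cartesianProductWith _∷_ (allFin M) (allWords M e)

length-allWords : ∀ M e → length (allWords M e) ≡ M ℕ.^ e
length-allWords M zero    = refl
length-allWords M (suc e) = trans (length-product _∷_ (allFin M) (allWords M e))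
  (cong₂ ℕ._*_ (List.length-tabulate {n = M} id) (length-allWords M e))

-- Substitution of linear forms and the chain rule.

module Substitution {c ℓ} (R : CommutativeRing c ℓ) where
  open CommutativeRing R hiding (zero)
    renaming (refl to ≈-refl; sym to ≈-sym; trans to ≈-trans)
  open Algebra.Properties.CommutativeMonoid.Sum +-commutativeMonoid
    using (sum; sum-cong-≋; ∑-distrib-+)
  open Algebra.Properties.Monoid.Mult +-monoid using (×-congʳ; ×-homo-1)
  open Algebra.Properties.CommutativeSemigroup +-commutativeSemigroup using (interchange)
  open Polynomials R using (S; coeff; homogeneous; ∂; ∂*; restrict; quotient; substitute)
  open Operators R

  private variable
    M N : ℕ

  quot : Series (suc N) → Series (suc N)
  quot f γ = f (inc Fin.zero γ)

  subs : (Fin M → Fin N → Carrier) → ℕ → Series M → Series N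
  subs {M}     l zero    f = f (replicate M 0) ⊡ 𝟏
  subs {zero}  l (suc d) f = 𝟎
  subs {suc M} l (suc d) f = subs (l ∘ Fin.suc) (suc d) (f ∘ (0 ∷_)) ⊞ multiply (l Fin.zero) (subs l d (quot f))

  subs-linear : ∀ (l : Fin M → Fin N → Carrier) d → Linear (subs l d)
  subs-linear {M} l zero = record
    { ≋-cong = λ h γ → *-congʳ (h (replicate M 0))
    ; homo-⊞ = λ f g γ → distribʳ (𝟏 γ) (f (replicate M 0)) (g (replicate M 0))
    ; homo-⊡ = λ a f γ → *-assoc a (f (replicate M 0)) (𝟏 γ)
    }
  subs-linear {zero} l (suc d) = record
    { ≋-cong = λ _ _ → ≈-refl
    ; homo-⊞ = λ _ _ _ → ≈-sym (+-identityˡ 0#)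
    ; homo-⊡ = λ a _ _ → ≈-sym (zeroʳ a)
    }
  subs-linear {suc M} l (suc d) = record
    { ≋-cong = λ h γ → +-cong (≋-cong A (h ∘ (0 ∷_)) γ) (≋-cong L (≋-cong B (h ∘ inc Fin.zero)) γ)
    ; homo-⊞ = λ f g γ → ≈-trans (+-cong (homo-⊞ A (f ∘ (0 ∷_)) (g ∘ (0 ∷_)) γ)
        (≈-trans (≋-cong L (homo-⊞ B (quot f) (quot g)) γ) (homo-⊞ L (subs l d (quot f)) (subs l d (quot g)) γ)))
        (interchange _ _ _ _)
    ; homo-⊡ = λ a f γ → ≈-trans (+-cong (homo-⊡ A a (f ∘ (0 ∷_)) γ)
        (≈-trans (≋-cong L (homo-⊡ B a (quot f)) γ) (homo-⊡ L a (subs l d (quot f)) γ)))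
        (≈-sym (distribˡ a _ _))
    }
    where
    A = subs-linear (l ∘ Fin.suc) (suc d)
    B = subs-linear l d
    L = multiply-linear (l Fin.zero)

  coeff-substitute : ∀ (ℓs : Fin M → S 1 N) {d} (p : S d M) → coeff (substitute ℓs p) ≋ subs (λ u → ℓs u at_) d (coeff p)
  coeff-substitute {M}     ℓs {zero}  p γ = *-congˡ (mono-shifts [] γ)
  coeff-substitute {zero}  ℓs {suc d} p γ = ≈-refl
  coeff-substitute {suc M} {N} ℓs {suc d} p γ = +-cong (coeff-substitute (ℓs ∘ Fin.suc) (restrict p) γ)
    (≈-trans (linear-form-· (ℓs Fin.zero) (coeff (substitute ℓs (quotient p))) γ)
      (≋-cong (multiply-linear (ℓs Fin.zero at_)) (λ β → ≈-trans (coeff-substitute ℓs (quotient p) β)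
        (≋-cong (subs-linear _ d) (λ { (a ∷ α) → ≈-refl }) β)) γ))

  pd-𝟏 : ∀ (v : Fin N) → pd v 𝟏 ≋ 𝟎
  pd-𝟏 {N} v γ = ≈-trans (×-congʳ (suc (lookup γ v)) (reflexive (𝟏-≢0 (inc v γ) λ eq → inc≢0 v {γ}
    (trans (cong (λ α → lookup α v) eq) (Vec.lookup-replicate v 0))))) (×-zero (suc (lookup γ v)))

  pd-constant : ∀ (v : Fin N) a → pd v (a ⊡ 𝟏) ≋ 𝟎
  pd-constant v a γ = ≈-trans (homo-⊡ (pd-linear v) a 𝟏 γ) (≈-trans (*-congˡ (pd-𝟏 v γ)) (zeroʳ a))

  -- Write f = f₀ + x₀ q with f₀ free of x₀. Differentiating ℓ₀ q(ℓ) gives a multiple of q(ℓ) and ℓ₀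
  -- times a derivative of q(ℓ). The former completes the summand u = 0, because ∂₀ f = q + x₀ ∂₀ q;
  -- the latter is the induction hypothesis for q.
  chain-rule : ∀ (l : Fin M → Fin N → Carrier) d f i →
               pd i (subs l (suc d) f) ≋ λ γ → sum λ u → l u i * subs l d (pd u f) γ
  chain-rule {zero}  l d f i γ = homo-𝟎 (pd-linear i) γ
  chain-rule {suc M} l d f i γ = ≈-trans (homo-⊞ (pd-linear i) A (multiply (l Fin.zero) B) γ)
    (≈-trans (+-cong (chain-rule (l ∘ Fin.suc) d (f ∘ (0 ∷_)) i γ) (pd-multiply i (l Fin.zero) B γ)) (by d))
    where
    A = subs (l ∘ Fin.suc) (suc d) (f ∘ (0 ∷_))
    B = subs l d (quot f)
    l₀ = l Fin.zero
    by : ∀ d → sum (λ u → l (Fin.suc u) i * subs (l ∘ Fin.suc) d (pd u (f ∘ (0 ∷_))) γ)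
               + (l₀ i * subs l d (quot f) γ + multiply l₀ (pd i (subs l d (quot f))) γ)
             ≈ l₀ i * subs l d (pd Fin.zero f) γ + sum (λ u → l (Fin.suc u) i * subs l d (pd (Fin.suc u) f) γ)
    by zero = ≈-trans (+-comm _ _) (+-congʳ (≈-trans
      (+-cong (*-congˡ (*-congʳ (≈-sym (×-homo-1 (f (1 ∷ replicate M 0))))))
              (homo-≋𝟎 (multiply-linear l₀) (pd-constant i (f (1 ∷ replicate M 0))) γ))
      (+-identityʳ _)))
    by (suc d) = ≈-trans (+-congˡ (+-congˡ ladder)) (≈-trans
      (solve (sum (λ u → l (Fin.suc u) i * X u)) (l₀ i * C) (l₀ i * Y₀) (sum λ u → l (Fin.suc u) i * Y u))
      (+-cong (≈-trans (≈-sym (distribˡ (l₀ i) C Y₀)) (*-congˡ (≈-sym zero-case)))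
              (≈-trans (≈-sym (∑-distrib-+ {M} _ _)) (sum-cong-≋ {M} λ u → ≈-sym (distribˡ (l (Fin.suc u) i) (X u) (Y u))))))
      where
      X : Fin M → Carrier
      X u = subs (l ∘ Fin.suc) (suc d) (pd u (f ∘ (0 ∷_))) γ
      Y : Fin M → Carrier
      Y u = multiply l₀ (subs l d (quot (pd (Fin.suc u) f))) γ
      C Y₀ : Carrier
      C = subs l (suc d) (quot f) γ
      Y₀ = multiply l₀ (subs l d (pd Fin.zero (quot f))) γ
      solve : ∀ a b c e → a + (b + (c + e)) ≈ (b + c) + (a + e)
      solve a b c e = ≈-trans (+-congˡ (≈-sym (+-assoc b c e))) (≈-trans (≈-sym (+-assoc a (b + c) e))
        (≈-trans (+-congʳ (+-comm a (b + c))) (+-assoc (b + c) a e)))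
      ladder : multiply l₀ (pd i (subs l (suc d) (quot f))) γ ≈ l₀ i * Y₀ + sum (λ u → l (Fin.suc u) i * Y u)
      ladder = ≈-trans (≋-cong (multiply-linear l₀) (chain-rule l d (quot f) i) γ)
        (≈-trans (homo-sum (multiply-linear l₀) (λ u → l u i) (λ u → subs l d (pd u (quot f))) γ)
          (+-congˡ (sum-cong-≋ {M} λ u → *-congˡ (≋-cong (multiply-linear l₀) (≋-cong (subs-linear l d) λ { (a ∷ α) → ≈-refl }) γ))))
      zero-case : subs l (suc d) (pd Fin.zero f) γ ≈ C + Y₀
      zero-case = ≈-trans (+-cong
          (≋-cong (subs-linear (l ∘ Fin.suc) (suc d)) (λ α → ×-homo-1 (f (1 ∷ α))) γ)
          (≈-trans (≋-cong (multiply-linear l₀) (λ β → ≈-trans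
             (≋-cong (subs-linear l d) {g = quot (quot f) ⊞ pd Fin.zero (quot f)} (λ { (a ∷ α) → ≈-refl }) β)
             (homo-⊞ (subs-linear l d) (quot (quot f)) (pd Fin.zero (quot f)) β)) γ)
           (homo-⊞ (multiply-linear l₀) _ _ γ)))
        (≈-sym (+-assoc _ _ _))

  pds : ∀ {e} → Vec (Fin N) e → Series N → Series N
  pds []      f = f
  pds (i ∷ w) f = pds w (pd i f)

  pds-linear : ∀ {e} (w : Vec (Fin N) e) → Linear (pds w)
  pds-linear []      = record { ≋-cong = λ h → h ; homo-⊞ = λ _ _ _ → ≈-refl ; homo-⊡ = λ _ _ _ → ≈-refl }
  pds-linear (i ∷ w) = record
    { ≋-cong = λ h → ≋-cong (pds-linear w) (≋-cong (pd-linear i) h)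
    ; homo-⊞ = λ f g γ → ≈-trans (≋-cong (pds-linear w) (homo-⊞ (pd-linear i) f g) γ) (homo-⊞ (pds-linear w) _ _ γ)
    ; homo-⊡ = λ a f γ → ≈-trans (≋-cong (pds-linear w) (homo-⊡ (pd-linear i) a f) γ) (homo-⊡ (pds-linear w) a _ γ)
    }

  coeff-∂* : ∀ {e} (w : Vec (Fin N) e) {d} (f : S d N) → coeff (∂* w f) ≋ pds w (coeff f)
  coeff-∂* []      f γ = ≈-refl
  coeff-∂* (i ∷ w) {suc d} f γ = coeff-∂* w (∂ i f) γ
  coeff-∂* (i ∷ w) {zero}  f γ = ≈-sym (homo-≋𝟎 (pds-linear w) (λ β → ≈-trans
    (×-congʳ (suc (lookup β i)) (homogeneous f (inc i β) λ eq → contradiction (trans (sym (sum-inc i β)) eq) λ ()))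
    (×-zero (suc (lookup β i)))) γ)

  sumL : ∀ {x} {X : Set x} → List X → (X → Carrier) → Carrier
  sumL []       f = 0#
  sumL (x ∷ xs) f = f x + sumL xs f

  module _ {x} {X : Set x} where

    sumL-cong : ∀ (xs : List X) {f g} → (∀ x → f x ≈ g x) → sumL xs f ≈ sumL xs g
    sumL-cong []       h = ≈-refl
    sumL-cong (x ∷ xs) h = +-cong (h x) (sumL-cong xs h)

    sumL-zero : ∀ (xs : List X) {f} → (∀ x → x ∈ xs → f x ≈ 0#) → sumL xs f ≈ 0#
    sumL-zero []       h = ≈-refl
    sumL-zero (x ∷ xs) h = ≈-trans (+-cong (h x (here refl)) (sumL-zero xs λ y → h y ∘ there)) (+-identityˡ 0#)

    sumL-+ : ∀ (xs : List X) f g → sumL xs (λ x → f x + g x) ≈ sumL xs f + sumL xs g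
    sumL-+ []       f g = ≈-sym (+-identityˡ 0#)
    sumL-+ (x ∷ xs) f g = ≈-trans (+-congˡ (sumL-+ xs f g)) (interchange _ _ _ _)

    sumL-*ˡ : ∀ (xs : List X) a f → sumL xs (λ x → a * f x) ≈ a * sumL xs f
    sumL-*ˡ []       a f = ≈-sym (zeroʳ a)
    sumL-*ˡ (x ∷ xs) a f = ≈-trans (+-congˡ (sumL-*ˡ xs a f)) (≈-sym (distribˡ a _ _))

    sumL-++ : ∀ (xs ys : List X) f → sumL (xs List.++ ys) f ≈ sumL xs f + sumL ys f
    sumL-++ []       ys f = ≈-sym (+-identityˡ _)
    sumL-++ (x ∷ xs) ys f = ≈-trans (+-congˡ (sumL-++ xs ys f)) (≈-sym (+-assoc _ _ _))

    sumL-map : ∀ {y} {Y : Set y} (g : Y → X) ys f → sumL (map g ys) f ≈ sumL ys (f ∘ g)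
    sumL-map g []       f = ≈-refl
    sumL-map g (y ∷ ys) f = +-congˡ (sumL-map g ys f)

    sum-sumL : ∀ {n} (xs : List X) (f : Fin n → X → Carrier) → sum (λ i → sumL xs (f i)) ≈ sumL xs (λ x → sum λ i → f i x)
    sum-sumL {n} []       f = sum-zero {n} _ λ _ → ≈-refl
    sum-sumL {n} (x ∷ xs) f = ≈-trans (∑-distrib-+ {n} (λ i → f i x) _) (+-congˡ (sum-sumL xs f))

    sumL-tabulate : ∀ {n} (g : Fin n → X) f → sumL (List.tabulate g) f ≈ sum (f ∘ g)
    sumL-tabulate {zero}  g f = ≈-refl
    sumL-tabulate {suc n} g f = +-congˡ (sumL-tabulate (g ∘ Fin.suc) f)

    linear-sumL : ∀ {Φ : Series M → Series N} → Linear Φ → ∀ (xs : List X) (a : X → Carrier) (F : X → Series M) →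
                  Φ (λ γ → sumL xs λ x → a x * F x γ) ≋ λ γ → sumL xs λ x → a x * Φ (F x) γ
    linear-sumL lin []       a F γ = homo-𝟎 lin γ
    linear-sumL lin (x ∷ xs) a F γ = ≈-trans (homo-⊞ lin (a x ⊡ F x) _ γ) (+-cong (homo-⊡ lin (a x) (F x) γ) (linear-sumL lin xs a F γ))

  sumL-product : ∀ {x y z} {X : Set x} {Y : Set y} {Z : Set z} (_⊗_ : X → Y → Z) xs ys f →
    sumL (cartesianProductWith _⊗_ xs ys) f ≈ sumL xs λ x → sumL ys λ y → f (x ⊗ y)
  sumL-product _⊗_ []       ys f = ≈-refl
  sumL-product _⊗_ (x ∷ xs) ys f = ≈-trans (sumL-++ (map (x ⊗_) ys) (cartesianProductWith _⊗_ xs ys) f)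
    (+-cong (sumL-map (x ⊗_) ys f) (sumL-product _⊗_ xs ys f))

  -- Weights are indexed by X and not by positions in xs, the form in which `rank-bound-list` takes
  -- a matrix.
  record Spans {x} {X : Set x} (xs : List X) (F : X → Series N) (f : Series N) : Set (c ⊔ ℓ ⊔ x) where
    constructor spans
    field
      weights   : X → Carrier
      expansion : f ≋ λ γ → sumL xs λ x → weights x * F x γ

  module _ {x} {X : Set x} {xs : List X} {F : X → Series N} where

    Spans-≋ : ∀ {f g} → f ≋ g → Spans xs F f → Spans xs F g
    Spans-≋ f≋g (spans a e) = spans a λ γ → ≈-trans (≈-sym (f≋g γ)) (e γ)

    Spans-𝟎 : Spans xs F 𝟎
    Spans-𝟎 = spans (λ _ → 0#) λ γ → ≈-sym (sumL-zero xs λ x _ → zeroˡ _)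

    Spans-⊞ : ∀ {f g} → Spans xs F f → Spans xs F g → Spans xs F (f ⊞ g)
    Spans-⊞ (spans a e) (spans b e′) = spans (λ x → a x + b x) λ γ → ≈-trans (+-cong (e γ) (e′ γ))
      (≈-trans (≈-sym (sumL-+ xs _ _)) (sumL-cong xs λ x → ≈-sym (distribʳ _ _ _)))

    Spans-⊡ : ∀ {f} a → Spans xs F f → Spans xs F (a ⊡ f)
    Spans-⊡ a (spans b e) = spans (λ x → a * b x) λ γ → ≈-trans (*-congˡ (e γ))
      (≈-trans (≈-sym (sumL-*ˡ xs a _)) (sumL-cong xs λ x → ≈-sym (*-assoc _ _ _)))

    Spans-sumL : ∀ {y} {Y : Set y} (ys : List Y) (a : Y → Carrier) {G : Y → Series N} → (∀ y → Spans xs F (G y)) →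
                 Spans xs F (λ γ → sumL ys λ y → a y * G y γ)
    Spans-sumL []       a h = Spans-𝟎
    Spans-sumL (y ∷ ys) a h = Spans-⊞ (Spans-⊡ (a y) (h y)) (Spans-sumL ys a h)

  degree-expansion : ∀ d (p : Series N) → (∀ γ → Vec.sum γ ≢ d → p γ ≈ 0#) →
                     p ≋ λ γ → sumL (mons N d) λ β → p β * mono β γ
  degree-expansion {N} d p h γ with Vec.sum γ ℕ.≟ d
  ... | no ≢d = ≈-trans (h γ ≢d) (≈-sym (sumL-zero (mons N d) λ β β∈ →
          ≈-trans (*-congˡ (reflexive (mono-≢ λ { refl → ≢d (mons-sound N d β∈) }))) (zeroʳ _)))
  ... | yes ≡d = ≈-sym (single (mons N d) (mons-unique N d) (mons-complete γ d ≡d))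
    where
    single : ∀ xs → Unique xs → γ ∈ xs → sumL xs (λ β → p β * mono β γ) ≈ p γ
    single (x ∷ xs) (x∉ ∷ u) (here refl) = ≈-trans (+-cong (≈-trans (*-congˡ (reflexive (mono-≡ γ))) (*-identityʳ _))
      (sumL-zero xs λ β β∈ → ≈-trans (*-congˡ (reflexive (mono-≢ λ { refl → All.lookup x∉ β∈ refl }))) (zeroʳ _))) (+-identityʳ _)
    single (x ∷ xs) (x∉ ∷ u) (there γ∈) = ≈-trans (+-congʳ (≈-trans (*-congˡ (reflexive (mono-≢ λ { refl → All.lookup x∉ γ∈ refl }))) (zeroʳ _)))
      (≈-trans (+-identityˡ _) (single xs u γ∈))

  weight : ∀ {e} → (Fin M → Fin N → Carrier) → Vec (Fin M) e → Vec (Fin N) e → Carrier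
  weight l []       []      = 1#
  weight l (u ∷ us) (i ∷ w) = l u i * weight l us w

  -- The chain rule applied e times: whatever w is, only the M^e substituted derivatives of f occur.
  pds-subs : ∀ {e} (l : Fin M → Fin N → Carrier) (w : Vec (Fin N) e) k f →
    pds w (subs l (e ℕ.+ k) f) ≋ λ γ → sumL (allWords M e) λ us → weight l us w * subs l k (pds us f) γ
  pds-subs {M} l []      k f γ = ≈-sym (≈-trans (+-identityʳ _) (*-identityˡ _))
  pds-subs {M} {e = suc e} l (i ∷ w) k f γ = ≈-trans (≋-cong (pds-linear w) (chain-rule l (e ℕ.+ k) f i) γ)
    (≈-trans (homo-sum (pds-linear w) (λ u → l u i) (λ u → subs l (e ℕ.+ k) (pd u f)) γ)
    (≈-trans (sum-cong-≋ {M} λ u → ≈-trans (*-congˡ (pds-subs l w k (pd u f) γ))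
      (≈-trans (≈-sym (sumL-*ˡ (allWords M e) (l u i) _)) (sumL-cong (allWords M e) λ us → ≈-sym (*-assoc _ _ _))))
    (≈-trans (≈-sym (sumL-tabulate id (λ u → sumL (allWords M e) λ us → weight l (u ∷ us) (i ∷ w) * subs l k (pds (u ∷ us) f) γ)))
      (≈-sym (sumL-product _∷_ (allFin M) (allWords M e) _)))))

  pds-homogeneous : ∀ {d e} (w : Vec (Fin N) e) (f : S d N) γ → Vec.sum γ ≢ d ∸ e → pds w (coeff f) γ ≈ 0#
  pds-homogeneous w f γ h = ≈-trans (≈-sym (coeff-∂* w f γ)) (homogeneous (∂* w f) γ h)

unique-lookup-injective : ∀ {a} {A : Set a} {xs : List A} → Unique xs → ∀ i j → List.lookup xs i ≡ List.lookup xs j → i ≡ j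
unique-lookup-injective (x∉ ∷ u) Fin.zero    Fin.zero    eq = refl
unique-lookup-injective (x∉ ∷ u) Fin.zero    (Fin.suc j) eq = contradiction eq (All.lookup x∉ (∈-lookup j))
unique-lookup-injective (x∉ ∷ u) (Fin.suc i) Fin.zero    eq = contradiction (sym eq) (All.lookup x∉ (∈-lookup i))
unique-lookup-injective (x∉ ∷ u) (Fin.suc i) (Fin.suc j) eq = cong Fin.suc (unique-lookup-injective u i j eq)

∣ᵐ-∈ : ∀ {N} w {v : Fin N} β → v ∈ w → [ v ] ∣ᵐ incs w β
∣ᵐ-∈ (v ∷ w) β (here refl) = incs w β , refl
∣ᵐ-∈ (u ∷ w) {v} β (there v∈w) with ∣ᵐ-∈ w β v∈w
... | γ , eq = inc u γ , trans (cong (inc u) eq) (inc-comm u v γ)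

singletons-disjoint : ∀ {N} {vs : List (Fin N)} → Unique vs → AllPairs Disjoint (map [_] vs)
singletons-disjoint []       = []
singletons-disjoint (v∉ ∷ u) = All.map⁺ (All.map (λ v≢w → λ { (here refl) (here refl) → v≢w refl }) v∉) ∷ singletons-disjoint u

-- For words of length 1, `#Avoid-∷` is Pascal's rule.
#Avoid-singletons : ∀ {N} (vs : List (Fin N)) n d → AllPairs Disjoint (map [_] vs) → n ℕ.+ length vs ≡ N → #Avoid (map [_] vs) d ≡ H n d
#Avoid-singletons {N} []       n d _ eq = trans (∑-mons-1 N d) (cong (λ n → H n d) (trans (sym eq) (ℕ.+-identityʳ n)))
#Avoid-singletons (v ∷ vs) n d (dv ∷ dvs) eq = step d
  where
  rest : ∀ d → #Avoid (map [_] vs) d ≡ H (suc n) d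
  rest d = #Avoid-singletons vs (suc n) d dvs (trans (sym (ℕ.+-suc n (length vs))) eq)
  step : ∀ d → #Avoid (map [_] (v ∷ vs)) d ≡ H n d
  step zero    = trans (sym (ℕ.+-identityʳ _)) (trans (#Avoid-∷ [ v ] (map [_] vs) 0 dv) (rest 0))
  step (suc d) = ℕ.+-cancelʳ-≡ (H (suc n) d) _ _ (trans (cong (#Avoid (map [_] (v ∷ vs)) (suc d) ℕ.+_) (sym (rest d)))
    (trans (#Avoid-∷ [ v ] (map [_] vs) (suc d) dv) (rest (suc d))))

H-mono-vars : ∀ {n n′} d → n ℕ.≤′ n′ → H n d ℕ.≤ H n′ d
H-mono-vars d       ℕ.≤′-refl     = ℕ.≤-refl
H-mono-vars zero    (ℕ.≤′-step l) = H-mono-vars zero l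
H-mono-vars (suc d) (ℕ.≤′-step l) = ℕ.≤-trans (H-mono-vars (suc d) l) (ℕ.m≤m+n _ _)

-- Upper and lower bounds for dimensions of spaces of forms.

module Bounds {c ℓ} (R : CommutativeRing c ℓ)
    (domain : NoZeroDivisors R) (char0 : CharacteristicZero R) where
  open CommutativeRing R hiding (zero)
    renaming (refl to ≈-refl; sym to ≈-sym; trans to ≈-trans)
  open Algebra.Definitions.RawMonoid +-rawMonoid using () renaming (_×_ to _×ᵣ_)
  open Algebra.Properties.CommutativeMonoid.Sum +-commutativeMonoid
    using (sum; sum-cong-≋; ∑-distrib-+; ∑-comm)
  open Algebra.Properties.Semiring.Sum semiring using (*-distribˡ-sum; *-distribʳ-sum)
  open Algebra.Properties.Monoid.Mult +-monoid using (×-congʳ)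
  open Algebra.Properties.Semiring.Mult semiring using (×-assoc-*)
  open Algebra.Properties.Ring ring using (-‿distribʳ-*)
  open Algebra.Properties.CommutativeSemigroup *-commutativeSemigroup using () renaming (x∙yz≈y∙xz to x*yz≈y*xz)
  open Polynomials R using (S; coeff; homogeneous; convolve; _·_; ∂*; substitute; Operator; _⟨_⟩; S-module; _≈ₛ_; ShiftedPartials; DimShiftedPartials)
  open Operators R
  open Substitution R

  open Rank R domain char0 using (1≉0; rank-bound-list)

  ×-domain : ∀ n {x} → suc n ×ᵣ x ≈ 0# → x ≈ 0#
  ×-domain n {x} h = domain (char0 n) (≈-trans (×-assoc-* (suc n) 1# x) (≈-trans (×-congʳ (suc n) (*-identityˡ x)) h))

  module _ {d N : ℕ} where
    open LinearAlgebra R (S-module d N) public using (combination; HasDimension)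

    coeff-combination : ∀ {k} (a : Fin k → Carrier) (v : Fin k → S d N) γ →
                        coeff (combination a v) γ ≈ sum λ i → a i * coeff (v i) γ
    coeff-combination {zero}  a v γ = ≈-refl
    coeff-combination {suc k} a v γ = +-congˡ (coeff-combination (a ∘ Fin.suc) (v ∘ Fin.suc) γ)

    -- The number of values that determine an element of W bounds its dimension. Here φ depends on
    -- the proof of f ∈ W, since the weights of an expansion are not functions of f; accordingly the
    -- last hypothesis speaks of linear combinations of values.
    dimension-≤-functionals : ∀ {p} {W : Pred (S d N) p} {a x} {X : Set x} (xs : List X) (φ : ∀ {f} → W f → X → Carrier) →
      HasDimension W a →
      (∀ {n} (v : Fin n → S d N) (v∈W : ∀ i → W (v i)) (t : Fin n → Carrier) →
        (∀ j → j ∈ xs → sum (λ i → t i * φ (v∈W i) j) ≈ 0#) → ∀ γ → sum (λ i → t i * coeff (v i) γ) ≈ 0#) →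
      a ℕ.≤ length xs
    dimension-≤-functionals {a = a} xs φ (v , v∈W , independent , _) determine = rank-bound-list a xs (λ i → φ (v∈W i)) λ t h →
      independent t λ γ → ≈-trans (coeff-combination t v γ) (determine v v∈W t h γ)

    dimension-≤-span : ∀ {p} {W : Pred (S d N) p} {a x} {X : Set x} (xs : List X) (F : X → Series N) →
      HasDimension W a → (∀ f → W f → Spans xs F (coeff f)) → a ℕ.≤ length xs
    dimension-≤-span {W = W} {X = X} xs F dim span = dimension-≤-functionals xs (λ {f} f∈W → Spans.weights (span f f∈W)) dim determine
      where
      determine : ∀ {n} (v : Fin n → S d N) (v∈W : ∀ i → W (v i)) (t : Fin n → Carrier) →
        (∀ j → j ∈ xs → sum (λ i → t i * Spans.weights (span (v i) (v∈W i)) j) ≈ 0#) → ∀ γ → sum (λ i → t i * coeff (v i) γ) ≈ 0#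
      determine {n} v v∈W t h γ = ≈-trans (sum-cong-≋ {n} λ i → ≈-trans (*-congˡ (Spans.expansion (span (v i) (v∈W i)) γ)) (≈-sym (sumL-*ˡ xs (t i) _)))
        (≈-trans (sum-sumL xs λ i x → t i * (w i x * F x γ))
          (sumL-zero xs λ x x∈ → ≈-trans (sum-cong-≋ {n} λ i → ≈-sym (*-assoc (t i) (w i x) (F x γ)))
            (≈-trans (≈-sym (*-distribʳ-sum {n} (F x γ) λ i → t i * w i x)) (≈-trans (*-congʳ (h x x∈)) (zeroˡ _)))))
        where
        w : Fin n → X → Carrier
        w i = Spans.weights (span (v i) (v∈W i))

    -- κ has strictly least energy in f; other monomials may share an energy. A positive integer as
    -- coefficient is nonzero in characteristic 0.
    Leading : (Vec ℕ N → ℕ) → Vec ℕ N → S d N → Set ℓ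
    Leading E κ f = (∃ λ n → coeff f κ ≈ suc n ×ᵣ 1#) × (∀ γ → coeff f γ ≈ 0# ⊎ (γ ≡ κ ⊎ E κ ℕ.< E γ))

    -- Forms with distinct leading monomials are independent, so their coordinates in a basis of W
    -- form a matrix with trivial kernel, and the rank bound applies.
    dimension-≥-leading : ∀ {p} {W : Pred (S d N) p} {b} (E : Vec ℕ N → ℕ) (ks : List (Vec ℕ N)) → Unique ks →
      HasDimension W b → (∀ κ → κ ∈ ks → ∃ λ f → W f × Leading E κ f) → length ks ℕ.≤ b
    dimension-≥-leading {b = b} E ks unique (v , _ , _ , spanning) lead =
      subst (length ks ℕ.≤_) (List.length-tabulate {n = b} id)
        (rank-bound-list (length ks) (allFin b) A λ t h i → triangular t (vanish t h) (suc (E (κ i))) i ℕ.≤-refl)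
      where
      κ : Fin (length ks) → Vec ℕ N
      κ = List.lookup ks
      f : Fin (length ks) → S d N
      f i = proj₁ (lead (κ i) (∈-lookup i))
      leading : ∀ i → Leading E (κ i) (f i)
      leading i = proj₂ (proj₂ (lead (κ i) (∈-lookup i)))
      expand : ∀ i → ∃ λ a → f i ≈ₛ combination a v
      expand i = spanning (f i) (proj₁ (proj₂ (lead (κ i) (∈-lookup i))))
      A : Fin (length ks) → Fin b → Carrier
      A i = proj₁ (expand i)
      vanish : ∀ t → (∀ j → j ∈ allFin b → sum (λ i → t i * A i j) ≈ 0#) → ∀ γ → sum (λ i → t i * coeff (f i) γ) ≈ 0#
      vanish t h γ = ≈-trans
        (sum-cong-≋ {length ks} λ i → ≈-trans (*-congˡ (≈-trans (proj₂ (expand i) γ) (coeff-combination (A i) v γ)))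
          (*-distribˡ-sum {b} (t i) (λ j → A i j * coeff (v j) γ)))
        (≈-trans (∑-comm {length ks} {b} λ i j → t i * (A i j * coeff (v j) γ))
          (sum-zero {b} _ λ j → ≈-trans (sum-cong-≋ {length ks} λ i → ≈-sym (*-assoc (t i) (A i j) _))
            (≈-trans (≈-sym (*-distribʳ-sum {length ks} (coeff (v j) γ) λ i → t i * A i j))
              (≈-trans (*-congʳ (h j (∈-allFin j))) (zeroˡ _)))))
      -- Induction on energy: at κ i another form f j contributes only if κ j has smaller energy,
      -- and then t j is already 0.
      triangular : ∀ t → (∀ γ → sum (λ i → t i * coeff (f i) γ) ≈ 0#) → ∀ n i → E (κ i) ℕ.< n → t i ≈ 0#
      triangular t h (suc n) i (ℕ.s≤s Ei≤n) = domain (char0 (proj₁ (proj₁ (leading i))))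
        (≈-trans (*-congʳ (≈-sym (proj₂ (proj₁ (leading i))))) (≈-trans (*-comm _ (t i))
          (≈-trans (≈-sym (sum-single i (λ j → t j * coeff (f j) (κ i)) λ j i≢j → off j i≢j (proj₂ (leading j) (κ i)))) (h (κ i)))))
        where
        off : ∀ j → i ≢ j → coeff (f j) (κ i) ≈ 0# ⊎ (κ i ≡ κ j ⊎ E (κ j) ℕ.< E (κ i)) → t j * coeff (f j) (κ i) ≈ 0#
        off j i≢j (inj₁ ≈0)         = ≈-trans (*-congˡ ≈0) (zeroʳ _)
        off j i≢j (inj₂ (inj₁ eq))  = contradiction (unique-lookup-injective unique i j eq) i≢j
        off j i≢j (inj₂ (inj₂ lt))  = ≈-trans (*-congʳ (triangular t h n j (ℕ.<-≤-trans lt Ei≤n))) (zeroˡ _)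

  module Substituted {M N d e τ : ℕ} (ℓs : Fin M → S 1 N) (p : S d M) (e≤d : e ℕ.≤ d) where

    l : Fin M → Fin N → Carrier
    l u = ℓs u at_

    k : ℕ
    k = d ∸ e

    partial : Vec (Fin M) e → Series N
    partial us = subs l k (pds us (coeff p))

    ∂*-spans : ∀ (w : Vec (Fin N) e) → Spans (allWords M e) partial (coeff (∂* w (substitute ℓs p)))
    ∂*-spans w = spans (λ us → weight l us w) λ γ → ≈-trans (coeff-∂* w (substitute ℓs p) γ)
      (≈-trans (≋-cong (pds-linear w) (λ β → ≈-trans (coeff-substitute ℓs p β) (reflexive (cong (λ d → subs l d (coeff p) β) (sym (ℕ.m+[n∸m]≡n e≤d))))) γ)
        (pds-subs l w k (coeff p) γ))

    operator-spans : ∀ (D : Operator e N) → Spans (allWords M e) partial (coeff (D ⟨ substitute ℓs p ⟩))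
    operator-spans []            = Spans-𝟎
    operator-spans ((a , w) ∷ D) = Spans-⊞ (Spans-⊡ a (∂*-spans w)) (operator-spans D)

    convolve-spans : ∀ {x} {X : Set x} {xs : List X} {F : X → Series N} {f} (q : S τ N) → Spans xs F f →
      Spans (cartesianProduct (mons N τ) xs) (λ (β , x) → shifts (proj₁ (word β)) (F x)) (convolve (coeff q) f)
    convolve-spans {xs = xs} {F} {f} q (spans a expansion) = spans (λ (β , x) → coeff q β * a x) λ γ →
      ≈-trans (≋-cong (convolve-linear f) (degree-expansion τ (coeff q) (homogeneous q)) γ)
      (≈-trans (linear-sumL (convolve-linear f) (mons N τ) (coeff q) mono γ)
      (≈-trans (sumL-cong (mons N τ) λ β → ≈-trans (*-congˡ (by-word β γ))
        (≈-trans (*-congˡ (≈-trans (≋-cong (shifts-linear (proj₁ (word β))) expansion γ) (linear-sumL (shifts-linear (proj₁ (word β))) xs a F γ)))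
        (≈-trans (≈-sym (sumL-*ˡ xs (coeff q β) _)) (sumL-cong xs λ x → ≈-sym (*-assoc _ _ _)))))
      (≈-sym (sumL-product _,_ (mons N τ) xs λ (β , x) → coeff q β * a x * shifts (proj₁ (word β)) (F x) γ))))
      where
      by-word : ∀ β → convolve (mono β) f ≋ shifts (proj₁ (word β)) f
      by-word β with word β
      ... | w , refl , _ = convolve-mono w f

    W : Pred (S (τ ℕ.+ k) N) (c ⊔ ℓ)
    W = ShiftedPartials e τ (substitute ℓs p)

    span-spans : ∀ {x} {X : Set x} {xs : List X} {F : X → Series N} →
      (∀ (D : Operator e N) (q : S τ N) → Spans xs F (convolve (coeff q) (coeff (D ⟨ substitute ℓs p ⟩)))) →
      ∀ f → W f → Spans xs F (coeff f)
    span-spans {xs = xs} {F} h f (n , a , v , gen , eq) =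
      Spans-≋ {xs = xs} {F} {λ γ → sum λ i → a i * coeff (v i) γ} {coeff f}
        (λ γ → ≈-sym (≈-trans (eq γ) (coeff-combination a v γ))) (sums n a v gen)
      where
      generator : ∀ (g : S (τ ℕ.+ k) N) D (q : S τ N) → g ≈ₛ q · D ⟨ substitute ℓs p ⟩ → Spans xs F (coeff g)
      generator g D q eq = Spans-≋ {xs = xs} {F} {convolve (coeff q) (coeff (D ⟨ substitute ℓs p ⟩))} {coeff g}
        (λ γ → ≈-sym (eq γ)) (h D q)
      sums : ∀ n (a : Fin n → Carrier) (v : Fin n → S (τ ℕ.+ k) N) → (∀ (i : Fin n) → Σ (Operator e N) λ D → Σ (S τ N) λ q → v i ≈ₛ q · D ⟨ substitute ℓs p ⟩) →
             Spans xs F (λ γ → sum λ i → a i * coeff (v i) γ)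
      sums zero    a v gen = Spans-𝟎
      sums (suc n) a v gen = Spans-⊞ {f = a Fin.zero ⊡ coeff (v Fin.zero)} {λ γ → sum λ i → a (Fin.suc i) * coeff (v (Fin.suc i)) γ}
        (Spans-⊡ {f = coeff (v Fin.zero)} (a Fin.zero)
          (generator (v Fin.zero) (proj₁ (gen Fin.zero)) (proj₁ (proj₂ (gen Fin.zero))) (proj₂ (proj₂ (gen Fin.zero)))))
        (sums n (a ∘ Fin.suc) (v ∘ Fin.suc) (gen ∘ Fin.suc))

    dimension-≤-operators : ∀ {a} → DimShiftedPartials e τ (substitute ℓs p) a → a ℕ.≤ M ℕ.^ e ℕ.* H N τ
    dimension-≤-operators {a} dim = subst (a ℕ.≤_)
      (trans (length-product _,_ (mons N τ) (allWords M e)) (trans (cong₂ ℕ._*_ (length-mons N τ) (length-allWords M e)) (ℕ.*-comm (H N τ) _)))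
      (dimension-≤-span {W = W} (cartesianProduct (mons N τ) (allWords M e)) (λ (β , us) → shifts (proj₁ (word β)) (partial us)) dim
        (span-spans λ D q → convolve-spans q (operator-spans D)))

    dimension-≤-monomials : ∀ {a} → DimShiftedPartials e τ (substitute ℓs p) a → a ℕ.≤ H M k ℕ.* H N τ
    dimension-≤-monomials {a} dim = subst (a ℕ.≤_)
      (trans (length-product _,_ (mons N τ) (mons M k)) (trans (cong₂ ℕ._*_ (length-mons N τ) (length-mons M k)) (ℕ.*-comm (H N τ) _)))
      (dimension-≤-span {W = W} (cartesianProduct (mons N τ) (mons M k)) (λ (β , α) → shifts (proj₁ (word β)) (subs l k (mono α))) dim
        (span-spans λ D q → convolve-spans q (monomials D)))
      where
      monomials : ∀ D → Spans (mons M k) (λ α → subs l k (mono α)) (coeff (D ⟨ substitute ℓs p ⟩))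
      monomials D = Spans-≋ (λ γ → ≈-sym (Spans.expansion (operator-spans D) γ))
        (Spans-sumL (allWords M e) (Spans.weights (operator-spans D)) λ us → spans (pds us (coeff p)) λ γ →
          ≈-trans (≋-cong (subs-linear l k) (degree-expansion k (pds us (coeff p)) (pds-homogeneous us p)) γ)
            (linear-sumL (subs-linear l k) (mons M k) (pds us (coeff p)) mono γ))

    Kernel : (Fin N → Carrier) → Set ℓ
    Kernel y = ∀ u → sum (λ v → y v * l u v) ≈ 0#

    -- A form of degree j in the ideal of the ℓs vanishes on their common zero space, hence so do its
    -- derivatives along that space; Flat j f records that the j-fold ones, which are constants, are 0.
    Flat : ℕ → Series N → Set (c ⊔ ℓ)
    Flat zero    f = Lift c (f ≋ 𝟎)
    Flat (suc j) f = ∀ y → Kernel y → Flat j (pd-along y f)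

    Flat-≋ : ∀ j {f g} → f ≋ g → Flat j f → Flat j g
    Flat-≋ zero    f≋g (lift h) = lift λ γ → ≈-trans (≈-sym (f≋g γ)) (h γ)
    Flat-≋ (suc j) {f} {g} f≋g h y ker  = Flat-≋ j {pd-along y f} {pd-along y g} (≋-cong (pd-along-linear y) f≋g) (h y ker)

    Flat-⊞ : ∀ j {f g} → Flat j f → Flat j g → Flat j (f ⊞ g)
    Flat-⊞ zero    (lift h) (lift h′) = lift λ γ → ≈-trans (+-cong (h γ) (h′ γ)) (+-identityˡ 0#)
    Flat-⊞ (suc j) {f} {g} h h′ y ker = Flat-≋ j {pd-along y f ⊞ pd-along y g} {pd-along y (f ⊞ g)}
      (λ γ → ≈-sym (homo-⊞ (pd-along-linear y) f g γ)) (Flat-⊞ j {pd-along y f} {pd-along y g} (h y ker) (h′ y ker))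

    Flat-⊡ : ∀ j a {f} → Flat j f → Flat j (a ⊡ f)
    Flat-⊡ zero    a (lift h) = lift λ γ → ≈-trans (*-congˡ (h γ)) (zeroʳ a)
    Flat-⊡ (suc j) a {f} h y ker = Flat-≋ j {a ⊡ pd-along y f} {pd-along y (a ⊡ f)}
      (λ γ → ≈-sym (homo-⊡ (pd-along-linear y) a f γ)) (Flat-⊡ j a {pd-along y f} (h y ker))

    Flat-𝟎 : ∀ j → Flat j 𝟎
    Flat-𝟎 zero    = lift λ γ → ≈-refl
    Flat-𝟎 (suc j) y ker = Flat-≋ j {𝟎} {pd-along y 𝟎} (λ γ → ≈-sym (homo-𝟎 (pd-along-linear y) γ)) (Flat-𝟎 j)

    Flat-sumL : ∀ j {x} {X : Set x} (xs : List X) (a : X → Carrier) (F : X → Series N) → (∀ x → x ∈ xs → Flat j (F x)) →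
                Flat j (λ γ → sumL xs λ x → a x * F x γ)
    Flat-sumL j []       a F h = Flat-𝟎 j
    Flat-sumL j (x ∷ xs) a F h = Flat-⊞ j {a x ⊡ F x} {λ γ → sumL xs λ x → a x * F x γ} (Flat-⊡ j (a x) {F x} (h x (here refl))) (Flat-sumL j xs a F λ y → h y ∘ there)

    Flat-sum : ∀ j {n} (a : Fin n → Carrier) (F : Fin n → Series N) → (∀ i → Flat j (F i)) → Flat j (λ γ → sum λ i → a i * F i γ)
    Flat-sum j {zero}  a F h = Flat-𝟎 j
    Flat-sum j {suc n} a F h = Flat-⊞ j {a Fin.zero ⊡ F Fin.zero} {λ γ → sum λ i → a (Fin.suc i) * F (Fin.suc i) γ} (Flat-⊡ j (a Fin.zero) {F Fin.zero} (h Fin.zero)) (Flat-sum j (a ∘ Fin.suc) (F ∘ Fin.suc) (h ∘ Fin.suc))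

    Flat-suc : ∀ j {f} → Flat j f → Flat (suc j) f
    Flat-suc zero        (lift h) y ker = lift (homo-≋𝟎 (pd-along-linear y) h)
    Flat-suc (suc j) {f} h        y ker = Flat-suc j {pd-along y f} (h y ker)

    Flat-+ : ∀ j i {f} → Flat j f → Flat (i ℕ.+ j) f
    Flat-+ j zero    h = h
    Flat-+ j (suc i) {f} h = Flat-suc (i ℕ.+ j) {f} (Flat-+ j i {f} h)

    -- By Leibniz's rule a factor x_v, which raises the degree by one, costs one more derivative.
    Flat-shift : ∀ j v {f} → Flat j f → Flat (suc j) (shift v f)
    Flat-shift zero    v {f} (lift h) = Flat-suc 0 {shift v f} (lift (homo-≋𝟎 (shift-linear v) h))
    Flat-shift (suc j) v {f} h y ker = Flat-≋ (suc j) {y v ⊡ f ⊞ shift v (pd-along y f)} {pd-along y (shift v f)}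
      (λ γ → ≈-sym (pd-along-shift y v f γ))
      (Flat-⊞ (suc j) {y v ⊡ f} {shift v (pd-along y f)} (Flat-⊡ (suc j) (y v) {f} h) (Flat-shift j v {pd-along y f} (h y ker)))

    Flat-shifts : ∀ j w {f} → Flat j f → Flat (length w ℕ.+ j) (shifts w f)
    Flat-shifts j []      h = h
    Flat-shifts j (v ∷ w) {f} h = Flat-shift (length w ℕ.+ j) v {shifts w f} (Flat-shifts j w {f} h)

    -- By the chain rule the derivative along y is a combination of the values of the ℓs at y, which
    -- are 0.
    Flat-subs : ∀ k g → Flat 1 (subs l k g)
    Flat-subs zero    g y ker = lift λ γ → sum-zero {N} _ λ v → ≈-trans (*-congˡ (pd-constant v _ γ)) (zeroʳ _)
    Flat-subs (suc k) g y ker = lift λ γ → ≈-trans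
      (sum-cong-≋ {N} λ v → ≈-trans (*-congˡ (chain-rule l k g v γ)) (*-distribˡ-sum {M} (y v) λ u → l u v * subs l k (pd u g) γ))
      (≈-trans (∑-comm {N} {M} λ v u → y v * (l u v * subs l k (pd u g) γ))
        (sum-zero {M} _ λ u → ≈-trans (sum-cong-≋ {N} λ v → ≈-sym (*-assoc (y v) (l u v) _))
          (≈-trans (≈-sym (*-distribʳ-sum {N} (subs l k (pd u g) γ) λ v → y v * l u v)) (≈-trans (*-congʳ (ker u)) (zeroˡ _)))))

    -- As k > 0, flatness 1 of the substituted partials may be weakened to k; a shift of degree τ
    -- then gives τ + k, the degree of the forms in W.
    Flat-W : 0 ℕ.< k → ∀ f → W f → Flat (τ ℕ.+ k) (coeff f)
    Flat-W 0<k f (n , a , v , gen , eq) = Flat-≋ (τ ℕ.+ k) {λ γ → sum λ i → a i * coeff (v i) γ} {coeff f}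
      (λ γ → ≈-sym (≈-trans (eq γ) (coeff-combination a v γ)))
      (Flat-sum (τ ℕ.+ k) a (λ i → coeff (v i)) λ i → let (D , q , eq) = gen i; sp = convolve-spans q (operator-spans D) in
        Flat-≋ (τ ℕ.+ k) {λ γ → sumL βuss λ x → Spans.weights sp x * shifted-partial x γ} {coeff (v i)}
          (λ γ → ≈-sym (≈-trans (eq γ) (Spans.expansion sp γ)))
          (Flat-sumL (τ ℕ.+ k) βuss (Spans.weights sp) shifted-partial λ { (β , us) βus∈ → shifted β us (mons-sound N τ (proj₁ (∈-cartesianProduct⁻ (mons N τ) (allWords M e) βus∈))) }))
      where
      βuss = cartesianProduct (mons N τ) (allWords M e)
      shifted-partial : Vec ℕ N × Vec (Fin M) e → Series N
      shifted-partial (β , us) = shifts (proj₁ (word β)) (partial us)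
      shifted : ∀ β us → Vec.sum β ≡ τ → Flat (τ ℕ.+ k) (shifts (proj₁ (word β)) (partial us))
      shifted β us β≡τ = subst (λ j → Flat j (shifts (proj₁ (word β)) (partial us)))
        (cong₂ ℕ._+_ (trans (proj₂ (proj₂ (word β))) β≡τ) (trans (ℕ.+-comm (ℕ.pred k) 1) (ℕ.suc-pred k {{ℕ.>-nonZero 0<k}})))
        (Flat-shifts (ℕ.pred k ℕ.+ 1) (proj₁ (word β)) {partial us} (Flat-+ 1 (ℕ.pred k) {partial us} (Flat-subs k (pds us (coeff p)))))

  -- Reduced echelon data of the forms l: the columns of Y lie in their common kernel, and
  -- the column of a non-pivot v is scale at v and 0 at the other non-pivots.
  record Echelon {M N} (l : Fin M → Fin N → Carrier) : Set (c ⊔ ℓ) where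
    field
      pivots     : List (Fin N)
      unique     : Unique pivots
      few        : length pivots ℕ.≤ M
      scale      : Carrier
      scale≉0    : ¬ (scale ≈ 0#)
      Y          : Fin N → Fin N → Carrier
      kernel     : ∀ u v → sum (λ w → l u w * Y w v) ≈ 0#
      diagonal   : ∀ {v} → v ∉ pivots → Y v v ≈ scale
      offdiag    : ∀ {v w} → w ∉ pivots → w ≢ v → Y w v ≈ 0#
      pivot-zero : ∀ {v} w → v ∈ pivots → Y w v ≈ 0#

  -- Elimination without division, one form at a time. Either the new form vanishes on all columns
  -- found so far, or a column v₀ on which it does not vanish becomes a pivot and corrects the
  -- others.
  echelon : ∀ {N} M (l : Fin M → Fin N → Carrier) → ¬ ¬ Echelon l
  echelon {N} zero l h = h record
    { pivots = [] ; unique = [] ; few = ℕ.z≤n ; scale = 1# ; scale≉0 = 1≉0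
    ; Y = kronecker
    ; kernel = λ ()
    ; diagonal = λ {v} _ → kronecker-≡ v
    ; offdiag = λ _ w≢v → kronecker-≢ w≢v
    ; pivot-zero = λ { _ () }
    }
  echelon {N} (suc M) l h = echelon M (l ∘ Fin.suc) λ E → all-or-counterexample (λ v → residue E v ≈ 0#) λ
    { (inj₁ zeros)       → h (keep E zeros)
    ; (inj₂ (v₀ , λ≉0)) → h (extend-by E v₀ λ≉0) }
    where
    residue : Echelon (l ∘ Fin.suc) → Fin N → Carrier
    residue E v = sum λ w → l Fin.zero w * Echelon.Y E w v
    keep : ∀ E → (∀ v → residue E v ≈ 0#) → Echelon l
    keep E zeros = record
      { pivots = pivots ; unique = unique ; few = ℕ.m≤n⇒m≤1+n few ; scale = scale ; scale≉0 = scale≉0 ; Y = Y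
      ; kernel = λ { Fin.zero → zeros ; (Fin.suc u) → kernel u }
      ; diagonal = diagonal ; offdiag = offdiag ; pivot-zero = pivot-zero }
      where open Echelon E
    extend-by : ∀ E v₀ → ¬ (residue E v₀ ≈ 0#) → Echelon l
    extend-by E v₀ r₀≉0 = record
      { pivots = v₀ ∷ pivots
      ; unique = All.¬Any⇒All¬ pivots v₀∉ ∷ unique
      ; few = ℕ.s≤s few
      ; scale = r v₀ * scale
      ; scale≉0 = λ r₀c≈0 → scale≉0 (domain r₀≉0 r₀c≈0)
      ; Y = Y′
      ; kernel = kernel′
      ; diagonal = λ {v} v∉ → ≈-trans (difference (diagonal (v∉ ∘ there)) (≈-trans (*-congʳ (offdiag (v∉ ∘ there) (v∉ ∘ here))) (zeroˡ _))) ≈-refl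
      ; offdiag = λ {v} {w} w∉ w≢v → ≈-trans (difference (offdiag (w∉ ∘ there) w≢v)
          (≈-trans (*-congʳ (offdiag (w∉ ∘ there) (w∉ ∘ here))) (zeroˡ _))) (zeroʳ _)
      ; pivot-zero = λ { w (here refl) → ≈-trans (+-congʳ (*-comm _ _)) (-‿inverseʳ _)
                       ; w (there v∈) → ≈-trans (difference (pivot-zero w v∈) (≈-trans (*-congˡ (residue-zero v∈)) (zeroʳ _))) (zeroʳ _) }
      }
      where
      open Echelon E
      r = residue E
      residue-zero : ∀ {v} → v ∈ pivots → r v ≈ 0#
      residue-zero v∈ = sum-zero {N} _ λ w → ≈-trans (*-congˡ (pivot-zero w v∈)) (zeroʳ _)
      v₀∉ : v₀ ∉ pivots
      v₀∉ v₀∈ = r₀≉0 (residue-zero v₀∈)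
      -- The new form takes the value `r v` on column v, so it vanishes on this combination; for v =
      -- v₀ the combination itself is 0.
      Y′ : Fin N → Fin N → Carrier
      Y′ w v = r v₀ * Y w v - Y w v₀ * r v
      difference : ∀ {a b x y} → x ≈ b → y ≈ 0# → a * x - y ≈ a * b
      difference {a} {b} x≈b y≈0 = ≈-trans (+-cong (*-congˡ x≈b) (≈-trans (-‿cong y≈0) -0#≈0#)) (+-identityʳ _)
        where open Algebra.Properties.Ring ring using (-0#≈0#)
      split : ∀ u v → sum (λ w → l u w * Y′ w v) ≈ r v₀ * sum (λ w → l u w * Y w v) - sum (λ w → l u w * Y w v₀) * r v
      split u v = ≈-trans (sum-cong-≋ {N} λ w → ≈-trans (distribˡ (l u w) _ _)
          (+-cong (x*yz≈y*xz (l u w) (r v₀) (Y w v))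
            (≈-trans (*-congˡ (-‿distribʳ-* (Y w v₀) (r v))) (≈-sym (*-assoc (l u w) (Y w v₀) (- r v))))))
        (≈-trans (∑-distrib-+ {N} (λ w → r v₀ * (l u w * Y w v)) (λ w → l u w * Y w v₀ * (- r v)))
          (+-cong (≈-sym (*-distribˡ-sum {N} (r v₀) λ w → l u w * Y w v))
            (≈-trans (≈-sym (*-distribʳ-sum {N} (- r v) λ w → l u w * Y w v₀)) (≈-sym (-‿distribʳ-* _ (r v))))))
      kernel′ : ∀ u v → sum (λ w → l u w * Y′ w v) ≈ 0#
      kernel′ Fin.zero    v = ≈-trans (split Fin.zero v) (-‿inverseʳ (r v₀ * r v))
      kernel′ (Fin.suc u) v = ≈-trans (split (Fin.suc u) v)
        (≈-trans (difference (kernel u v) (≈-trans (*-congʳ (kernel u v₀)) (zeroˡ _))) (zeroʳ _))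

  module Restricted {M N d e τ : ℕ} (ℓs : Fin M → S 1 N) (p : S d M) (e≤d : e ℕ.≤ d)
                    (E : Echelon (Substituted.l {τ = τ} ℓs p e≤d)) where
    open Substituted {M} {N} {d} {e} {τ} ℓs p e≤d
    open Echelon E

    PivotFree : Series N → Set ℓ
    PivotFree f = ∀ {v} → v ∈ pivots → ∀ γ → f (inc v γ) ≈ 0#

    direction : Fin N → Fin N → Carrier
    direction v w = Y w v

    direction-kernel : ∀ v → Kernel (direction v)
    direction-kernel v u = ≈-trans (sum-cong-≋ {N} λ w → *-comm (Y w v) (l u w)) (kernel u v)

    _∈?_ : ∀ v (vs : List (Fin N)) → Dec (v ∈ vs)
    v ∈? vs = any? (v Fin.≟_) vs

    -- Apart from the entry `scale` at v, the direction is supported on pivots, and f does not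
    -- involve the pivot variables.
    pd-along-direction : ∀ {f} → PivotFree f → ∀ {v} → v ∉ pivots → pd-along (direction v) f ≋ scale ⊡ pd v f
    pd-along-direction {f} free {v} v∉ γ = ≈-trans (sum-single v _ off) (*-congʳ (diagonal v∉))
      where
      off : ∀ w → v ≢ w → Y w v * pd w f γ ≈ 0#
      off w v≢w with w ∈? pivots
      ... | yes w∈ = ≈-trans (*-congˡ (≈-trans (×-congʳ (suc (lookup γ w)) (free w∈ γ)) (×-zero (suc (lookup γ w))))) (zeroʳ _)
      ... | no  w∉ = ≈-trans (*-congʳ (offdiag w∉ (v≢w ∘ sym))) (zeroˡ _)

    pivotFree-pd-along : ∀ {f} y → PivotFree f → PivotFree (pd-along y f)
    pivotFree-pd-along {f} y free {v} v∈ γ = sum-zero {N} _ λ w → ≈-trans (*-congˡ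
      (≈-trans (×-congʳ (suc (lookup (inc v γ) w)) (≈-trans (reflexive (cong f (inc-comm w v γ))) (free v∈ (inc w γ)))) (×-zero (suc (lookup (inc v γ) w))))) (zeroʳ _)

    -- Differentiating along the direction of each variable of w isolates the coefficient at w up to
    -- powers of `scale` and positive integers, all of which cancel.
    flat-pivotFree : ∀ w {f} → (∀ {v} → v ∈ w → v ∉ pivots) → PivotFree f → Flat (length w) f → f (incs w (replicate N 0)) ≈ 0#
    flat-pivotFree []      w∉ free (lift h) = h (replicate N 0)
    flat-pivotFree (v ∷ w) {f} w∉ free h = ×-domain (lookup γ v) (domain scale≉0
      (≈-trans (≈-sym (pd-along-direction {f} free (w∉ (here refl)) γ))
        (flat-pivotFree w {pd-along (direction v) f} (w∉ ∘ there) (pivotFree-pd-along {f} (direction v) free) (h (direction v) (direction-kernel v)))))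
      where γ = incs w (replicate N 0)

    D : ℕ
    D = τ ℕ.+ k

    withPivot : List (Vec ℕ N)
    withPivot = filter (λ κ → ¬? (Avoid? (map [_] pivots) κ)) (mons N D)

    -- The coefficients at monomials with a pivot determine an element of W: if they vanish, only
    -- pivot-free monomials are left, and flatness kills these.
    dimension-≤-withPivot : ∀ {a} → 0 ℕ.< k → DimShiftedPartials e τ (substitute ℓs p) a → a ℕ.≤ length withPivot
    dimension-≤-withPivot 0<k dim = dimension-≤-functionals {W = W} withPivot (λ {f} _ → coeff f) dim determine
      where
      determine : ∀ {n} (v : Fin n → S D N) (v∈W : ∀ i → W (v i)) (t : Fin n → Carrier) →
        (∀ κ → κ ∈ withPivot → sum (λ i → t i * coeff (v i) κ) ≈ 0#) → ∀ γ → sum (λ i → t i * coeff (v i) γ) ≈ 0#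
      determine {n} v v∈W t h γ = by (Vec.sum γ ℕ.≟ D)
        where
        f : Series N
        f γ = sum λ i → t i * coeff (v i) γ
        homogeneous-f : ∀ γ → Vec.sum γ ≢ D → f γ ≈ 0#
        homogeneous-f γ ≢D = sum-zero {n} _ λ i → ≈-trans (*-congˡ (homogeneous (v i) γ ≢D)) (zeroʳ _)
        at-pivot : ∀ γ → Vec.sum γ ≡ D → ¬ Avoid (map [_] pivots) γ → f γ ≈ 0#
        at-pivot γ ≡D ¬avoid = h γ (∈-filter⁺ (λ κ → ¬? (Avoid? (map [_] pivots) κ)) (mons-complete γ D ≡D) ¬avoid)
        free : PivotFree f
        free {u} u∈ γ with Vec.sum (inc u γ) ℕ.≟ D
        ... | no  ≢D = homogeneous-f (inc u γ) ≢D
        ... | yes ≡D = at-pivot (inc u γ) ≡D λ avoid → All.lookup avoid (∈-map⁺ [_] u∈) (γ , refl)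
        by : Dec (Vec.sum γ ≡ D) → f γ ≈ 0#
        by (no  ≢D) = homogeneous-f γ ≢D
        by (yes ≡D) with Avoid? (map [_] pivots) γ | word γ
        ... | no  ¬avoid | _ = at-pivot γ ≡D ¬avoid
        ... | yes avoid  | w , refl , len = flat-pivotFree w
              (λ {u} u∈w u∈ → All.lookup avoid (∈-map⁺ [_] u∈) (∣ᵐ-∈ w (replicate N 0) u∈w)) free
              (subst (λ j → Flat j f) (sym (trans len ≡D)) (Flat-sum D t (λ i → coeff (v i)) λ i → Flat-W 0<k (v i) (v∈W i)))

  -- There are at most M pivots, so at least H n D monomials of degree D avoid them all. Deciding
  -- the inequality first removes the double negation of `echelon`.
  dimension-≤-codimension : ∀ {M N d e τ} (ℓs : Fin M → S 1 N) (p : S d M) → e ℕ.< d → ∀ n → n ℕ.+ M ≡ N → ∀ {a} →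
    DimShiftedPartials e τ (substitute ℓs p) a → a ℕ.+ H n (τ ℕ.+ (d ∸ e)) ℕ.≤ H N (τ ℕ.+ (d ∸ e))
  dimension-≤-codimension {M} {N} {d} {e} {τ} ℓs p e<d n n+M≡N {a} dim with a ℕ.+ H n (τ ℕ.+ (d ∸ e)) ℕ.≤? H N (τ ℕ.+ (d ∸ e))
  ... | yes le = le
  ... | no ¬le = ⊥-elim (echelon M _ λ E → ¬le (bound E))
    where
    D = τ ℕ.+ (d ∸ e)
    bound : Echelon (Substituted.l {τ = τ} ℓs p (ℕ.<⇒≤ e<d)) → a ℕ.+ H n D ℕ.≤ H N D
    bound E = begin
      a ℕ.+ H n D                          ≤⟨ ℕ.+-mono-≤ (dimension-≤-withPivot (ℕ.m<n⇒0<n∸m e<d) dim)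
                                                (H-mono-vars D (ℕ.≤⇒≤′ n≤)) ⟩
      length withPivot ℕ.+ H n′ D          ≡⟨ cong₂ ℕ._+_ (length-filter-∑ _ (mons N D)) (sym (#Avoid-singletons pivots n′ D (singletons-disjoint unique) n′+r≡N)) ⟩
      ∑ (mons N D) (λ κ → 𝟙 (¬? (Avoid? (map [_] pivots) κ))) ℕ.+ #Avoid (map [_] pivots) D
                                           ≡⟨ sym (∑-+ (mons N D) _ _) ⟩
      ∑ (mons N D) (λ κ → 𝟙 (¬? (Avoid? (map [_] pivots) κ)) ℕ.+ 𝟙 (Avoid? (map [_] pivots) κ))
                                           ≡⟨ ∑-cong (mons N D) complementary ⟩
      ∑ (mons N D) (λ _ → 1)               ≡⟨ ∑-mons-1 N D ⟩
      H N D                                ∎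
      where
      open ℕ.≤-Reasoning
      open Restricted {τ = τ} ℓs p (ℕ.<⇒≤ e<d) E using (withPivot; dimension-≤-withPivot)
      open Echelon E
      n′ = N ∸ length pivots
      r≤N : length pivots ℕ.≤ N
      r≤N = ℕ.≤-trans few (subst (M ℕ.≤_) n+M≡N (ℕ.m≤n+m M n))
      n′+r≡N : n′ ℕ.+ length pivots ≡ N
      n′+r≡N = ℕ.m∸n+n≡m r≤N
      n≤ : n ℕ.≤ n′
      n≤ = ℕ.m+n≤o⇒m≤o∸n n (subst (n ℕ.+ length pivots ℕ.≤_) n+M≡N (ℕ.+-monoʳ-≤ n few))
      complementary : ∀ κ → 𝟙 (¬? (Avoid? (map [_] pivots) κ)) ℕ.+ 𝟙 (Avoid? (map [_] pivots) κ) ≡ 1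
      complementary κ with Avoid? (map [_] pivots) κ
      ... | yes _ = refl
      ... | no  _ = refl

-- Walks, and the minimality of straight ones.

module Walks where
  open import Data.Nat.Base
    using (_+_; _*_; _≤_; _<_; z≤n; s≤s; NonZero)
  open import Data.Nat.Properties
  open import Data.Nat.Solver using (module +-*-Solver)
  open import Data.Nat.DivMod using (m%n<n; m<n⇒m%n≡m)
  open import Data.Nat.ListAction using (sum)

  private variable
    d n N : ℕ

  energy : (Fin N → ℕ) → Vec ℕ N → ℕ
  energy ω []      = 0
  energy ω (a ∷ α) = a * ω Fin.zero + energy (ω ∘ Fin.suc) α

  energy-inc : ∀ ω (v : Fin N) α → energy ω (inc v α) ≡ ω v + energy ω α
  energy-inc ω Fin.zero    (a ∷ α) = +-assoc (ω Fin.zero) (a * ω Fin.zero) _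
  energy-inc ω (Fin.suc v) (a ∷ α) = trans (cong (a * ω Fin.zero +_) (energy-inc (ω ∘ Fin.suc) v α))
    (solve 3 (λ x y z → x :+ (y :+ z) := y :+ (x :+ z)) refl (a * ω Fin.zero) (ω (Fin.suc v)) _)
    where open +-*-Solver

  energy-0 : ∀ ω → energy ω (replicate N 0) ≡ 0
  energy-0 {zero}  ω = refl
  energy-0 {suc N} ω = energy-0 (ω ∘ Fin.suc)

  energy-incs-< : ∀ ω w {α β : Vec ℕ N} → energy ω α < energy ω β → energy ω (incs w α) < energy ω (incs w β)
  energy-incs-< ω []      h = h
  energy-incs-< ω (v ∷ w) {α} {β} h = subst₂ _<_ (sym (energy-inc ω v (incs w α))) (sym (energy-inc ω v (incs w β)))
    (+-monoʳ-< (ω v) (energy-incs-< ω w {α} {β} h))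

  -- v t a b is the variable in row a and column b of the t-th matrix. A walk contributes the
  -- monomial of the variables on its edges to the entry (i , j) of the matrix product.
  Variables : ℕ → ℕ → ℕ → Set
  Variables d n N = Fin d → Fin n → Fin n → Fin N

  Walk : ∀ d → Variables d n N → Fin n → Fin n → Vec ℕ N → Set
  Walk {N = N} zero    v i j α = i ≡ j × α ≡ replicate N 0
  Walk         (suc d) v i j α = ∃ λ k → ∃ λ β → α ≡ inc (v Fin.zero i k) β × Walk d (v ∘ Fin.suc) k j β

  Injective : Variables d n N → Set
  Injective v = ∀ {t a b t′ a′ b′} → v t a b ≡ v t′ a′ b′ → t ≡ t′ × a ≡ a′ × b ≡ b′

  Injective-∘ : ∀ {d′} {v : Variables d n N} (f : Fin d′ → Fin d) → (∀ {s t} → f s ≡ f t → s ≡ t) → Injective v → Injective (v ∘ f)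
  Injective-∘ f f-inj inj eq = let (t≡ , a≡ , b≡) = inj eq in f-inj t≡ , a≡ , b≡

  Injective-suc : ∀ {v : Variables (suc d) n N} → Injective v → Injective (v ∘ Fin.suc)
  Injective-suc = Injective-∘ Fin.suc Fin.suc-injective

  walk-avoids : ∀ d {v : Variables d n N} {i j α} x → (∀ t a b → v t a b ≢ x) → Walk d v i j α → lookup α x ≡ 0
  walk-avoids zero    x h (_ , refl) = Vec.lookup-replicate x 0
  walk-avoids (suc d) {v} {i} x h (k , β , refl , walk) =
    trans (lookup-inc-≢ β (h Fin.zero i k ∘ sym)) (walk-avoids d x (h ∘ Fin.suc) walk)

  first-avoids : ∀ {v : Variables (suc d) n N} → Injective v → ∀ a b t a′ b′ → v (Fin.suc t) a′ b′ ≢ v Fin.zero a b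
  first-avoids inj a b t a′ b′ eq with proj₁ (inj eq)
  ... | ()

  -- A step of a schedule names the next node; the edges of jumps are differentiated away.
  data Step (n : ℕ) : Set where
    jump free : Fin n → Step n

  pos : Fin n → ℤ
  pos x = ℤ.+ toℕ x

  -- δ is the increment of the run in progress; a jump ends the run and admits any new increment.
  data Straight {n} : ∀ {d} → ℤ → Fin n → Vec (Step n) d → Set where
    []   : ∀ {δ x} → Straight δ x []
    jump : ∀ {d δ δ′ x y} {s : Vec (Step n) d} → Straight δ′ y s → Straight δ x (jump y ∷ s)
    free : ∀ {d δ x y} {s : Vec (Step n) d} → pos y ≡ pos x ℤ.+ δ → Straight δ y s → Straight δ x (free y ∷ s)

  square : ℤ → ℕ
  square i = ℤ.∣ i ∣ * ℤ.∣ i ∣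

  square-+ : ∀ i → ℤ.+ square i ≡ i ℤ.* i
  square-+ (ℤ.+ n)      = ℤ.pos-* n n
  square-+ ℤ.-[1+ n ] = refl

  square-0 : ∀ i → square i ≡ 0 → i ≡ 0ℤ
  square-0 i eq with m*n≡0⇒m≡0∨n≡0 ℤ.∣ i ∣ eq
  ... | inj₁ ≡0 = ℤ.∣i∣≡0⇒i≡0 ≡0
  ... | inj₂ ≡0 = ℤ.∣i∣≡0⇒i≡0 ≡0

  pos-injective : ∀ {x y : Fin n} → pos x ≡ pos y → x ≡ y
  pos-injective eq = Fin.toℕ-injective (ℤ.+-injective eq)

  endpoint : ∀ {d} → Fin n → Vec (Step n) d → Fin n
  endpoint x []           = x
  endpoint x (jump y ∷ s) = endpoint y s
  endpoint x (free y ∷ s) = endpoint y s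

  module _ {n N : ℕ} where

    jumps : ∀ {d} → Variables d n N → Fin n → Vec (Step n) d → List (Fin N)
    jumps v x []           = []
    jumps v x (jump y ∷ s) = v Fin.zero x y ∷ jumps (v ∘ Fin.suc) y s
    jumps v x (free y ∷ s) = jumps (v ∘ Fin.suc) y s

    frees : ∀ {d} → Variables d n N → Fin n → Vec (Step n) d → List (Fin N)
    frees v x []           = []
    frees v x (jump y ∷ s) = frees (v ∘ Fin.suc) y s
    frees v x (free y ∷ s) = v Fin.zero x y ∷ frees (v ∘ Fin.suc) y s

    0ᵐ : Vec ℕ N
    0ᵐ = replicate N 0

    scheduled-walk : ∀ {d} (v : Variables d n N) x s → Walk d v x (endpoint x s) (incs (jumps v x s) (incs (frees v x s) 0ᵐ))
    scheduled-walk v x []           = refl , refl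
    scheduled-walk v x (jump y ∷ s) = y , _ , refl , scheduled-walk (v ∘ Fin.suc) y s
    scheduled-walk v x (free y ∷ s) = y , _ , incs-inc (jumps (v ∘ Fin.suc) y s) _ _ , scheduled-walk (v ∘ Fin.suc) y s

    jumps-avoid : ∀ {d} (v : Variables d n N) x s {e} → (∀ t a b → v t a b ≢ e) → e ∉ jumps v x s
    jumps-avoid v x (jump y ∷ s) h (here eq) = h Fin.zero x y (sym eq)
    jumps-avoid v x (jump y ∷ s) h (there e∈) = jumps-avoid (v ∘ Fin.suc) y s (h ∘ Fin.suc) e∈
    jumps-avoid v x (free y ∷ s) h e∈ = jumps-avoid (v ∘ Fin.suc) y s (h ∘ Fin.suc) e∈

    -- Variables at different times are distinct, so a variable of the first matrix can only come
    -- from the first edge.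
    walk-jump⁻ : ∀ {d} {v : Variables (suc d) n N} → Injective v → ∀ {x y i j α} →
      Walk (suc d) v i j (inc (v Fin.zero x y) α) → i ≡ x × Walk d (v ∘ Fin.suc) y j α
    walk-jump⁻ {d} {v} inj {x} {y} {i} {j} {α} (k , β , eq , walk) with v Fin.zero x y Fin.≟ v Fin.zero i k
    ... | yes vxy≡vik with inj vxy≡vik
    ...   | _ , refl , refl = refl , subst (Walk d (v ∘ Fin.suc) y j) (sym (inc-injective (v Fin.zero x y) eq)) walk
    walk-jump⁻ {d} {v} inj {x} {y} {i} {j} {α} (k , β , eq , walk) | no vxy≢vik = contradiction
      (trans (cong (λ γ → lookup γ (v Fin.zero x y)) eq) (trans (lookup-inc-≢ β vxy≢vik)
        (walk-avoids d (v Fin.zero x y) (first-avoids inj x y) walk)))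
      (inc≢0 (v Fin.zero x y) {α})

    -- The variable of the first edge is not among the later jumps, so it divides γ.
    walk-free⁻ : ∀ {d} {v : Variables (suc d) n N} → Injective v → ∀ {y s i j γ} →
      Walk (suc d) v i j (incs (jumps (v ∘ Fin.suc) y s) γ) →
      ∃ λ k → ∃ λ γ′ → γ ≡ inc (v Fin.zero i k) γ′ × Walk d (v ∘ Fin.suc) k j (incs (jumps (v ∘ Fin.suc) y s) γ′)
    walk-free⁻ {d} {v} inj {y} {s} {i} {j} {γ} (k , β , eq , walk) with uninc (v Fin.zero i k) γ
    ... | inj₁ ≡0 = contradiction
      (trans (sym (cong (λ α → lookup α (v Fin.zero i k)) eq))
        (trans (lookup-incs-∉ js γ (jumps-avoid (v ∘ Fin.suc) y s (first-avoids inj i k))) ≡0))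
      (inc≢0 (v Fin.zero i k) {β})
      where js = jumps (v ∘ Fin.suc) y s
    ... | inj₂ (γ′ , refl) = k , γ′ , refl ,
      subst (Walk d (v ∘ Fin.suc) k j) (inc-injective (v Fin.zero i k) (trans (sym eq) (incs-inc js (v Fin.zero i k) γ′))) walk
      where js = jumps (v ∘ Fin.suc) y s

    -- Summing d² = δ² + 2δ(d - δ) + (d - δ)² over the free steps of a walk that starts at x′ and
    -- agrees with the schedule at all jumps, the middle terms telescope; the excess is Σ (d - δ)².
    straight-minimal : ∀ {d} {v : Variables d n N} (ω : Fin N → ℕ) → Injective v →
      (∀ t a b → ω (v t a b) ≡ square (pos a ℤ.- pos b)) →
      ∀ {δ x s} → Straight δ x s → ∀ {x′ γ} → Walk d v x′ (endpoint x s) (incs (jumps v x s) γ) →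
      ∃ λ excess → (ℤ.+ energy ω γ ℤ.+ (ℤ.+ 2) ℤ.* (δ ℤ.* (pos x′ ℤ.- pos x)) ≡ ℤ.+ energy ω (incs (frees v x s) 0ᵐ) ℤ.+ ℤ.+ excess)
                 × (excess ≡ 0 → γ ≡ incs (frees v x s) 0ᵐ × x′ ≡ x)
    straight-minimal ω inj ω≡ {δ} {x} [] (refl , refl) = 0 ,
      solve 3 (λ e δ x → e :+ con (ℤ.+ 2) :* (δ :* (x :- x)) := e :+ con 0ℤ) refl (ℤ.+ energy ω 0ᵐ) δ (pos x) , λ _ → refl , refl
      where open Data.Integer.Solver.+-*-Solver
    straight-minimal {v = v} ω inj ω≡ {δ} {x} (jump {δ′ = δ′} {y = y} st) {γ = γ} walk with walk-jump⁻ inj walk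
    ... | refl , walk′ with straight-minimal ω (Injective-suc inj) (ω≡ ∘ Fin.suc) st walk′
    ...   | c , eq , tight = c , trans
        (solve 5 (λ e δ δ′ x y → e :+ con (ℤ.+ 2) :* (δ :* (x :- x)) := e :+ con (ℤ.+ 2) :* (δ′ :* (y :- y))) refl (ℤ.+ energy ω γ) δ δ′ (pos x) (pos y)) eq ,
        λ c≡0 → proj₁ (tight c≡0) , refl
      where open Data.Integer.Solver.+-*-Solver
    straight-minimal {v = v} ω inj ω≡ {δ} {x} (free {y = y} {s = s} y≡x+δ st) {x′} walk with walk-free⁻ inj {y} {s} walk
    ... | k , γ′ , refl , walk′ with straight-minimal ω (Injective-suc inj) (ω≡ ∘ Fin.suc) st walk′
    ...   | c , eq , tight = c + square D , total , λ excess≡0 →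
        let (γ′≡ , k≡y) = tight (m+n≡0⇒m≡0 c excess≡0)
            x′≡x = x′≡ (square-0 D (m+n≡0⇒n≡0 c excess≡0)) (cong pos k≡y)
        in cong₂ inc (cong₂ (v Fin.zero) x′≡x k≡y) γ′≡ , x′≡x
      where
      open Data.Integer.Solver.+-*-Solver
      F′ = incs (frees (v ∘ Fin.suc) y s) 0ᵐ
      D = pos k ℤ.- pos x′ ℤ.- δ
      energy-step : ∀ a b α → ℤ.+ energy ω (inc (v Fin.zero a b) α) ≡ (pos a ℤ.- pos b) ℤ.* (pos a ℤ.- pos b) ℤ.+ ℤ.+ energy ω α
      energy-step a b α = trans (cong ℤ.+_ (trans (energy-inc ω (v Fin.zero a b) α) (cong (_+ energy ω α) (ω≡ Fin.zero a b))))
        (trans (ℤ.pos-+ _ (energy ω α)) (cong (ℤ._+ ℤ.+ energy ω α) (square-+ (pos a ℤ.- pos b))))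
      x′≡ : D ≡ 0ℤ → pos k ≡ pos y → x′ ≡ x
      x′≡ D≡0 k≡y = pos-injective (trans
        (trans (solve 3 (λ k x′ δ → x′ := k :- δ :- (k :- x′ :- δ)) refl (pos k) (pos x′) δ)
               (cong₂ (λ k D → k ℤ.- δ ℤ.- D) (trans k≡y y≡x+δ) D≡0))
        (solve 2 (λ x δ → x :+ δ :- δ :- con 0ℤ := x) refl (pos x) δ))
      total : ℤ.+ energy ω (inc (v Fin.zero x′ k) γ′) ℤ.+ (ℤ.+ 2) ℤ.* (δ ℤ.* (pos x′ ℤ.- pos x)) ≡
              ℤ.+ energy ω (inc (v Fin.zero x y) F′) ℤ.+ ℤ.+ (c + square D)
      total = begin
        ℤ.+ energy ω (inc (v Fin.zero x′ k) γ′) ℤ.+ (ℤ.+ 2) ℤ.* (δ ℤ.* (pos x′ ℤ.- pos x))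
          ≡⟨ cong (ℤ._+ (ℤ.+ 2) ℤ.* (δ ℤ.* (pos x′ ℤ.- pos x))) (energy-step x′ k γ′) ⟩
        (pos x′ ℤ.- pos k) ℤ.* (pos x′ ℤ.- pos k) ℤ.+ ℤ.+ energy ω γ′ ℤ.+ (ℤ.+ 2) ℤ.* (δ ℤ.* (pos x′ ℤ.- pos x))
          ≡⟨ solve 5 (λ x′ k x δ e → (x′ :- k) :* (x′ :- k) :+ e :+ con (ℤ.+ 2) :* (δ :* (x′ :- x))
               := (e :+ con (ℤ.+ 2) :* (δ :* (k :- (x :+ δ)))) :+ (δ :* δ :+ (k :- x′ :- δ) :* (k :- x′ :- δ))) refl (pos x′) (pos k) (pos x) δ (ℤ.+ energy ω γ′) ⟩
        (ℤ.+ energy ω γ′ ℤ.+ (ℤ.+ 2) ℤ.* (δ ℤ.* (pos k ℤ.- (pos x ℤ.+ δ)))) ℤ.+ (δ ℤ.* δ ℤ.+ D ℤ.* D)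
          ≡⟨ cong (λ y → (ℤ.+ energy ω γ′ ℤ.+ (ℤ.+ 2) ℤ.* (δ ℤ.* (pos k ℤ.- y))) ℤ.+ (δ ℤ.* δ ℤ.+ D ℤ.* D)) (sym y≡x+δ) ⟩
        (ℤ.+ energy ω γ′ ℤ.+ (ℤ.+ 2) ℤ.* (δ ℤ.* (pos k ℤ.- pos y))) ℤ.+ (δ ℤ.* δ ℤ.+ D ℤ.* D)
          ≡⟨ cong (ℤ._+ (δ ℤ.* δ ℤ.+ D ℤ.* D)) eq ⟩
        (ℤ.+ energy ω F′ ℤ.+ ℤ.+ c) ℤ.+ (δ ℤ.* δ ℤ.+ D ℤ.* D)
          ≡⟨ solve 5 (λ f c δ D x → (f :+ c) :+ (δ :* δ :+ D) := ((x :- (x :+ δ)) :* (x :- (x :+ δ)) :+ f) :+ (c :+ D)) refl (ℤ.+ energy ω F′) (ℤ.+ c) δ (D ℤ.* D) (pos x) ⟩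
        ((pos x ℤ.- (pos x ℤ.+ δ)) ℤ.* (pos x ℤ.- (pos x ℤ.+ δ)) ℤ.+ ℤ.+ energy ω F′) ℤ.+ (ℤ.+ c ℤ.+ D ℤ.* D)
          ≡⟨ cong₂ (λ y q → ((pos x ℤ.- y) ℤ.* (pos x ℤ.- y) ℤ.+ ℤ.+ energy ω F′) ℤ.+ q) (sym y≡x+δ)
               (trans (cong (λ q → ℤ.+ c ℤ.+ q) (sym (square-+ D))) (sym (ℤ.pos-+ c (square D)))) ⟩
        ((pos x ℤ.- pos y) ℤ.* (pos x ℤ.- pos y) ℤ.+ ℤ.+ energy ω F′) ℤ.+ ℤ.+ (c + square D)
          ≡⟨ cong (ℤ._+ ℤ.+ (c + square D)) (sym (energy-step x y F′)) ⟩
        ℤ.+ energy ω (inc (v Fin.zero x y) F′) ℤ.+ ℤ.+ (c + square D) ∎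
        where open ≡-Reasoning

    -- The initial jump fixes both ends of the remaining walk, so the linear term of
    -- `straight-minimal` vanishes and the excess alone compares the energies.
    closed-straight-minimal : ∀ {d} {v : Variables (suc d) n N} (ω : Fin N → ℕ) → Injective v →
      (∀ t a b → ω (v t a b) ≡ square (pos a ℤ.- pos b)) →
      ∀ {δ x y} {s : Vec (Step n) d} → Straight δ y s → endpoint y s ≡ x → ∀ {i γ} →
      Walk (suc d) v i i (incs (jumps v x (jump y ∷ s)) γ) →
      γ ≡ incs (frees v x (jump y ∷ s)) 0ᵐ ⊎ energy ω (incs (frees v x (jump y ∷ s)) 0ᵐ) < energy ω γ
    closed-straight-minimal {v = v} ω inj ω≡ {δ} {x} {y} {s} st refl {i} {γ} walk with walk-jump⁻ inj walk
    ... | refl , walk′ with straight-minimal ω (Injective-suc inj) (ω≡ ∘ Fin.suc) st walk′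
    ...   | zero  , eq , tight = inj₁ (proj₁ (tight refl))
    ...   | suc c , eq , _     = inj₂ (subst (energy ω F <_) (sym (ℤ.+-injective (trans lhs (trans eq (sym (ℤ.pos-+ (energy ω F) (suc c))))))) (m<m+n (energy ω F) (s≤s z≤n)))
      where
      open Data.Integer.Solver.+-*-Solver
      F = incs (frees (v ∘ Fin.suc) y s) 0ᵐ
      lhs : ℤ.+ energy ω γ ≡ ℤ.+ energy ω γ ℤ.+ (ℤ.+ 2) ℤ.* (δ ℤ.* (pos y ℤ.- pos y))
      lhs = solve 3 (λ e δ y → e := e :+ con (ℤ.+ 2) :* (δ :* (y :- y))) refl (ℤ.+ energy ω γ) δ (pos y)

  -- The number of matrices consumed by runs of the given lengths, each preceded by one jump.
  total : List ℕ → ℕ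
  total []       = 0
  total (r ∷ rs) = suc (r + total rs)

  total-sum : ∀ rs → total rs ≡ length rs + sum rs
  total-sum []       = refl
  total-sum (r ∷ rs) = cong suc (trans (cong (r +_) (total-sum rs))
    (solve 3 (λ r l s → r :+ (l :+ s) := l :+ (r :+ s)) refl r (length rs) (sum rs)))
    where open +-*-Solver

  Label : Set
  Label = ℕ × ℕ

  module Runs (n N : ℕ) .{{_ : NonZero n}} where

    -- The node with label (u , w) after j of ρ + j steps on the line from (ρ + j)u to (ρ + j)w.
    node : ℕ → ℕ → Label → Fin n
    node ρ j (u , w) = fromℕ< (m%n<n (ρ * u + j * w) n)

    -- The remainder only makes `node` total; below n it changes nothing.
    toℕ-node : ∀ ρ j u w → ρ * u + j * w < n → toℕ (node ρ j (u , w)) ≡ ρ * u + j * w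
    toℕ-node ρ j u w h = trans (Fin.toℕ-fromℕ< _) (m<n⇒m%n≡m h)

    steps : ∀ {d} ρ → ℕ → Label → Vec (Step n) d → Vec (Step n) (ρ + d)
    steps zero    j l s = s
    steps (suc ρ) j l s = free (node ρ (suc j) l) ∷ steps ρ (suc j) l s

    schedule : ∀ rs → Vec Label (length rs) → Vec (Step n) (total rs)
    schedule []       []       = []
    schedule (r ∷ rs) (l ∷ ls) = jump (node r 0 l) ∷ steps r 0 l (schedule rs ls)

    run : ∀ {d} ρ → ℕ → Label → Variables (ρ + d) n N → List (Fin N)
    run zero    j l v = []
    run (suc ρ) j l v = v Fin.zero (node (suc ρ) j l) (node ρ (suc j) l) ∷ run ρ (suc j) l (v ∘ Fin.suc)

    length-run : ∀ {d} ρ j l (v : Variables (ρ + d) n N) → length (run ρ j l v) ≡ ρ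
    length-run zero    j l v = refl
    length-run (suc ρ) j l v = cong suc (length-run ρ (suc j) l (v ∘ Fin.suc))

    -- One family per run. Every label is offered to every run, since jumps can join any two lines.
    groups : List Label → ∀ rs → Variables (total rs) n N → List (List (List (Fin N)))
    groups labels []       v = []
    groups labels (r ∷ rs) v = map (λ l → run r 0 l (v ∘ Fin.suc)) labels ∷ groups labels rs (v ∘ Fin.suc ∘ (r ↑ʳ_))

    frees-schedule : ∀ rs ls (v : Variables (total rs) n N) x y → frees v x (schedule rs ls) ≡ frees v y (schedule rs ls)
    frees-schedule []       []       v x y = refl
    frees-schedule (r ∷ rs) (l ∷ ls) v x y = refl

    frees-steps : ∀ rs ls x₀ ρ j l (v : Variables (ρ + total rs) n N) →
      frees v (node ρ j l) (steps ρ j l (schedule rs ls)) ≡ run ρ j l v ++ frees (v ∘ (ρ ↑ʳ_)) x₀ (schedule rs ls)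
    frees-steps rs ls x₀ zero    j l v = frees-schedule rs ls v (node 0 j l) x₀
    frees-steps rs ls x₀ (suc ρ) j l v = cong (v Fin.zero (node (suc ρ) j l) (node ρ (suc j) l) ∷_) (frees-steps rs ls x₀ ρ (suc j) l (v ∘ Fin.suc))

    -- Turns a choice of words back into a schedule whose free edges spell it.
    selection-labels : ∀ labels rs (v : Variables (total rs) n N) x {u} → Selection (groups labels rs v) u →
      ∃ λ ls → VecAll.All (_∈ labels) ls × frees v x (schedule rs ls) ≡ u
    selection-labels labels []       v x []         = [] , VecAll.[] , refl
    selection-labels labels (r ∷ rs) v x (_∷_ {u = u} w∈ sel) with ∈-map⁻ (λ l → run r 0 l (v ∘ Fin.suc)) w∈
    ... | l , l∈ , refl with selection-labels labels rs (v ∘ Fin.suc ∘ (r ↑ʳ_)) x sel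
    ...   | ls , ls∈ , refl = l ∷ ls , l∈ VecAll.∷ ls∈ , frees-steps rs ls x r 0 l (v ∘ Fin.suc)

    #jumps : ∀ {d} → Vec (Step n) d → ℕ
    #jumps []           = 0
    #jumps (jump y ∷ s) = suc (#jumps s)
    #jumps (free y ∷ s) = #jumps s

    length-jumps : ∀ {d} (v : Variables d n N) x s → length (jumps v x s) ≡ #jumps s
    length-jumps v x []           = refl
    length-jumps v x (jump y ∷ s) = cong suc (length-jumps (v ∘ Fin.suc) y s)
    length-jumps v x (free y ∷ s) = length-jumps (v ∘ Fin.suc) y s

    #jumps-steps : ∀ {d} ρ j l (s : Vec (Step n) d) → #jumps (steps ρ j l s) ≡ #jumps s
    #jumps-steps zero    j l s = refl
    #jumps-steps (suc ρ) j l s = #jumps-steps ρ (suc j) l s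

    #jumps-schedule : ∀ rs ls → #jumps (schedule rs ls) ≡ length rs
    #jumps-schedule []       []       = refl
    #jumps-schedule (r ∷ rs) (l ∷ ls) = cong suc (trans (#jumps-steps r 0 l (schedule rs ls)) (#jumps-schedule rs ls))

    module Bounded (R B : ℕ) (RB<n : R * B < n) where

      Small : Label → Set
      Small (u , w) = u ≤ B × w ≤ B

      node-bound : ∀ ρ j {u w} → ρ + j ≤ R → Small (u , w) → ρ * u + j * w < n
      node-bound ρ j {u} {w} ρ+j≤R (u≤B , w≤B) = ≤-<-trans (≤-trans (+-mono-≤ (*-monoʳ-≤ ρ u≤B) (*-monoʳ-≤ j w≤B))
        (≤-trans (≤-reflexive (sym (*-distribʳ-+ B ρ j))) (*-monoˡ-≤ B ρ+j≤R))) RB<n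

      toℕ-node′ : ∀ ρ j {u w} → ρ + j ≤ R → Small (u , w) → toℕ (node ρ j (u , w)) ≡ ρ * u + j * w
      toℕ-node′ ρ j ≤R sm = toℕ-node ρ j _ _ (node-bound ρ j ≤R sm)

      steps-straight : ∀ {d} {s : Vec (Step n) d} → (∀ δ x → Straight δ x s) → ∀ ρ j {u w} → ρ + j ≤ R → Small (u , w) →
        Straight (ℤ.+ w ℤ.- ℤ.+ u) (node ρ j (u , w)) (steps ρ j (u , w) s)
      steps-straight st zero    j ≤R sm = st _ _
      steps-straight st (suc ρ) j {u} {w} ≤R sm = free advance (steps-straight st ρ (suc j) ≤R′ sm)
        where
        ≤R′ : ρ + suc j ≤ R
        ≤R′ = subst (_≤ R) (sym (+-suc ρ j)) ≤R
        a = ρ * u + suc j * w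
        b = suc ρ * u + j * w
        a+u≡b+w : a + u ≡ b + w
        a+u≡b+w = solve 4 (λ ρ j u w → (ρ :* u :+ (con 1 :+ j) :* w) :+ u := ((con 1 :+ ρ) :* u :+ j :* w) :+ w) refl ρ j u w
          where open +-*-Solver
        advance : ℤ.+ toℕ (node ρ (suc j) (u , w)) ≡ ℤ.+ toℕ (node (suc ρ) j (u , w)) ℤ.+ (ℤ.+ w ℤ.- ℤ.+ u)
        advance = trans (cong ℤ.+_ (toℕ-node′ ρ (suc j) ≤R′ sm))
          (trans (trans (solve 2 (λ a u → a := a :+ u :- u) refl (ℤ.+ a) (ℤ.+ u))
            (trans (cong (ℤ._- ℤ.+ u) (trans (sym (ℤ.pos-+ a u)) (trans (cong ℤ.+_ a+u≡b+w) (ℤ.pos-+ b w))))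
              (solve 3 (λ b w u → b :+ w :- u := b :+ (w :- u)) refl (ℤ.+ b) (ℤ.+ w) (ℤ.+ u))))
          (cong (λ x → ℤ.+ x ℤ.+ (ℤ.+ w ℤ.- ℤ.+ u)) (sym (toℕ-node′ (suc ρ) j ≤R sm))))
          where open Data.Integer.Solver.+-*-Solver

      schedule-straight : ∀ rs ls → All (_≤ R) rs → VecAll.All Small ls → ∀ δ x → Straight δ x (schedule rs ls)
      schedule-straight []       []       []         _                δ x = []
      schedule-straight (r ∷ rs) (l ∷ ls) (r≤R ∷ h) (sm VecAll.∷ sms) δ x =
        jump (steps-straight (schedule-straight rs ls h sms) r 0 (subst (_≤ R) (sym (+-identityʳ r)) r≤R) sm)

      -- Two consecutive points give the slope, so w - u = w′ - u′. Then u < u′ would imply w < w′,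
      -- and the first points would differ.
      line-injective : ∀ ρ j {u w u′ w′} → suc ρ * u + j * w ≡ suc ρ * u′ + j * w′ → ρ * u + suc j * w ≡ ρ * u′ + suc j * w′ → u ≡ u′ × w ≡ w′
      line-injective ρ j {u} {w} {u′} {w′} eq₁ eq₂ = compare (<-cmp u u′)
        where
        open +-*-Solver
        w+u′≡w′+u : w + u′ ≡ w′ + u
        w+u′≡w′+u = +-cancelˡ-≡ (suc ρ * u + j * w + (ρ * u′ + suc j * w′)) _ _ (trans
          (solve 6 (λ ρ j u w u′ w′ → ((con 1 :+ ρ) :* u :+ j :* w :+ (ρ :* u′ :+ (con 1 :+ j) :* w′)) :+ (w :+ u′)
            := ((con 1 :+ ρ) :* u′ :+ j :* w′ :+ (ρ :* u :+ (con 1 :+ j) :* w)) :+ (w′ :+ u)) refl ρ j u w u′ w′)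
          (cong (_+ (w′ + u)) (cong₂ _+_ (sym eq₁) eq₂)))
        apart : ∀ {a b c d} → a < c → b < d → suc ρ * a + j * b ≢ suc ρ * c + j * d
        apart a<c b<d = <⇒≢ (+-mono-<-≤ (*-monoʳ-< (suc ρ) a<c) (*-monoʳ-≤ j (<⇒≤ b<d)))
        compare : _ → u ≡ u′ × w ≡ w′
        compare (tri≈ _ refl _) = refl , +-cancelʳ-≡ u w w′ w+u′≡w′+u
        compare (tri< u<u′ _ _) = contradiction eq₁ (apart u<u′ (+-cancelʳ-< u′ w w′ (subst (_< w′ + u′) (sym w+u′≡w′+u) (+-monoʳ-< w′ u<u′))))
        compare (tri> _ _ u′<u) = contradiction (sym eq₁) (apart u′<u (+-cancelʳ-< u w′ w (subst (_< w + u) w+u′≡w′+u (+-monoʳ-< w u′<u))))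

      run-∈ : ∀ {d} ρ j l (v : Variables (ρ + d) n N) {x} → x ∈ run ρ j l v → ∃ λ (t : Fin ρ) → ∃ λ a → ∃ λ b → x ≡ v (t ↑ˡ d) a b
      run-∈ (suc ρ) j l v (here refl) = Fin.zero , _ , _ , refl
      run-∈ (suc ρ) j l v (there x∈) with run-∈ ρ (suc j) l (v ∘ Fin.suc) x∈
      ... | t , a , b , eq = Fin.suc t , a , b , eq

      groups-∈ : ∀ labels rs (v : Variables (total rs) n N) {C w x} → C ∈ groups labels rs v → w ∈ C → x ∈ w → ∃ λ t → ∃ λ a → ∃ λ b → x ≡ v t a b
      groups-∈ labels (r ∷ rs) v (here refl) w∈ x∈ with ∈-map⁻ (λ l → run r 0 l (v ∘ Fin.suc)) w∈
      ... | l , _ , refl with run-∈ r 0 l (v ∘ Fin.suc) x∈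
      ...   | t , a , b , eq = Fin.suc (t ↑ˡ total rs) , a , b , eq
      groups-∈ labels (r ∷ rs) v (there C∈) w∈ x∈ with groups-∈ labels rs (v ∘ Fin.suc ∘ (r ↑ʳ_)) C∈ w∈ x∈
      ... | t , a , b , eq = Fin.suc (r ↑ʳ t) , a , b , eq

      first∉run : ∀ {d} {v : Variables (suc d) n N} → Injective v → ∀ {ρ d′} j l (v′ : Variables (ρ + d′) n N) (f : Fin (ρ + d′) → Fin d) →
        (∀ t a b → v′ t a b ≡ v (Fin.suc (f t)) a b) → ∀ {a b} → v Fin.zero a b ∉ run ρ j l v′
      first∉run inj {ρ} j l v′ f h x∈ with run-∈ ρ j l v′ x∈
      ... | t , a′ , b′ , eq with proj₁ (inj (trans eq (h (t ↑ˡ _) a′ b′)))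
      ...   | ()

      run-disjoint : ∀ {d} ρ j {u w u′ w′} (v : Variables (ρ + d) n N) → Injective v → ρ + j ≤ R → Small (u , w) → Small (u′ , w′) →
        (u , w) ≢ (u′ , w′) → Disjoint (run ρ j (u , w) v) (run ρ j (u′ , w′) v)
      run-disjoint (suc ρ) j {u} {w} {u′} {w′} v inj ≤R sm sm′ l≢l′ (here refl) (here eq) = l≢l′ (labels≡ (inj eq))
        where
        ≤R′ : ρ + suc j ≤ R
        ≤R′ = subst (_≤ R) (sym (+-suc ρ j)) ≤R
        labels≡ : _ × node (suc ρ) j (u , w) ≡ node (suc ρ) j (u′ , w′) × node ρ (suc j) (u , w) ≡ node ρ (suc j) (u′ , w′) → (u , w) ≡ (u′ , w′)
        labels≡ (_ , eq₁ , eq₂) =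
          let (u≡ , w≡) = line-injective ρ j
                (trans (sym (toℕ-node′ (suc ρ) j ≤R sm)) (trans (cong toℕ eq₁) (toℕ-node′ (suc ρ) j ≤R sm′)))
                (trans (sym (toℕ-node′ ρ (suc j) ≤R′ sm)) (trans (cong toℕ eq₂) (toℕ-node′ ρ (suc j) ≤R′ sm′)))
          in cong₂ _,_ u≡ w≡
      run-disjoint (suc ρ) j v inj ≤R sm sm′ l≢l′ (here refl) (there x∈′) = first∉run inj {ρ} (suc j) _ (v ∘ Fin.suc) (λ t → t) (λ _ _ _ → refl) x∈′
      run-disjoint (suc ρ) j v inj ≤R sm sm′ l≢l′ (there x∈) (here refl) = first∉run inj {ρ} (suc j) _ (v ∘ Fin.suc) (λ t → t) (λ _ _ _ → refl) x∈
      run-disjoint (suc ρ) j v inj ≤R sm sm′ l≢l′ (there x∈) (there x∈′) =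
        run-disjoint ρ (suc j) (v ∘ Fin.suc) (Injective-suc inj) (subst (_≤ R) (sym (+-suc ρ j)) ≤R) sm sm′ l≢l′ x∈ x∈′

      -- Within a family a common variable would be a common edge at the same time and thus force
      -- equal labels; different families use different matrices.
      groups-independent : ∀ {labels} → Unique labels → All Small labels → ∀ rs (v : Variables (total rs) n N) → Injective v → All (_≤ R) rs →
        Independent (groups labels rs v)
      groups-independent unique small []       v inj []        = []
      groups-independent {labels} unique small (r ∷ rs) v inj (r≤R ∷ h) = (within unique small , across) ∷
        groups-independent unique small rs (v ∘ Fin.suc ∘ (r ↑ʳ_)) (Injective-∘ (r ↑ʳ_) (Fin.↑ʳ-injective r _ _) (Injective-suc inj)) h
        where
        r≤R′ : r + 0 ≤ R
        r≤R′ = subst (_≤ R) (sym (+-identityʳ r)) r≤R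
        within : ∀ {ls} → Unique ls → All Small ls → AllPairs Disjoint (map (λ l → run r 0 l (v ∘ Fin.suc)) ls)
        within []       []         = []
        within (l∉ ∷ u) (sm ∷ sms) = All.map⁺ (All.zipWith (λ p {x} → run-disjoint r 0 (v ∘ Fin.suc) (Injective-suc inj) r≤R′ sm (proj₂ p) (proj₁ p) {x}) (l∉ , sms)) ∷ within u sms
        across : ∀ {w C′ w′} → w ∈ map (λ l → run r 0 l (v ∘ Fin.suc)) labels → C′ ∈ groups labels rs (v ∘ Fin.suc ∘ (r ↑ʳ_)) → w′ ∈ C′ → Disjoint w w′
        across w∈ C′∈ w′∈ x∈w x∈w′ with ∈-map⁻ (λ l → run r 0 l (v ∘ Fin.suc)) w∈ | groups-∈ labels rs (v ∘ Fin.suc ∘ (r ↑ʳ_)) C′∈ w′∈ x∈w′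
        ... | l , _ , refl | t′ , a′ , b′ , eq′ with run-∈ r 0 l (v ∘ Fin.suc) x∈w
        ...   | t , a , b , eq = <⇒≢ (<-≤-trans (Fin.toℕ<n t) (m≤m+n r (toℕ t′)))
              (trans (sym (Fin.toℕ-↑ˡ t (total rs))) (trans (cong toℕ (Fin.suc-injective (proj₁ (inj (trans (sym eq) eq′))))) (Fin.toℕ-↑ʳ r t′)))

    groups-length : ∀ labels rs (v : Variables (total rs) n N) → length (groups labels rs v) ≡ length rs
    groups-length labels []       v = refl
    groups-length labels (r ∷ rs) v = cong suc (groups-length labels rs (v ∘ Fin.suc ∘ (r ↑ʳ_)))

    groups-lengths : ∀ labels rs (v : Variables (total rs) n N) → All (λ C → length C ≡ length labels) (groups labels rs v)
    groups-lengths labels []       v = []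
    groups-lengths labels (r ∷ rs) v = List.length-map (λ l → run r 0 l (v ∘ Fin.suc)) labels ∷ groups-lengths labels rs (v ∘ Fin.suc ∘ (r ↑ʳ_))

    groups-words : ∀ {p} {P : ℕ → Set p} labels rs (v : Variables (total rs) n N) → All P rs → All (All (λ w → P (length w))) (groups labels rs v)
    groups-words         labels []       v []       = []
    groups-words {P = P} labels (r ∷ rs) v (Pr ∷ h) =
      All.map⁺ (All.universal (λ l → subst P (sym (length-run r 0 l (v ∘ Fin.suc))) Pr) labels) ∷ groups-words labels rs (v ∘ Fin.suc ∘ (r ↑ʳ_)) h

    selection-length : ∀ labels rs (v : Variables (total rs) n N) {u} → Selection (groups labels rs v) u → length u ≡ sum rs
    selection-length labels []       v []        = refl
    selection-length labels (r ∷ rs) v (_∷_ {w} w∈ sel) with ∈-map⁻ (λ l → run r 0 l (v ∘ Fin.suc)) w∈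
    ... | l , _ , refl = trans (List.length-++ (run r 0 l (v ∘ Fin.suc))) (cong₂ _+_ (length-run r 0 l (v ∘ Fin.suc)) (selection-length labels rs (v ∘ Fin.suc ∘ (r ↑ʳ_)) sel))

open Walks

-- The support of the iterated matrix product and of its derivatives.

imm-variables : ∀ m n → Variables m n (m ℕ.* (n ℕ.* n))
imm-variables m n t i j = combine t (combine i j)

imm-variables-injective : ∀ m n → Injective (imm-variables m n)
imm-variables-injective m n {t} {a} {b} {t′} {a′} {b′} eq =
  let (t≡ , ab≡) = Fin.combine-injective t (combine a b) t′ (combine a′ b′) eq
  in t≡ , Fin.combine-injective a b a′ b′ ab≡

ClosedWalk : ∀ m n → Vec ℕ (m ℕ.* (n ℕ.* n)) → Set
ClosedWalk m n α = ∃ λ i → Walk m (imm-variables m n) i i α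

module Supports {c ℓ} (R : CommutativeRing c ℓ) where
  open CommutativeRing R hiding (zero)
    renaming (refl to ≈-refl; sym to ≈-sym; trans to ≈-trans)
  open Algebra.Definitions.RawMonoid +-rawMonoid using () renaming (_×_ to _×ᵣ_)
  open Algebra.Properties.CommutativeMonoid.Sum +-commutativeMonoid using (sum)
  open Algebra.Properties.Monoid.Mult +-monoid using (×-congʳ; ×-homo-+; ×-homo-1; ×-assocˡ)
  open Polynomials R using (S; coeff; var; sumₛ; matrixProduct; IMM)
  open Operators R
  open Substitution R

  private variable
    d n N : ℕ

  -- Positive integer coefficients rule out cancellation in sums and derivatives, so supports can be
  -- computed as sets. The disjunction also decides Q.
  Supported : Series N → (Vec ℕ N → Set) → Set ℓ
  Supported f Q = ∀ α → (∃ λ n → f α ≈ suc n ×ᵣ 1# × Q α) ⊎ (f α ≈ 0# × ¬ Q α)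

  Supported-≋ : ∀ {f g : Series N} {Q} → f ≋ g → Supported f Q → Supported g Q
  Supported-≋ f≋g h α with h α
  ... | inj₁ (n , eq , q) = inj₁ (n , ≈-trans (≈-sym (f≋g α)) eq , q)
  ... | inj₂ (eq , ¬q)    = inj₂ (≈-trans (≈-sym (f≋g α)) eq , ¬q)

  Supported-sum : ∀ {k} {f : Fin k → Series N} {Q : Fin k → Vec ℕ N → Set} → (∀ i → Supported (f i) (Q i)) →
                  Supported (λ α → sum λ i → f i α) (λ α → ∃ λ i → Q i α)
  Supported-sum {k = zero}  h α = inj₂ (≈-refl , λ ())
  Supported-sum {k = suc k} {f} {Q} h α with h Fin.zero α | Supported-sum {k = k} {f ∘ Fin.suc} {Q ∘ Fin.suc} (h ∘ Fin.suc) α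
  ... | inj₁ (a , eq , q) | inj₁ (b , eq′ , _)       = inj₁ (a ℕ.+ suc b , ≈-trans (+-cong eq eq′) (≈-sym (×-homo-+ 1# (suc a) (suc b))) , Fin.zero , q)
  ... | inj₁ (a , eq , q) | inj₂ (eq′ , _)           = inj₁ (a , ≈-trans (+-cong eq eq′) (+-identityʳ _) , Fin.zero , q)
  ... | inj₂ (eq , _)     | inj₁ (b , eq′ , i , q)   = inj₁ (b , ≈-trans (+-cong eq eq′) (+-identityˡ _) , Fin.suc i , q)
  ... | inj₂ (eq , ¬q)    | inj₂ (eq′ , ¬qs)         = inj₂ (≈-trans (+-cong eq eq′) (+-identityˡ 0#) ,
          λ { (Fin.zero , q) → ¬q q ; (Fin.suc i , q) → ¬qs (i , q) })

  Supported-shift : ∀ (v : Fin N) {f Q} → Supported f Q → Supported (shift v f) (λ α → ∃ λ β → α ≡ inc v β × Q β)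
  Supported-shift v {f} h α with uninc v α
  ... | inj₁ ≡0 = inj₂ (reflexive (shift-∤ v f α ≡0) , λ { (β , refl , _) → inc≢0 v {β} ≡0 })
  ... | inj₂ (β , refl) with h β
  ...   | inj₁ (n , eq , q) = inj₁ (n , ≈-trans (reflexive (shift-inc v f β)) eq , β , refl , q)
  ...   | inj₂ (eq , ¬q)    = inj₂ (≈-trans (reflexive (shift-inc v f β)) eq , λ { (β′ , eq′ , q) → ¬q (subst _ (sym (inc-injective v eq′)) q) })

  Supported-shifts : ∀ (w : List (Fin N)) {f Q} → Supported f Q → Supported (shifts w f) (λ α → ∃ λ β → α ≡ incs w β × Q β)
  Supported-shifts w {f} h α with w ∣ᵐ? α
  ... | no w∤α = inj₂ (shifts-∤ w f α w∤α , λ { (β , eq , _) → w∤α (β , eq) })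
  ... | yes (β , refl) with h β
  ...   | inj₁ (n , eq , q) = inj₁ (n , ≈-trans (reflexive (shifts-incs w f β)) eq , β , refl , q)
  ...   | inj₂ (eq , ¬q)    = inj₂ (≈-trans (reflexive (shifts-incs w f β)) eq , λ { (β′ , eq′ , q) → ¬q (subst _ (sym (incs-injective w eq′)) q) })

  Supported-pd : ∀ (v : Fin N) {f Q} → Supported f Q → Supported (pd v f) (Q ∘ inc v)
  Supported-pd v {f} h γ with h (inc v γ)
  ... | inj₁ (n , eq , q) = inj₁ (n ℕ.+ lookup γ v ℕ.* suc n , ≈-trans (×-congʳ (suc (lookup γ v)) eq) (×-assocˡ 1# (suc (lookup γ v)) (suc n)) , q)
  ... | inj₂ (eq , ¬q)    = inj₂ (≈-trans (×-congʳ (suc (lookup γ v)) eq) (×-zero (suc (lookup γ v))) , ¬q)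

  Supported-pds : ∀ (w : List (Fin N)) {f Q} → Supported f Q → Supported (pds (Vec.fromList w) f) (Q ∘ incs w)
  Supported-pds []      h = h
  Supported-pds (v ∷ w) h = Supported-pds w (Supported-pd v h)

  coeff-sumₛ : ∀ {k} (f : Fin k → S d N) α → coeff (sumₛ f) α ≈ sum λ i → coeff (f i) α
  coeff-sumₛ {k = zero}  f α = ≈-refl
  coeff-sumₛ {k = suc k} f α = +-congˡ (coeff-sumₛ (f ∘ Fin.suc) α)

  matrixProduct-supported : ∀ d (v : Variables d n N) i j →
    Supported (coeff (matrixProduct (λ t i j → var (v t i j)) i j)) (Walk d v i j)
  matrixProduct-supported {N = N} zero v i j α with i Fin.≟ j
  ... | no i≢j = inj₂ (≈-refl , i≢j ∘ proj₁)
  ... | yes i≡j with Vec.≡-dec ℕ._≟_ (replicate N 0) α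
  ...   | yes eq = inj₁ (0 , ≈-sym (×-homo-1 1#) , i≡j , sym eq)
  ...   | no ≢   = inj₂ (≈-refl , ≢ ∘ sym ∘ proj₂)
  matrixProduct-supported {n = n} {N} (suc d) v i j = Supported-≋ (λ α → ≈-sym (coeff-sumₛ {k = n} _ α))
    (Supported-sum λ k → Supported-≋ (λ α → ≈-sym (convolve-mono [ v Fin.zero i k ] (rest k) α))
      (Supported-shift (v Fin.zero i k) (matrixProduct-supported d (v ∘ Fin.suc) k j)))
    where
    rest : Fin n → Series N
    rest k = coeff (matrixProduct (λ t i j → var (v (Fin.suc t) i j)) k j)

  IMM-supported : ∀ m n → Supported (coeff (IMM m n)) (ClosedWalk m n)
  IMM-supported m n = Supported-≋ (λ α → ≈-sym (coeff-sumₛ {k = n} (λ i → matrixProduct (λ t i j → var (imm-variables m n t i j)) i i) α))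
    (Supported-sum λ i → matrixProduct-supported m (imm-variables m n) i i)

-- Leading monomials of shifted partials.

module LowerBound {c ℓ} (R : CommutativeRing c ℓ)
    (domain : NoZeroDivisors R) (char0 : CharacteristicZero R) where
  open CommutativeRing R hiding (zero)
    renaming (refl to ≈-refl; sym to ≈-sym; trans to ≈-trans)
  open Algebra.Definitions.RawMonoid +-rawMonoid using () renaming (_×_ to _×ᵣ_)
  open Polynomials R using (S; coeff; _·_; Operator; _⟨_⟩; ShiftedPartials; monomial; IMM)
  open Operators R
  open Substitution R
  open Supports R
  open Bounds R domain char0 using (Leading)

  -- The form is β times the derivative along w. Its support consists of the β γ for which w γ is a
  -- closed walk, and multiplication by β preserves the strict minimality of u.
  leading-partial : ∀ m n {e τ} (ω : Fin (m ℕ.* (n ℕ.* n)) → ℕ) (w u : List (Fin (m ℕ.* (n ℕ.* n)))) → length w ≡ e →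
    ClosedWalk m n (incs w (incs u (replicate _ 0))) →
    (∀ {γ} → ClosedWalk m n (incs w γ) → γ ≡ incs u (replicate _ 0) ⊎ energy ω (incs u (replicate _ 0)) ℕ.< energy ω γ) →
    ∀ β → Vec.sum β ≡ τ → ∃ λ f → ShiftedPartials e τ (IMM m n) f × Leading (energy ω) (incs u β) f
  leading-partial m n {τ = τ} ω w u refl walk minimal β ≡τ =
    f , (1 , (λ _ → 1#) , (λ _ → f) , (λ _ → D , q , λ _ → ≈-refl) , λ γ → ≈-sym (≈-trans (+-identityʳ _) (*-identityˡ _))) , top , others
    where
    N = m ℕ.* (n ℕ.* n)
    D : Operator (length w) N
    D = (1# , Vec.fromList w) ∷ []
    q : S τ N
    q = monomial β ≡τ
    f = q · D ⟨ IMM m n ⟩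
    w′ = proj₁ (word β)
    β≡ : β ≡ incs w′ (replicate N 0)
    β≡ = proj₁ (proj₂ (word β))
    f≋ : coeff f ≋ shifts w′ (pds (Vec.fromList w) (coeff (IMM m n)))
    f≋ γ = ≈-trans (≋-cong (convolve-linear (coeff (D ⟨ IMM m n ⟩))) (λ α → reflexive (cong (λ β → mono β α) β≡)) γ)
      (≈-trans (convolve-mono w′ (coeff (D ⟨ IMM m n ⟩)) γ)
        (≋-cong (shifts-linear w′) (λ α → ≈-trans (+-identityʳ _) (≈-trans (*-identityˡ _) (coeff-∂* (Vec.fromList w) (IMM m n) α))) γ))
    supported : Supported (coeff f) (λ α → ∃ λ γ → α ≡ incs w′ γ × ClosedWalk m n (incs w γ))
    supported = Supported-≋ (λ γ → ≈-sym (f≋ γ)) (Supported-shifts w′ (Supported-pds w (IMM-supported m n)))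
    κ≡ : incs u β ≡ incs w′ (incs u (replicate N 0))
    κ≡ = trans (cong (incs u) β≡) (incs-comm u w′ (replicate N 0))
    top : ∃ λ k → coeff f (incs u β) ≈ suc k ×ᵣ 1#
    top with supported (incs u β)
    ... | inj₁ (k , eq , _) = k , eq
    ... | inj₂ (_ , none)   = contradiction (incs u (replicate N 0) , κ≡ , walk) none
    others : ∀ γ → coeff f γ ≈ 0# ⊎ (γ ≡ incs u β ⊎ energy ω (incs u β) ℕ.< energy ω γ)
    others γ with supported γ
    ... | inj₂ (eq , _) = inj₁ eq
    ... | inj₁ (_ , _ , γ′ , refl , walk′) with minimal walk′
    ...   | inj₁ refl = inj₂ (inj₁ (sym κ≡))
    ...   | inj₂ lt   = inj₂ (inj₂ (subst (λ κ → energy ω κ ℕ.< energy ω (incs w′ γ′)) (sym κ≡) (energy-incs-< ω w′ lt)))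

-- Choice of run lengths, labels and constants.

module Schedules where
  open import Data.Nat.Base
    using (_+_; _*_; _^_; _⊓_; _/_; _%_; _≤_; _<_; z≤n; s≤s; s≤s⁻¹; NonZero)
  open import Data.Nat.Properties
  open import Data.Nat.Solver using (module +-*-Solver)
  open +-*-Solver using (solve; _:=_; _:+_; _:*_; con)
  open import Data.Nat.DivMod using (m/n*n≤m; m/n≤m; m≡m%n+[m/n]*n; m%n<n; m≥n⇒m/n>0; n/1≡n)
  open import Data.Nat.ListAction using (sum)

  -- Greedy, so that the runs of full length s come first and `take` selects their families.
  runLengths : ℕ → ℕ → ℕ → List ℕ
  runLengths zero    s k = []
  runLengths (suc e) s k = k ⊓ s ∷ runLengths e s (k ∸ s)

  length-runLengths : ∀ e s k → length (runLengths e s k) ≡ e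
  length-runLengths zero    s k = refl
  length-runLengths (suc e) s k = cong suc (length-runLengths e s (k ∸ s))

  sum-runLengths : ∀ e s k → k ≤ e * s → sum (runLengths e s k) ≡ k
  sum-runLengths zero    s k z≤n = refl
  sum-runLengths (suc e) s k k≤ = trans (cong (k ⊓ s +_) (sum-runLengths e s (k ∸ s) (m≤n+o⇒m∸n≤o k s k≤)))
    (trans (cong (_+ (k ∸ s)) (⊓-comm k s)) (m⊓n+n∸m≡n s k))

  runLengths-≤ : ∀ e s k → All (_≤ s) (runLengths e s k)
  runLengths-≤ zero    s k = []
  runLengths-≤ (suc e) s k = m⊓n≤n k s ∷ runLengths-≤ e s (k ∸ s)

  runLengths-≡ : ∀ g e s k → g * s ≤ k → All (_≡ s) (take g (runLengths e s k))
  runLengths-≡ zero    e       s k _  = []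
  runLengths-≡ (suc g) zero    s k _  = []
  runLengths-≡ (suc g) (suc e) s k h = m≥n⇒m⊓n≡n (≤-trans (m≤m+n s (g * s)) h) ∷
    runLengths-≡ g e s (k ∸ s) (m+n≤o⇒m≤o∸n (g * s) (≤-trans (≤-reflexive (+-comm (g * s) s)) h))

  edge : ∀ m n → Fin (m * (n * n)) → Fin n × Fin n
  edge m n x = remQuot {n} n (proj₂ (remQuot {m} (n * n) x))

  edge-≡ : ∀ m n t a b → edge m n (imm-variables m n t a b) ≡ (a , b)
  edge-≡ m n t a b = trans (cong (remQuot {n} n ∘ proj₂) (Fin.remQuot-combine {m} {n * n} t (combine a b))) (Fin.remQuot-combine {n} {n} a b)

  step-weight : ∀ m n → Fin (m * (n * n)) → ℕ
  step-weight m n x = let (a , b) = edge m n x in square (pos a ℤ.- pos b)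

  step-weight-≡ : ∀ m n t a b → step-weight m n (imm-variables m n t a b) ≡ square (pos a ℤ.- pos b)
  step-weight-≡ m n t a b = cong (λ (a , b) → square (pos a ℤ.- pos b)) (edge-≡ m n t a b)

  -- For e = 0 no edge is prescribed, and all constant walks tie at `step-weight` 0. This weight
  -- singles out the constant walk at node 0.
  node-weight : ∀ m n → Fin (m * (n * n)) → ℕ
  node-weight m n x = let (a , b) = edge m n x in toℕ a + toℕ b

  node-weight-≡ : ∀ m n t a b → node-weight m n (imm-variables m n t a b) ≡ toℕ a + toℕ b
  node-weight-≡ m n t a b = cong (λ (a , b) → toℕ a + toℕ b) (edge-≡ m n t a b)

  zero-walk : ∀ {n N} d → Variables d (suc n) N → List (Fin N)
  zero-walk d v = frees v Fin.zero (Vec.replicate d (free Fin.zero))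

  zero-walk-walk : ∀ {n N} d (v : Variables d (suc n) N) → Walk d v Fin.zero Fin.zero (incs (zero-walk d v) (replicate N 0))
  zero-walk-walk zero    v = refl , refl
  zero-walk-walk (suc d) v = Fin.zero , _ , refl , zero-walk-walk d (v ∘ Fin.suc)

  zero-walk-energy : ∀ {n N} d (v : Variables d (suc n) N) ω → (∀ t a b → ω (v t a b) ≡ toℕ a + toℕ b) →
    energy ω (incs (zero-walk d v) (replicate N 0)) ≡ 0
  zero-walk-energy zero    v ω ω≡ = energy-0 ω
  zero-walk-energy {N = N} (suc d) v ω ω≡ = trans (energy-inc ω (v Fin.zero Fin.zero Fin.zero) (incs (zero-walk d (v ∘ Fin.suc)) (replicate N 0)))
    (cong₂ _+_ (ω≡ Fin.zero Fin.zero Fin.zero) (zero-walk-energy d (v ∘ Fin.suc) ω (ω≡ ∘ Fin.suc)))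

  zero-walk-unique : ∀ {n N} d (v : Variables d (suc n) N) ω → (∀ t a b → ω (v t a b) ≡ toℕ a + toℕ b) →
    ∀ {i j γ} → i ≡ Fin.zero ⊎ 0 < d → Walk d v i j γ → energy ω γ ≡ 0 → γ ≡ incs (zero-walk d v) (replicate N 0)
  zero-walk-unique zero    v ω ω≡ _ (_ , refl) _ = refl
  zero-walk-unique (suc d) v ω ω≡ {i} _ (k , β , refl , walk) E≡0 = cong₂ inc (cong₂ (v Fin.zero) i≡0 k≡0)
    (zero-walk-unique d (v ∘ Fin.suc) ω (ω≡ ∘ Fin.suc) (inj₁ k≡0) walk (m+n≡0⇒n≡0 (ω (v Fin.zero i k)) E≡0′))
    where
    E≡0′ : ω (v Fin.zero i k) + energy ω β ≡ 0
    E≡0′ = trans (sym (energy-inc ω (v Fin.zero i k) β)) E≡0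
    edge≡0 : toℕ i + toℕ k ≡ 0
    edge≡0 = trans (sym (ω≡ Fin.zero i k)) (m+n≡0⇒m≡0 (ω (v Fin.zero i k)) E≡0′)
    i≡0 : i ≡ Fin.zero
    i≡0 = Fin.toℕ-injective (m+n≡0⇒m≡0 (toℕ i) edge≡0)
    k≡0 : k ≡ Fin.zero
    k≡0 = Fin.toℕ-injective (m+n≡0⇒n≡0 (toℕ i) edge≡0)

  gridLabels : ℕ → ℕ → List Label
  gridLabels B l = take l (cartesianProduct (upTo (suc B)) (upTo (suc B)))

  length-gridLabels : ∀ B l → l ≤ suc B * suc B → length (gridLabels B l) ≡ l
  length-gridLabels B l l≤ = trans (List.length-take l _) (m≤n⇒m⊓n≡m (≤-trans l≤ (≤-reflexive
    (sym (trans (length-product _,_ (upTo (suc B)) (upTo (suc B))) (cong₂ _*_ (List.length-upTo (suc B)) (List.length-upTo (suc B))))))))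

  gridLabels-unique : ∀ B l → Unique (gridLabels B l)
  gridLabels-unique B l = Unique.take⁺ l (Unique.cartesianProduct⁺ (Unique.upTo⁺ (suc B)) (Unique.upTo⁺ (suc B)))

  gridLabels-small : ∀ B l → All (λ (u , w) → u ≤ B × w ≤ B) (gridLabels B l)
  gridLabels-small B l = All.take⁺ l (All.tabulate λ x∈ → let (u∈ , w∈) = ∈-cartesianProduct⁻ (upTo (suc B)) (upTo (suc B)) x∈ in
    s≤s⁻¹ (∈-upTo⁻ u∈) , s≤s⁻¹ (∈-upTo⁻ w∈))

  H-degree-0 : ∀ M → H M 0 ≡ 1
  H-degree-0 zero    = refl
  H-degree-0 (suc M) = H-degree-0 M

  -- The growth factor (k + M + 1)/(k + 1) of `H (suc M)` is at most M + 1.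
  H≤^ : ∀ M k → H (suc M) k ≤ suc M ^ k
  H≤^ M zero    = ≤-reflexive (H-degree-0 M)
  H≤^ M (suc k) = *-cancelˡ-≤ (suc k) (begin
    suc k * H (suc M) (suc k)         ≡⟨ H-suc-degree (suc M) k ⟩
    (k + suc M) * H (suc M) k         ≤⟨ *-mono-≤ {k + suc M} {suc k * suc M} (≤-trans (m≤m+n (k + suc M) (k * M))
                                           (≤-reflexive (solve 2 (λ k M → k :+ (con 1 :+ M) :+ k :* M := (con 1 :+ k) :* (con 1 :+ M)) refl k M))) (H≤^ M k) ⟩
    suc k * suc M * suc M ^ k         ≡⟨ *-assoc (suc k) (suc M) _ ⟩
    suc k * (suc M * suc M ^ k)       ∎)
    where open ≤-Reasoning

  n≤2^n : ∀ n → n ≤ 2 ^ n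
  n≤2^n zero    = z≤n
  n≤2^n (suc n) = +-mono-≤ (m^n>0 2 n) (≤-trans (n≤2^n n) (≤-reflexive (sym (+-identityʳ (2 ^ n)))))

  -- s = ⌈k/e⌉ and g = ⌊k/s⌋, so that all full blocks have the same length and 2g ≥ e if s > 1.
  record Blocks (M e k : ℕ) : Set where
    field
      s g        : ℕ
      0<s        : 0 < s
      0<g        : 0 < g
      gs≤k       : g * s ≤ k
      k≤es       : k ≤ e * s
      generators : e ≤ 2 * g ⊎ H M k ≤ M ^ (2 * g)

  blocks : ∀ M e k → 0 < M → 0 < e → 0 < k → Blocks M e k
  blocks (suc M) (suc e) (suc k) _ _ _ = record
    { s = s ; g = suc k / s ; 0<s = s≤s z≤n
    ; 0<g = m≥n⇒m/n>0 {suc k} {s} (s≤s (m/n≤m k (suc e)))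
    ; gs≤k = m/n*n≤m (suc k) s
    ; k≤es = k≤es
    ; generators = by (k / suc e) refl
    }
    where
    s = suc (k / suc e)
    k≤es : suc k ≤ suc e * s
    k≤es = begin
      suc k                                   ≡⟨ cong suc (m≡m%n+[m/n]*n k (suc e)) ⟩
      suc (k % suc e) + k / suc e * suc e     ≤⟨ +-monoˡ-≤ _ (m%n<n k (suc e)) ⟩
      suc e + k / suc e * suc e               ≡⟨ *-comm s (suc e) ⟩
      suc e * s                               ∎
      where open ≤-Reasoning
    by : ∀ q → k / suc e ≡ q → suc e ≤ 2 * (suc k / s) ⊎ H (suc M) (suc k) ≤ suc M ^ (2 * (suc k / s))
    by q k/e≡q with suc e ≤? 2 * (suc k / s)
    ... | yes e≤ = inj₁ e≤
    -- Here s = 1, so g is the whole degree and `H≤^` suffices.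
    by zero k/e≡0 | no e≰ = inj₂ (≤-trans (H≤^ M (suc k)) (^-monoʳ-≤ (suc M) (≤-trans (≤-reflexive (sym g≡k)) (m≤m+n _ _))))
      where
      g≡k : suc k / s ≡ suc k
      g≡k = trans (cong (λ q → suc k / suc q) k/e≡0) (n/1≡n (suc k))
    by (suc q) k/e≡ | no e≰ = contradiction too-small (<⇒≱ too-large)
      where
      open ≤-Reasoning
      g = suc k / s
      2g≤e : 2 * g ≤ e
      2g≤e = s≤s⁻¹ (≰⇒> e≰)
      -- (2g + 1)(s - 1) ≤ k and k + 1 < (g + 1)s are incompatible for s ≥ 2 and g ≥ 1.
      too-small : suc (2 * g) * suc q ≤ k
      too-small = begin
        suc (2 * g) * suc q       ≤⟨ *-monoˡ-≤ (suc q) (s≤s 2g≤e) ⟩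
        suc e * suc q             ≡⟨ cong (suc e *_) (sym k/e≡) ⟩
        suc e * (k / suc e)       ≡⟨ *-comm (suc e) _ ⟩
        k / suc e * suc e         ≤⟨ m/n*n≤m k (suc e) ⟩
        k                         ∎
      too-large : k < suc (2 * g) * suc q
      too-large = begin
        suc k                                 ≡⟨ m≡m%n+[m/n]*n (suc k) s ⟩
        suc k % s + g * s                     ≤⟨ +-monoˡ-≤ (g * s) (s≤s⁻¹ (m%n<n (suc k) s)) ⟩
        k / suc e + g * s                     ≡⟨ cong (λ q → q + g * suc q) k/e≡ ⟩
        suc q + g * suc (suc q)               ≤⟨ m≤m+n _ (g * q) ⟩
        suc q + g * suc (suc q) + g * q       ≡⟨ solve 2 (λ q g → con 1 :+ q :+ g :* (con 2 :+ q) :+ g :* q := (con 1 :+ con 2 :* g) :* (con 1 :+ q)) refl q g ⟩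
        suc (2 * g) * suc q                   ∎

  -- All that the count needs to know about walks: families of words such that every selection is
  -- the leading monomial of a derivative of order e.
  record LeadingGroups (m n e k l s g : ℕ) : Set where
    field
      groups      : List (List (List (Fin (m * (n * n)))))
      independent : Independent groups
      degree      : ∀ {u} → Selection groups u → length u ≡ k
      sizes       : All (λ C → length C ≡ l) groups
      number      : length groups ≡ e
      short       : All (All (λ w → length w ≤ s)) groups
      full        : All (All (λ w → length w ≡ s)) (take g groups)
      closed      : ∀ {u} → Selection groups u → ∃ λ w → length w ≡ e × ClosedWalk m n (incs w (incs u (replicate _ 0)))
                      × (∀ {γ} → ClosedWalk m n (incs w γ) → γ ≡ incs u (replicate _ 0)
                           ⊎ energy (step-weight m n) (incs u (replicate _ 0)) < energy (step-weight m n) γ)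

  leadingGroups : ∀ m n e k s g B l .{{_ : NonZero n}} → m ≡ e + k → 0 < e → k * B < n → k ≤ e * s → g * s ≤ k → l ≤ suc B * suc B →
                  LeadingGroups m n e k l s g
  leadingGroups m n e k s g B l m≡ 0<e kB<n k≤es gs≤k l≤ =
    by (runLengths e s k) (length-runLengths e s k) (sum-runLengths e s k k≤es) (runLengths-≤ e s k) (runLengths-≡ g e s k gs≤k)
      (trans (total-sum (runLengths e s k)) (trans (cong₂ _+_ (length-runLengths e s k) (sum-runLengths e s k k≤es)) (sym m≡)))
    where
    parts≤sum : ∀ rs → All (_≤ sum rs) rs
    parts≤sum []       = []
    parts≤sum (r ∷ rs) = m≤m+n r (sum rs) ∷ All.map (λ h → ≤-trans h (m≤n+m (sum rs) r)) (parts≤sum rs)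
    labels = gridLabels B l
    by : ∀ rs → length rs ≡ e → sum rs ≡ k → All (_≤ s) rs → All (_≡ s) (take g rs) → total rs ≡ m → LeadingGroups m n e k l s g
    by [] len _ _ _ _ = contradiction len (<⇒≢ 0<e)
    by rs@(r ∷ rs′) len sum≡ ≤s ≡s refl = record
      { groups      = groups labels rs v
      ; independent = groups-independent (gridLabels-unique B l) (gridLabels-small B l) rs v inj ≤k
      ; degree      = λ sel → trans (selection-length labels rs v sel) sum≡
      ; sizes       = All.map (λ eq → trans eq (length-gridLabels B l l≤)) (groups-lengths labels rs v)
      ; number      = trans (groups-length labels rs v) len
      ; short       = groups-words labels rs v ≤s
      ; full        = take-full g rs v ≡s
      ; closed      = closed
      }
      where
      open Runs n (m * (n * n))
      open Bounded k B kB<n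
      v = imm-variables (total rs) n
      inj : Injective v
      inj = imm-variables-injective (total rs) n
      ≤k : All (_≤ k) rs
      ≤k = subst (λ k → All (_≤ k) rs) sum≡ (parts≤sum rs)
      take-full : ∀ g rs v → All (_≡ s) (take g rs) → All (All (λ w → length w ≡ s)) (take g (groups labels rs v))
      take-full zero    rs       v h        = []
      take-full (suc g) []       v h        = []
      take-full (suc g) (r ∷ rs) v (eq ∷ h) = All.map⁺ (All.universal (λ lb → trans (length-run r 0 lb (v ∘ Fin.suc)) eq) labels)
        ∷ take-full g rs (v ∘ Fin.suc ∘ (r Fin.↑ʳ_)) h
      closed : ∀ {u} → Selection (groups labels rs v) u → ∃ λ w → length w ≡ e × ClosedWalk (total rs) n (incs w (incs u (replicate _ 0)))
        × (∀ {γ} → ClosedWalk (total rs) n (incs w γ) → γ ≡ incs u (replicate _ 0)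
             ⊎ energy (step-weight (total rs) n) (incs u (replicate _ 0)) < energy (step-weight (total rs) n) γ)
      closed sel with selection-labels labels rs v (node 0 0 (0 , 0)) sel
      ... | lb ∷ lbs , lb∈ VecAll.∷ lbs∈ , refl = jumps v x (schedule rs (lb ∷ lbs)) ,
        trans (length-jumps v x (schedule rs (lb ∷ lbs))) (trans (#jumps-schedule rs (lb ∷ lbs)) len) ,
        (x , scheduled-walk v x (schedule rs (lb ∷ lbs))) ,
        λ { {γ} (i , walk) → minimal {ℤ.+ 0} {i} {γ} (schedule-straight rs (lb ∷ lbs) ≤k small (ℤ.+ 0) x) walk }
        where
        -- Starting where the last run ends makes the walk closed; the first jump leads from there
        -- to the first run.
        x = endpoint (node r 0 lb) (steps r 0 lb (schedule rs′ lbs))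
        ω = step-weight (total rs) n
        F = incs (frees v x (schedule rs (lb ∷ lbs))) (replicate _ 0)
        small : VecAll.All Small (lb ∷ lbs)
        small = VecAll.map (All.lookup (gridLabels-small B l)) (lb∈ VecAll.∷ lbs∈)
        minimal : ∀ {δ i γ} → Straight δ x (schedule rs (lb ∷ lbs)) → Walk (total rs) v i i (incs (jumps v x (schedule rs (lb ∷ lbs))) γ) →
          γ ≡ F ⊎ energy ω F < energy ω γ
        minimal (jump st) walk = closed-straight-minimal ω inj (step-weight-≡ (total rs) n) st refl walk

  zero-walk-minimal : ∀ m n .{{_ : NonZero n}} → 0 < m → ∃ λ u → ClosedWalk m n (incs u (replicate _ 0)) ×
    (∀ {γ} → ClosedWalk m n γ → γ ≡ incs u (replicate _ 0)
       ⊎ energy (node-weight m n) (incs u (replicate _ 0)) < energy (node-weight m n) γ)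
  zero-walk-minimal m n@(suc _) 0<m = zero-walk m v , (Fin.zero , zero-walk-walk m v) , minimal
    where
    v = imm-variables m n
    ω = node-weight m n
    minimal : ∀ {γ} → ClosedWalk m n γ → γ ≡ incs (zero-walk m v) (replicate _ 0) ⊎ energy ω (incs (zero-walk m v) (replicate _ 0)) < energy ω γ
    minimal {γ} (i , walk) with energy ω γ in eq
    ... | zero  = inj₁ (zero-walk-unique m v ω (node-weight-≡ m n) (inj₂ 0<m) walk eq)
    ... | suc E = inj₂ (subst (_< suc E) (sym (zero-walk-energy m v ω (node-weight-≡ m n))) (s≤s z≤n))

  good-monomials′ : ∀ {N} P M s L τ k G g (Cs : List (List (List (Fin N)))) → N ≡ suc P + M →
    (let K = 2 * (g * L); n = M * suc (2 * s * K)) →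
    Independent Cs → (∀ {u} → Selection Cs u → length u ≡ k) → g ≤ length Cs →
    All (λ C → length C ≡ n) Cs → All (All (λ w → length w ≤ s)) Cs → All (All (λ w → length w ≡ s)) (take g Cs) →
    0 < M → 0 < P → 0 < g → 0 < L → L ≤ n → length Cs ≤ 2 ^ M →
    2 * s * (P + M) ≤ suc (2 * s) * suc P → 2 * G ≤ L ^ g →
    ∃ λ ks → Unique ks × (∀ κ → κ ∈ ks → Good τ Cs κ) ×
      (G * H N τ ≤ length ks ⊎ H N (τ + k) ≤ length ks + H (suc P) (τ + k))
  good-monomials′ P M s L τ k G g Cs refl ind deg g≤ sizes short full 0<M 0<P 0<g 0<L L≤n e≤ sP≤ 2G≤ =
    by (take g Cs) (drop g Cs) (List.take++drop≡id g Cs) full (trans (List.length-take g Cs) (m≤n⇒m⊓n≡m g≤))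
    where
    by : ∀ Bs Rs → Bs ++ Rs ≡ Cs → All (All (λ w → length w ≡ s)) Bs → length Bs ≡ g → _
    by Bs Rs refl full refl = good-monomials P M s L τ k G Bs Rs ind deg sizes short full 0<M 0<P 0<g 0<L L≤n e≤ sP≤ 2G≤

  -- The reason for the hypothesis n > m⁵: the labels of a block are pairs of numbers up to m⁴.
  label-count : ∀ m e k s g → m ≡ e + k → 0 < e → 0 < k → g * s ≤ k →
    (let M = m * m) → ∀ L → (e ≡ 1 × L ≡ 2 * M) ⊎ (1 < e × L ≡ 2 * (M * M)) →
    M * suc (2 * s * (2 * (g * L))) ≤ suc (m ^ 4) * suc (m ^ 4)
  label-count m e k s g m≡ 0<e 0<k gs≤k L h = begin
    M * suc (2 * s * (2 * (g * L)))   ≡⟨ solve 4 (λ M s g L → M :* (con 1 :+ con 2 :* s :* (con 2 :* (g :* L))) := M :+ M :* (con 4 :* (g :* s) :* L)) refl M s g L ⟩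
    M + M * (4 * (g * s) * L)         ≤⟨ +-mono-≤ M≤ (*-monoʳ-≤ M (bound h)) ⟩
    2 * (M * M) + M * (M * (M * M))   ≤⟨ n≤1+n _ ⟩
    suc (2 * (M * M) + M * (M * (M * M)))
      ≡⟨ solve 1 (λ m → con 1 :+ (con 2 :* (m :* m :* (m :* m)) :+ m :* m :* (m :* m :* (m :* m :* (m :* m))))
                     := (con 1 :+ m :* (m :* (m :* (m :* con 1)))) :* (con 1 :+ m :* (m :* (m :* (m :* con 1))))) refl m ⟩
    suc (m ^ 4) * suc (m ^ 4)         ∎
    where
    open ≤-Reasoning
    M = m * m
    2≤m : 2 ≤ m
    2≤m = ≤-trans (+-mono-≤ 0<e 0<k) (≤-reflexive (sym m≡))
    1≤M : 1 ≤ M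
    1≤M = *-mono-≤ {1} {m} {1} {m} (≤-trans (s≤s z≤n) 2≤m) (≤-trans (s≤s z≤n) 2≤m)
    M≤ : M ≤ 2 * (M * M)
    M≤ = ≤-trans (≤-trans (≤-reflexive (sym (*-identityʳ M))) (*-monoʳ-≤ M 1≤M)) (m≤m+n _ _)
    -- For e ≥ 2 the estimate 8k ≤ (k + 2)² ≤ M leaves room for L = 2M². For e = 1 one has m = k +
    -- 1, and 8k ≤ (k + 1)² fails for small k; the weaker 8k ≤ (k + 1)⁴ = M² allows L = 2M.
    bound : (e ≡ 1 × L ≡ 2 * M) ⊎ (1 < e × L ≡ 2 * (M * M)) → 4 * (g * s) * L ≤ M * (M * M)
    8k≤ : ∀ k → 0 < k → 8 * k ≤ (suc k * suc k) * (suc k * suc k)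
    8k≤ (suc j) _ = begin
      8 * suc j ≤⟨ m≤m+n _ _ ⟩
      8 * suc j + (8 + 24 * j + 24 * (j * j) + 8 * (j * j * j) + j * j * (j * j))
        ≡⟨ solve 1 (λ j → con 8 :* (con 1 :+ j) :+ (con 8 :+ con 24 :* j :+ con 24 :* (j :* j) :+ con 8 :* (j :* j :* j) :+ j :* j :* (j :* j))
             := (con 2 :+ j) :* (con 2 :+ j) :* ((con 2 :+ j) :* (con 2 :+ j))) refl j ⟩
      (2 + j) * (2 + j) * ((2 + j) * (2 + j)) ∎
    8k≤[2+k]² : ∀ k → 8 * k ≤ (2 + k) * (2 + k)
    8k≤[2+k]² zero          = z≤n
    8k≤[2+k]² (suc zero)    = n≤1+n 8
    8k≤[2+k]² (suc (suc j)) = begin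
      8 * (2 + j)             ≤⟨ m≤m+n _ (j * j) ⟩
      8 * (2 + j) + j * j     ≡⟨ solve 1 (λ j → con 8 :* (con 2 :+ j) :+ j :* j := (con 4 :+ j) :* (con 4 :+ j)) refl j ⟩
      (4 + j) * (4 + j)       ∎
    bound (inj₁ (refl , refl)) = begin
      4 * (g * s) * (2 * M)   ≤⟨ *-monoˡ-≤ (2 * M) (*-monoʳ-≤ 4 gs≤k) ⟩
      4 * k * (2 * M)         ≡⟨ solve 2 (λ k M → con 4 :* k :* (con 2 :* M) := M :* (con 8 :* k)) refl k M ⟩
      M * (8 * k)             ≤⟨ *-monoʳ-≤ M (≤-trans (8k≤ k 0<k) (≤-reflexive (cong (λ m → m * m * (m * m)) (sym m≡)))) ⟩
      M * (M * M)             ∎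
    bound (inj₂ (1<e , refl)) = begin
      4 * (g * s) * (2 * (M * M))   ≤⟨ *-monoˡ-≤ (2 * (M * M)) (*-monoʳ-≤ 4 gs≤k) ⟩
      4 * k * (2 * (M * M))         ≡⟨ solve 2 (λ k M → con 4 :* k :* (con 2 :* (M :* M)) := con 8 :* k :* (M :* M)) refl k M ⟩
      8 * k * (M * M)               ≤⟨ *-monoˡ-≤ (M * M) (≤-trans (8k≤[2+k]² k) (*-mono-≤ 2+k≤m 2+k≤m)) ⟩
      M * (M * M)                   ∎
      where
      2+k≤m : 2 + k ≤ m
      2+k≤m = ≤-trans (+-monoˡ-≤ k 1<e) (≤-reflexive (sym m≡))

open Schedules

-- Comparison of the two dimensions.

module Comparison {c ℓ} (R : CommutativeRing c ℓ)
    (domain : NoZeroDivisors R) (char0 : CharacteristicZero R) where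
  open import Data.Nat.Base
    using (_+_; _*_; _^_; _≤_; _<_; z≤n; s≤s; NonZero; >-nonZero; >-nonZero⁻¹)
  open import Data.Nat.Properties
  open import Data.Nat.Solver using (module +-*-Solver)
  open +-*-Solver using (solve; _:=_; _:+_; _:*_; con)
  open Polynomials R using (S; ShiftedPartials; DimShiftedPartials; substitute; IMM)
  open Bounds R domain char0
  open LowerBound R domain char0

  module _ {m n e τ a b : ℕ} (ℓs : Fin (m * m) → S 1 (m * (n * n))) (p : S m (m * m))
           (m⁵<n : m ^ 5 < n) (e≤m : e ≤ m) (0<m : 0 < m)
           (dim-p : DimShiftedPartials e τ (substitute ℓs p) a)
           (dim-IMM : DimShiftedPartials e τ (IMM m n) b) where

    M N k : ℕ
    M = m * m
    N = m * (n * n)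
    k = m ∸ e

    instance
      n≢0 : NonZero n
      n≢0 = >-nonZero (≤-<-trans z≤n m⁵<n)
      M≢0 : NonZero M
      M≢0 = >-nonZero (*-mono-≤ {1} {m} {1} {m} 0<m 0<m)

    m≡e+k : m ≡ e + k
    m≡e+k = sym (m+[n∸m]≡n e≤m)

    kB<n : k * m ^ 4 < n
    kB<n = ≤-<-trans (*-monoˡ-≤ (m ^ 4) (m∸n≤m m e)) m⁵<n

    -- The shifts of a single leading monomial; this is enough for e = 0 and for e = m.
    single-leading : ∀ (ω : Fin N → ℕ) (w u : List (Fin N)) → length w ≡ e →
      ClosedWalk m n (incs w (incs u (replicate _ 0))) →
      (∀ {γ} → ClosedWalk m n (incs w γ) → γ ≡ incs u (replicate _ 0) ⊎ energy ω (incs u (replicate _ 0)) < energy ω γ) →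
      H N τ ≤ b
    single-leading ω w u len walk minimal = subst (_≤ b) (trans (List.length-map (incs u) (mons N τ)) (length-mons N τ))
      (dimension-≥-leading (energy ω) (map (incs u) (mons N τ)) (Unique.map⁺ (incs-injective u) (mons-unique N τ)) dim-IMM leading)
      where
      leading : ∀ κ → κ ∈ map (incs u) (mons N τ) → ∃ λ f → ShiftedPartials e τ (IMM m n) f × Leading (energy ω) κ f
      leading κ κ∈ with ∈-map⁻ (incs u) κ∈
      ... | β , β∈ , refl = leading-partial m n ω w u len walk minimal β (mons-sound N τ β∈)

    good-leading : ∀ {l s g} (LG : LeadingGroups m n e k l s g) (ks : List (Vec ℕ N)) → Unique ks →
      (∀ κ → κ ∈ ks → Good τ (LeadingGroups.groups LG) κ) → length ks ≤ b
    good-leading LG ks unique good = dimension-≥-leading (energy (step-weight m n)) ks unique dim-IMM leading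
      where
      leading : ∀ κ → κ ∈ ks → ∃ λ f → ShiftedPartials e τ (IMM m n) f × Leading (energy (step-weight m n)) κ f
      leading κ κ∈ with good κ κ∈
      ... | u , β , sel , refl , ≡τ with LeadingGroups.closed LG sel
      ...   | w , len , walk , minimal = leading-partial m n (step-weight m n) w u len walk minimal β ≡τ

    a≤G*H : ∀ {G} → (G ≡ M ^ e ⊎ G ≡ H M k) → a ≤ G * H N τ
    a≤G*H (inj₁ refl) = Substituted.dimension-≤-operators {τ = τ} ℓs p e≤m dim-p
    a≤G*H (inj₂ refl) = Substituted.dimension-≤-monomials {τ = τ} ℓs p e≤m dim-p

    -- The M variables are few among all N; this yields the hypothesis of `many-avoided-is-rare`
    -- that relates s, P and M.
    big-N : ∀ s → 2 ≤ m → s ≤ k → 0 < e → suc (2 * s) * M ≤ N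
    big-N s 2≤m s≤k 0<e = begin
      suc (2 * s) * M         ≤⟨ *-monoˡ-≤ M (≤-trans (s≤s (*-monoʳ-≤ 2 s≤k)) (≤-trans (≤-reflexive (+-comm 1 (2 * k))) (≤-trans (+-monoʳ-≤ (2 * k) (≤-trans 0<e (m≤m+n e (e + 0))))
                                   (≤-trans (≤-reflexive (trans (+-comm (2 * k) (2 * e)) (sym (*-distribˡ-+ 2 e k)))) (*-monoʳ-≤ 2 (≤-reflexive (sym m≡e+k)))))))  ⟩
      2 * m * M               ≡⟨ solve 1 (λ m → con 2 :* m :* (m :* m) := m :* (con 2 :* (m :* m))) refl m ⟩
      m * (2 * M)             ≤⟨ *-monoʳ-≤ m (≤-trans (*-monoˡ-≤ M (≤-trans 2≤m m≤M)) (*-mono-≤ M≤n M≤n)) ⟩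
      m * (n * n)             ∎
      where
      open ≤-Reasoning
      m≤M : m ≤ M
      m≤M = ≤-trans (≤-reflexive (sym (*-identityʳ m))) (*-monoʳ-≤ m 0<m)
      M≤n : M ≤ n
      M≤n = ≤-trans (≤-reflexive (cong (m *_) (sym (*-identityʳ m)))) (≤-trans (^-monoʳ-≤ m {{>-nonZero 0<m}} {2} {5} (s≤s (s≤s z≤n))) (<⇒≤ m⁵<n))

    compare-generic : 0 < e → 0 < k → a ≤ b
    compare-generic 0<e 0<k = split (generators-bound (m≤n⇒m<n∨m≡n 0<e))
      where
      open ≤-Reasoning
      0<M : 0 < M
      0<M = >-nonZero⁻¹ M
      open Blocks (blocks M e k 0<M 0<e 0<k)
      s≤k : s ≤ k
      s≤k = ≤-trans (m≤n*m s g {{>-nonZero 0<g}}) gs≤k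
      2≤m : 2 ≤ m
      2≤m = ≤-trans (+-mono-≤ 0<e 0<k) (≤-reflexive (sym m≡e+k))
      3M≤N : suc (2 * s) * M ≤ N
      3M≤N = big-N s 2≤m s≤k 0<e
      2+M≤N : suc (suc M) ≤ N
      2+M≤N = ≤-trans (≤-trans (+-mono-≤ {1} {M} 0<M (+-mono-≤ {1} {M} 0<M ≤-refl))
        (≤-trans (≤-reflexive (solve 1 (λ M → M :+ (M :+ M) := con 3 :* M) refl M)) (*-monoˡ-≤ M (s≤s (*-monoʳ-≤ 2 0<s))))) 3M≤N
      -- `suc P` = N - M is the number of variables that remain when M are avoided.
      P : ℕ
      P = N ∸ suc M
      N≡ : N ≡ suc P + M
      N≡ = trans (sym (m∸n+n≡m (<⇒≤ 2+M≤N))) (+-suc P M)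
      few-x : 2 * s * (P + M) ≤ suc (2 * s) * suc P
      few-x = begin
        2 * s * (P + M)           ≡⟨ *-distribˡ-+ (2 * s) P M ⟩
        2 * s * P + 2 * s * M     ≤⟨ +-monoʳ-≤ (2 * s * P) (+-cancelˡ-≤ M _ _ (≤-trans 3M≤N (≤-reflexive (trans N≡ (+-comm (suc P) M))))) ⟩
        2 * s * P + suc P         ≤⟨ +-monoˡ-≤ (suc P) (*-monoʳ-≤ (2 * s) (n≤1+n P)) ⟩
        2 * s * suc P + suc P     ≡⟨ +-comm (2 * s * suc P) (suc P) ⟩
        suc (2 * s) * suc P       ∎
      generators-bound : 1 < e ⊎ 1 ≡ e → ∃ λ G → ∃ λ L → (G ≡ M ^ e ⊎ G ≡ H M k) × 2 * G ≤ L ^ g × 0 < L × ((e ≡ 1 × L ≡ 2 * M) ⊎ (1 < e × L ≡ 2 * (M * M)))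
      -- For e = 1 there are M derivatives, and a single factor L = 2M is already 2G.
      generators-bound (inj₂ 1≡e) = M ^ e , 2 * M , inj₁ refl ,
        ≤-trans (≤-reflexive (cong (2 *_) (trans (cong (M ^_) (sym 1≡e)) (*-identityʳ M))))
          (≤-trans (≤-reflexive (sym (*-identityʳ (2 * M)))) (^-monoʳ-≤ (2 * M) {{m*n≢0 2 M}} 0<g)) ,
        *-mono-≤ {1} {2} {1} {M} (s≤s z≤n) 0<M , inj₁ (sym 1≡e , refl)
      -- With L = 2M² the power L^g = 2^g M^(2g) is at least twice the G for which `Blocks` vouches.
      generators-bound (inj₁ 1<e) = by generators
        where
        2M^2g≤ : ∀ {G} → G ≤ M ^ (2 * g) → 2 * G ≤ (2 * (M * M)) ^ g
        2M^2g≤ {G} G≤ = begin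
          2 * G                   ≤⟨ *-mono-≤ {2} {2 ^ g} (^-monoʳ-≤ 2 0<g) G≤ ⟩
          2 ^ g * M ^ (2 * g)     ≡⟨ cong (2 ^ g *_) (trans (sym (^-*-assoc M 2 g)) (cong (λ x → (M * x) ^ g) (*-identityʳ M))) ⟩
          2 ^ g * (M * M) ^ g     ≡⟨ sym (^-distribʳ-* 2 (M * M) g) ⟩
          (2 * (M * M)) ^ g       ∎
        0<L : 0 < 2 * (M * M)
        0<L = *-mono-≤ {1} {2} {1} {M * M} (s≤s z≤n) (*-mono-≤ 0<M 0<M)
        by : e ≤ 2 * g ⊎ H M k ≤ M ^ (2 * g) → _
        by (inj₁ e≤2g) = M ^ e , 2 * (M * M) , inj₁ refl , 2M^2g≤ (^-monoʳ-≤ M e≤2g) , 0<L , inj₂ (1<e , refl)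
        by (inj₂ H≤)   = H M k , 2 * (M * M) , inj₂ refl , 2M^2g≤ H≤ , 0<L , inj₂ (1<e , refl)
      split : (∃ λ G → ∃ λ L → (G ≡ M ^ e ⊎ G ≡ H M k) × 2 * G ≤ L ^ g × 0 < L × ((e ≡ 1 × L ≡ 2 * M) ⊎ (1 < e × L ≡ 2 * (M * M)))) → a ≤ b
      split (G , L , G≡ , 2G≤ , 0<L , L≡) = conclude
        (good-monomials′ P M s L τ k G g groups N≡ independent degree g≤ sizes short full
          0<M (m<n⇒0<n∸m 2+M≤N) 0<g 0<L L≤l number≤ few-x 2G≤)
        where
        l : ℕ
        l = M * suc (2 * s * (2 * (g * L)))
        LG : LeadingGroups m n e k l s g
        LG = leadingGroups m n e k s g (m ^ 4) l m≡e+k 0<e kB<n k≤es gs≤k (label-count m e k s g m≡e+k 0<e 0<k gs≤k L L≡)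
        open LeadingGroups LG
        g≤ : g ≤ length groups
        g≤ = ≤-trans (*-cancelʳ-≤ g e s {{>-nonZero 0<s}} (≤-trans gs≤k k≤es)) (≤-reflexive (sym number))
        number≤ : length groups ≤ 2 ^ M
        number≤ = ≤-trans (≤-reflexive number) (≤-trans e≤m (≤-trans (n≤2^n m) (^-monoʳ-≤ 2 (m≤m*n m m {{>-nonZero 0<m}}))))
        L≤l : L ≤ l
        L≤l = begin
          L                               ≤⟨ m≤n*m L g {{>-nonZero 0<g}} ⟩
          g * L                           ≤⟨ m≤n*m (g * L) 2 ⟩
          2 * (g * L)                     ≤⟨ m≤n*m (2 * (g * L)) (2 * s) {{m*n≢0 2 s {{_}} {{>-nonZero 0<s}}}} ⟩
          2 * s * (2 * (g * L))           ≤⟨ n≤1+n _ ⟩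
          suc (2 * s * (2 * (g * L)))     ≤⟨ m≤n*m _ M ⟩
          l                               ∎
        conclude : (∃ λ ks → Unique ks × (∀ κ → κ ∈ ks → Good τ groups κ) ×
          (G * H N τ ≤ length ks ⊎ H N (τ + k) ≤ length ks + H (suc P) (τ + k))) → a ≤ b
        conclude (ks , unique , good , inj₁ le) = ≤-trans (a≤G*H G≡) (≤-trans le (good-leading LG ks unique good))
        -- Both dimensions are compared through their codimensions among all forms of degree τ + k;
        -- the common term `H (suc P) (τ + k)` cancels.
        conclude (ks , unique , good , inj₂ le) = ≤-trans
          (+-cancelʳ-≤ (H (suc P) (τ + k)) a (length ks)
            (≤-trans (dimension-≤-codimension {τ = τ} ℓs p (0<n∸m⇒m<n 0<k) (suc P) (sym N≡) dim-p) le))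
          (good-leading LG ks unique good)
          where
          0<n∸m⇒m<n : 0 < m ∸ e → e < m
          0<n∸m⇒m<n h = m∸n≢0⇒n<m (λ eq → <⇒≢ h (sym eq))

    compare : a ≤ b
    compare with e ≟ 0 | k ≟ 0
    -- Without derivatives p itself is the only form to be shifted, so the upper bound is H N τ.
    ... | yes e≡0 | _ = let (u , walk , minimal) = zero-walk-minimal m n 0<m in
      ≤-trans (a≤G*H (inj₁ refl)) (≤-trans (≤-reflexive (trans (cong (λ e → M ^ e * H N τ) e≡0) (*-identityˡ _)))
        (single-leading (node-weight m n) [] u (sym e≡0) walk minimal))
    -- All runs are empty and every edge is prescribed, so the single label (0 , 0) is enough; the
    -- upper bound is again H N τ, as H M 0 = 1.
    ... | no  e≢0 | yes k≡0 = let
        LG = leadingGroups m n e k 0 0 0 1 m≡e+k (n≢0⇒n>0 e≢0) (subst (_< n) (sym (*-zeroʳ k)) (>-nonZero⁻¹ n))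
               (≤-trans (≤-reflexive k≡0) z≤n) z≤n ≤-refl
        (u , sel) = selection-exists (s≤s z≤n) (LeadingGroups.groups LG) (LeadingGroups.sizes LG)
        (w , len , walk , minimal) = LeadingGroups.closed LG sel
      in ≤-trans (a≤G*H (inj₂ refl)) (≤-trans (≤-reflexive (trans (cong (_* H N τ) (trans (cong (H M) k≡0) (H-degree-0 M))) (*-identityˡ _)))
        (single-leading (step-weight m n) w u len walk minimal))
    ... | no  e≢0 | no  k≢0 = compare-generic (n≢0⇒n>0 e≢0) (n≢0⇒n>0 k≢0)

open import Defs
open import Data.Nat.Base using (ℕ; _*_; _^_; _≤_; _<_)

theorem2 : ∀ (m n : ℕ) → 1 ≤ m → 1 ≤ n → m ^ 5 < n →
    (ι : S 1 (m * m) → S 1 (m * (n * n))) → IsLinearInclusion ι →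
    ∀ (e τ : ℕ) → e ≤ m →
    ∀ (a b : ℕ) →
    DimShiftedPartials e τ (Sᵈ[ ι ] (perm m)) a →
    DimShiftedPartials e τ (IMM m n) b →
    a ≤ b
theorem2 m n 1≤m _ m⁵<n ι _ e τ e≤m a b dim-perm dim-IMM =
  Comparison.compare ℂ (λ {w} {z} → ℂ-Domain.ℂ-domain {w} {z}) ℂ-Domain.ℂ-char0
    (ι ∘ var) (perm m) m⁵<n e≤m 1≤m dim-perm dim-IMM
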